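{- There is an absolute constant $C>0$ such that for every integer $N\ge 2$ and every $u\in\mathbb{Z}_N$, there exists a simple planar graph $G$ on at most $C\log_2 N$ vertices with $\tau(G)\equiv u \pmod N$.
   Context: For a graph $G$, $\tau(G)$ denotes the number of spanning trees of $G$. -}

module Defs where

open import Data.Nat as ℕ using (ℕ; suc)
open import Data.Fin using (Fin)
open import Data.Fin.Subset using (Subset; _∈_)
open import Data.Product using (_×_; _,_; Σ; ∃; ∃-syntax; proj₁; proj₂)
open import Data.Sum using (_⊎_)
open import Data.List using (List; []; _∷_; length)
open import Data.List.Relation.Unary.Unique.Propositional using (Unique)
import Data.List.Membership.Propositional as LM
open import Data.Rational as ℚ using (ℚ; 0ℚ; 1ℚ)
open import Relation.Binary.PropositionalEquality using (_≡_; _≢_)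
open import Relation.Nullary using (¬_)

-- Finite simple graphs on vertex set Fin n, with edges indexed by Fin m.
-- Edge e joins the vertices  proj₁ (ends e) < proj₂ (ends e)
-- (so no loops), and distinct edges have distinct end-pairs
-- (so no multiple edges).

record SimpleGraph : Set where
  field
    n      : ℕ
    m      : ℕ
    ends   : Fin m → Fin n × Fin n
    ordered : ∀ e → proj₁ (ends e) Data.Fin.< proj₂ (ends e)
    nomulti : ∀ e f → ends e ≡ ends f → e ≡ f

open SimpleGraph public

Incident : (G : SimpleGraph) → Fin (m G) → Fin (n G) → Set
Incident G e v = (proj₁ (ends G e) ≡ v) ⊎ (proj₂ (ends G e) ≡ v)

Joins : (G : SimpleGraph) → Fin (m G) → Fin (n G) → Fin (n G) → Set
Joins G e u w = (ends G e ≡ (u , w)) ⊎ (ends G e ≡ (w , u))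

data Walk (G : SimpleGraph) (S : Subset (m G)) : Fin (n G) → Fin (n G) → Set where
  nil  : ∀ {u} → Walk G S u u
  cons : ∀ {u w v} (e : Fin (m G)) → e ∈ S → Joins G e u w →
         Walk G S w v → Walk G S u v

walkEdges : ∀ {G S u v} → Walk G S u v → List (Fin (m G))
walkEdges nil             = []
walkEdges (cons e _ _ w)  = e ∷ walkEdges w

-- A cycle in the spanning subgraph (V, S): a closed walk of positive
-- length with no repeated edge (closed trail).  In a simple graph such a
-- closed trail exists iff the subgraph contains a cycle.
HasCycle : (G : SimpleGraph) → Subset (m G) → Set
HasCycle G S = ∃[ u ] Σ (Walk G S u u) λ w →
  (1 ℕ.≤ length (walkEdges w)) × Unique (walkEdges w)

IsSpanningTree : (G : SimpleGraph) → Subset (m G) → Set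
IsSpanningTree G S = (∀ u v → Walk G S u v) × ¬ HasCycle G S

NumSpanningTrees : SimpleGraph → ℕ → Set
NumSpanningTrees G k = Σ (List (Subset (m G))) λ L →
  Unique L × (∀ T → T LM.∈ L → IsSpanningTree G T)
           × (∀ T → IsSpanningTree G T → T LM.∈ L)
           × length L ≡ k

-- Planarity, via straight-line crossing-free drawings in ℚ²
-- (equivalent to planarity by Fáry's theorem).

Point : Set
Point = ℚ × ℚ

OnSegAt : ℚ → Point → Point → Point → Set
OnSegAt t p a b =
  (proj₁ p ≡ proj₁ a ℚ.+ t ℚ.* (proj₁ b ℚ.- proj₁ a)) ×
  (proj₂ p ≡ proj₂ a ℚ.+ t ℚ.* (proj₂ b ℚ.- proj₂ a))

OnSeg : Point → Point → Point → Set
OnSeg p a b = ∃[ t ] (0ℚ ℚ.≤ t) × (t ℚ.≤ 1ℚ) × OnSegAt t p a b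

Seg : (G : SimpleGraph) → (Fin (n G) → Point) → Fin (m G) → Point × Point
Seg G pos e = pos (proj₁ (ends G e)) , pos (proj₂ (ends G e))

OnEdge : (G : SimpleGraph) → (Fin (n G) → Point) → Point → Fin (m G) → Set
OnEdge G pos p e = OnSeg p (proj₁ (Seg G pos e)) (proj₂ (Seg G pos e))

record PlaneDrawing (G : SimpleGraph) : Set where
  field
    pos : Fin (n G) → Point
    pos-inj : ∀ u v → pos u ≡ pos v → u ≡ v
    vertex-off-edge : ∀ v e → ¬ Incident G e v → ¬ OnEdge G pos (pos v) e
    edges-meet-at-ends : ∀ e f → e ≢ f → ∀ p →
      OnEdge G pos p e → OnEdge G pos p f →
      ∃[ v ] Incident G e v × Incident G f v × (pos v ≡ p)

Planar : SimpleGraph → Set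
Planar G = PlaneDrawing G

{-# OPTIONS --safe #-}
-- Graphs are built from left to right around two hubs A and B.  The numbers of spanning forests, sorted by
-- the partition they induce on A, B and the current vertex, form a vector on which every construction step
-- acts linearly.  Two matrices of SL₂ generate more than N⁴ words of length O(log N), so two words have the
-- same product modulo N; running one word forwards and the other one reflected gives a gadget with O(log N)
-- vertices that acts modulo N as a rotation by a right angle.  Two such gadgets between fixed pieces form a
-- block that resets a chain, t ↦ y (β + ξ) - t and y ↦ - y, where ξ is any number whose base 36 digits are
-- 14 or 15 and was written into the chain beforehand.  The sum of 35 such numbers takes every residue.
module Submission where

open import Defs
open import Data.Bool using (Bool; true; false; if_then_else_)
open import Data.Empty using (⊥; ⊥-elim)
open import Data.Fin as Fin using (Fin; toℕ; fromℕ<)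
import Data.Fin.Properties as Fin
open import Data.List as List using (List; []; _∷_; _++_; length; map; replicate)
open import Data.List.Membership.Propositional.Properties using (∈-lookup)
open import Data.List.Properties using (length-map; length-++; ++-assoc; ++-identityʳ; map-++; ∷-injective)
open import Data.List.Relation.Unary.All as All using (All; []; _∷_)
import Data.List.Relation.Unary.All.Properties as All
open import Data.List.Relation.Unary.Unique.Propositional using (Unique; []; _∷_)
open import Data.Nat as ℕ using (ℕ; zero; suc; _≤_; _<_; _≟_; z≤n; s≤s; _^_; NonZero)
import Data.Nat.Properties as ℕ
open import Data.Product using (_×_; _,_; Σ; ∃-syntax; ∃₂; proj₁; proj₂)
open import Data.Sum using (_⊎_; inj₁; inj₂; [_,_]′)
open import Function using (id; _∘_)
open import Relation.Binary.PropositionalEquality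
  using (_≡_; _≢_; refl; sym; trans; cong; cong₂; subst; subst₂; module ≡-Reasoning)
open import Relation.Nullary using (¬_; Dec; yes; no)

-- After a chain, `y` and `t` count the forests that keep the hubs apart and those that connect
-- them, so t / y is the effective conductance between A and B; chains glued only at the hubs are in
-- parallel, and conductances add. What is wanted is thus a chain with y a fixed unit modulo N and t
-- prescribed. Steps and spokes have determinant 1, so they cannot multiply a stored number by a
-- base while keeping its unit part; pendant paths supply the determinant 36, hence the base.
-- Writing ξ this way leaves y proportional to 1 + 2 ξ, which the reset must clear. The reset matrix
-- has negative entries, so it can be realised only modulo N, which is why a collision of words is
-- sought. The collision controls the action on (x, y) alone; what a turn does to r and t stays
-- unknown. Hence two turns per block, run on opposite vectors, so that the changes of r cancel, and
-- an invariant quadratic form that recovers t from r. The offset β stays unknown, but it is the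
-- same for every chain of the graph and is subtracted from the target. Two digits per register do
-- not fill a residue system; sums of 35 of them take 36 consecutive values, a full digit in base
-- 36.

module SpanningTrees where

  open import Data.Fin using (zero; suc)
  open import Data.Fin.Subset using (Subset; inside; outside; _∈_)
  open import Data.List.Membership.Propositional using () renaming (_∈_ to _∈ˡ_)
  open import Data.List.Membership.Propositional.Properties
    using (∈-map⁺; ∈-map⁻; ∈-++⁺ˡ; ∈-++⁺ʳ; ∈-++⁻)
  open import Data.List.Relation.Unary.Any using (here; there)
  import Data.List.Relation.Unary.Unique.Propositional.Properties as U
  open import Data.Vec using (Vec; []; _∷_; lookup)
  open import Data.Vec.Properties using (lookup⇒[]=; []=⇒lookup; ∷-injectiveʳ)

  Edge : Set
  Edge = ℕ × ℕ

  Lab : Set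
  Lab = ℕ → ℕ

  relabel : ℕ → ℕ → ℕ → ℕ
  relabel a b c with c ≟ b
  ... | yes _ = a
  ... | no  _ = c

  relabel-hit : ∀ a {b c} → c ≡ b → relabel a b c ≡ a
  relabel-hit a {b} {c} eq with c ≟ b
  ... | yes _  = refl
  ... | no c≢b = ⊥-elim (c≢b eq)

  relabel-miss : ∀ a {b c} → c ≢ b → relabel a b c ≡ c
  relabel-miss a {b} {c} c≢b with c ≟ b
  ... | yes eq = ⊥-elim (c≢b eq)
  ... | no _   = refl

  merge : Lab → ℕ → ℕ → Lab
  merge lab u w = relabel (lab u) (lab w) ∘ lab

  AllSame : ℕ → Lab → Set
  AllSame n lab = ∀ {z} → z < n → lab z ≡ lab 0

  allSame? : ∀ n lab → Dec (AllSame n lab)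
  allSame? n lab = ℕ.allUpTo? (λ z → lab z ≟ lab 0) n

  -- Kruskal's greedy rule: an edge may be selected only if its endpoints still carry different labels.
  data Kruskal (n : ℕ) : (es : List Edge) → Lab → Subset (length es) → Set where
    done : ∀ {lab} → AllSame n lab → Kruskal n [] lab []
    skip : ∀ {e es lab T} → Kruskal n es lab T → Kruskal n (e ∷ es) lab (outside ∷ T)
    take : ∀ {u w es lab T} → lab u ≢ lab w → Kruskal n es (merge lab u w) T →
           Kruskal n ((u , w) ∷ es) lab (inside ∷ T)

  trees : (n : ℕ) (es : List Edge) → Lab → List (Subset (length es))
  trees n [] lab with allSame? n lab
  ... | yes _ = [] ∷ []
  ... | no  _ = []
  trees n ((u , w) ∷ es) lab with lab u ≟ lab w
  ... | yes _ = map (outside ∷_) (trees n es lab)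
  ... | no  _ = map (outside ∷_) (trees n es lab) ++ map (inside ∷_) (trees n es (merge lab u w))

  trees-sound : ∀ n es lab {T} → T ∈ˡ trees n es lab → Kruskal n es lab T
  trees-sound n [] lab T∈ with allSame? n lab
  trees-sound n [] lab (here refl) | yes same = done same
  trees-sound n ((u , w) ∷ es) lab T∈ with lab u ≟ lab w
  ... | yes _ with T' , T'∈ , refl ← ∈-map⁻ _ T∈ = skip (trees-sound n es lab T'∈)
  ... | no u≢w with ∈-++⁻ (map (outside ∷_) (trees n es lab)) T∈
  ...   | inj₁ p with T' , T'∈ , refl ← ∈-map⁻ _ p = skip (trees-sound n es lab T'∈)
  ...   | inj₂ p with T' , T'∈ , refl ← ∈-map⁻ _ p = take u≢w (trees-sound n es _ T'∈)

  trees-complete : ∀ {n es lab T} → Kruskal n es lab T → T ∈ˡ trees n es lab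
  trees-complete {n} {lab = lab} (done same) with allSame? n lab
  ... | yes _ = here refl
  ... | no ¬s = ⊥-elim (¬s same)
  trees-complete {n} {(u , w) ∷ es} {lab} (skip k) with lab u ≟ lab w
  ... | yes _ = ∈-map⁺ _ (trees-complete k)
  ... | no  _ = ∈-++⁺ˡ (∈-map⁺ _ (trees-complete k))
  trees-complete {n} {(u , w) ∷ es} {lab} (take u≢w k) with lab u ≟ lab w
  ... | yes u≡w = ⊥-elim (u≢w u≡w)
  ... | no  _   = ∈-++⁺ʳ _ (∈-map⁺ _ (trees-complete k))

  trees-unique : ∀ n es lab → Unique (trees n es lab)
  trees-unique n [] lab with allSame? n lab
  ... | yes _ = [] ∷ []
  ... | no  _ = []
  trees-unique n ((u , w) ∷ es) lab with lab u ≟ lab w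
  ... | yes _ = U.map⁺ ∷-injectiveʳ (trees-unique n es lab)
  ... | no  _ = U.++⁺ (U.map⁺ ∷-injectiveʳ (trees-unique n es lab))
                      (U.map⁺ ∷-injectiveʳ (trees-unique n es _)) disjoint
    where
    disjoint : ∀ {T} → ¬ (T ∈ˡ map (outside ∷_) (trees n es lab) ×
                          T ∈ˡ map (inside ∷_) (trees n es (merge lab u w)))
    disjoint (p , q) with ∈-map⁻ _ p | ∈-map⁻ _ q
    ... | _ , _ , refl | _ , _ , ()

  -- Walks, trails and the correctness of the greedy rule

  module _ (G : SimpleGraph) where

    private
      V E : Set
      V = Fin (n G)
      E = Fin (m G)

      src tgt : E → V
      src e = proj₁ (ends G e)
      tgt e = proj₂ (ends G e)

      Sub : Set
      Sub = Subset (m G)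

    Level : (V → ℕ) → E → Set
    Level L e = L (src e) ≡ L (tgt e)

    level-joins : ∀ {L : V → ℕ} {e u w} → Level L e → Joins G e u w → L u ≡ L w
    level-joins {L} lev (inj₁ eq) = trans (cong (L ∘ proj₁) (sym eq)) (trans lev (cong (L ∘ proj₂) eq))
    level-joins {L} lev (inj₂ eq) = trans (cong (L ∘ proj₂) (sym eq)) (trans (sym lev) (cong (L ∘ proj₁) eq))

    walk-∈ : ∀ {S : Sub} {u v} (w : Walk G S u v) {e} → e ∈ˡ walkEdges w → e ∈ S
    walk-∈ (cons _ e∈S _ _) (here refl) = e∈S
    walk-∈ (cons _ _ _ w)   (there e∈w) = walk-∈ w e∈w

    walk-level : ∀ {S : Sub} {L : V → ℕ} {u v} (w : Walk G S u v) →
      (∀ {e} → e ∈ˡ walkEdges w → Level L e) → L u ≡ L v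
    walk-level nil            lev = refl
    walk-level (cons e _ j w) lev = trans (level-joins (lev (here refl)) j) (walk-level w (lev ∘ there))

    _++ʷ_ : ∀ {S : Sub} {a b c} → Walk G S a b → Walk G S b c → Walk G S a c
    nil          ++ʷ v = v
    cons e p j w ++ʷ v = cons e p j (w ++ʷ v)

    ++ʷ-∈ : ∀ {S : Sub} {a b c} (w : Walk G S a b) {v : Walk G S b c} {e} →
      e ∈ˡ walkEdges (w ++ʷ v) → e ∈ˡ walkEdges w ⊎ e ∈ˡ walkEdges v
    ++ʷ-∈ nil            e∈ = inj₂ e∈
    ++ʷ-∈ (cons _ _ _ w) (here eq) = inj₁ (here eq)
    ++ʷ-∈ (cons _ _ _ w) (there e∈) with ++ʷ-∈ w e∈
    ... | inj₁ p = inj₁ (there p)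
    ... | inj₂ p = inj₂ p

    flip-joins : ∀ {e u w} → Joins G e u w → Joins G e w u
    flip-joins (inj₁ eq) = inj₂ eq
    flip-joins (inj₂ eq) = inj₁ eq

    reverseʷ : ∀ {S : Sub} {a b} → Walk G S a b → Walk G S b a
    reverseʷ nil            = nil
    reverseʷ (cons e p j w) = reverseʷ w ++ʷ cons e p (flip-joins j) nil

    reverseʷ-∈ : ∀ {S : Sub} {a b} (w : Walk G S a b) {e} →
      e ∈ˡ walkEdges (reverseʷ w) → e ∈ˡ walkEdges w
    reverseʷ-∈ (cons e p j w) e∈ with ++ʷ-∈ (reverseʷ w) e∈
    ... | inj₁ q           = there (reverseʷ-∈ w q)
    ... | inj₂ (here refl) = here refl

    joins-end : ∀ {e a b c d} → Joins G e a b → Joins G e c d → c ≡ a ⊎ c ≡ b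
    joins-end (inj₁ p) (inj₁ q) = inj₁ (cong proj₁ (trans (sym q) p))
    joins-end (inj₁ p) (inj₂ q) = inj₂ (cong proj₂ (trans (sym q) p))
    joins-end (inj₂ p) (inj₁ q) = inj₂ (cong proj₁ (trans (sym q) p))
    joins-end (inj₂ p) (inj₂ q) = inj₁ (cong proj₂ (trans (sym q) p))

    TrailWithin : (S : Sub) → V → V → List E → Set
    TrailWithin S a b es = Σ (Walk G S a b) λ t → Unique (walkEdges t) × (∀ {e} → e ∈ˡ walkEdges t → e ∈ˡ es)

    suffix-after : ∀ {S : Sub} {a b e} (w : Walk G S a b) → Unique (walkEdges w) → e ∈ˡ walkEdges w →
      ∃[ c ] ∃[ d ] Joins G e c d × Σ (Walk G S d b) λ t →
        Unique (walkEdges t) × ¬ (e ∈ˡ walkEdges t) × (∀ {f} → f ∈ˡ walkEdges t → f ∈ˡ walkEdges w)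
    suffix-after (cons e _ j w) (fresh ∷ uniq) (here refl) =
      _ , _ , j , w , uniq , All.All¬⇒¬Any fresh , there
    suffix-after (cons _ _ _ w) (_ ∷ uniq) (there e∈w) with suffix-after w uniq e∈w
    ... | c , d , j , t , ut , e∉t , t⊆w = c , d , j , t , ut , e∉t , there ∘ t⊆w

    -- Cycles are closed trails, so a connecting walk must be freed of repeated edges. If the first
    -- edge e recurs, cut at the recurrence: the remainder starts at an end of e, and e is dropped
    -- if that end is the starting point and kept once otherwise.
    trail : ∀ {S : Sub} {a b} (w : Walk G S a b) → TrailWithin S a b (walkEdges w)
    trail nil = nil , [] , id
    trail {S} {a} (cons e p j w) with trail w
    ... | t , ut , t⊆w with Any? e (walkEdges t)
      where
      open import Data.List.Membership.DecPropositional (Fin._≟_ {m G}) using () renaming (_∈?_ to Any?)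
    ...   | no e∉t = cons e p j t , All.¬Any⇒All¬ _ e∉t ∷ ut , λ { (here eq) → here eq ; (there q) → there (t⊆w q) }
    ...   | yes e∈t with suffix-after t ut e∈t
    ...     | c , d , j′ , t′ , ut′ , e∉t′ , t′⊆t with joins-end j (flip-joins j′)
    ...       | inj₁ refl = t′ , ut′ , there ∘ t⊆w ∘ t′⊆t
    ...       | inj₂ refl = cons e p j t′ , All.¬Any⇒All¬ _ e∉t′ ∷ ut′ ,
                            λ { (here eq) → here eq ; (there q) → there (t⊆w (t′⊆t q)) }

    -- The pieces of the trail before and after `e₀` preserve labels, so the labels of a and b are
    -- carried to the two ends of `e₀`. A closed trail cannot leave a label class exactly once.
    walk-crosses : ∀ {S : Sub} {L : V → ℕ} {a b e₀} (w : Walk G S a b) → Unique (walkEdges w) → e₀ ∈ˡ walkEdges w →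
      (∀ {e} → e ∈ˡ walkEdges w → e ≢ e₀ → Level L e) → L a ≡ L b → Level L e₀
    walk-crosses {L = L} (cons e _ j w) (fresh ∷ uniq) (here refl) lev a≡b =
      level-back (trans a≡b (sym (walk-level w λ f∈ → lev (there f∈) λ { refl → All.All¬⇒¬Any fresh f∈ }))) j
      where
      level-back : ∀ {e u v} → L u ≡ L v → Joins G e u v → Level L e
      level-back eq (inj₁ q) = trans (cong (L ∘ proj₁) q) (trans eq (sym (cong (L ∘ proj₂) q)))
      level-back eq (inj₂ q) = trans (cong (L ∘ proj₁) q) (trans (sym eq) (sym (cong (L ∘ proj₂) q)))
    walk-crosses (cons e _ j w) (fresh ∷ uniq) (there e₀∈) lev a≡b =
      walk-crosses w uniq e₀∈ (lev ∘ there)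
        (trans (sym (level-joins (lev (here refl) λ { refl → All.All¬⇒¬Any fresh e₀∈ }) j)) a≡b)

    -- The rule consumes the edge list, whereas walks and S refer to all edges of G; `emb` places
    -- what is left of the list inside the full edge set.
    record Suffix (S : Sub) (es : List Edge) (T : Subset (length es)) : Set where
      field
        emb       : Fin (length es) → E
        injective : ∀ {i j} → emb i ≡ emb j → i ≡ j
        edge      : ∀ i → List.lookup es i ≡ (toℕ (src (emb i)) , toℕ (tgt (emb i)))
        side      : ∀ i → lookup T i ≡ lookup S (emb i)
    open Suffix

    next : ∀ {S e es s T} → Suffix S (e ∷ es) (s ∷ T) → Suffix S es T
    next σ = record
      { emb = emb σ ∘ suc ; injective = Fin.suc-injective ∘ injective σ
      ; edge = edge σ ∘ suc ; side = side σ ∘ suc }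

    ⌊_⌋ : Lab → V → ℕ
    ⌊ lab ⌋ = lab ∘ toℕ

    module _ {S : Sub} {u w : ℕ} {es : List Edge} {T : Subset (length es)} (lab : Lab) where

      head-level : ∀ {s} (σ : Suffix S ((u , w) ∷ es) (s ∷ T)) → Level ⌊ lab ⌋ (emb σ zero) → lab u ≡ lab w
      head-level σ lev =
        trans (cong (lab ∘ proj₁) (edge σ zero)) (trans lev (cong (lab ∘ proj₂) (sym (edge σ zero))))

      head-level⁻ : ∀ {s} (σ : Suffix S ((u , w) ∷ es) (s ∷ T)) → lab u ≡ lab w → Level ⌊ lab ⌋ (emb σ zero)
      head-level⁻ σ eq =
        trans (cong (lab ∘ proj₁) (sym (edge σ zero))) (trans eq (cong (lab ∘ proj₂) (edge σ zero)))

      head-∉ : (σ : Suffix S ((u , w) ∷ es) (outside ∷ T)) → ¬ (emb σ zero ∈ S)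
      head-∉ σ e∈S with () ← trans (side σ zero) ([]=⇒lookup e∈S)

      head-∈ : (σ : Suffix S ((u , w) ∷ es) (inside ∷ T)) → emb σ zero ∈ S
      head-∈ σ = lookup⇒[]= _ _ (sym (side σ zero))

    merge-same : ∀ lab u w → merge lab u w u ≡ merge lab u w w
    merge-same lab u w with lab u ≟ lab w
    ... | yes _ = sym (relabel-hit (lab u) {lab w} refl)
    ... | no _  = sym (relabel-hit (lab u) {lab w} refl)

    merge-level : ∀ lab u w e → Level ⌊ lab ⌋ e → Level ⌊ merge lab u w ⌋ e
    merge-level lab u w _ = cong (relabel (lab u) (lab w))

    -- Taken edges become level for the merged labels. When the last edge of the closed trail is
    -- reached, all its other edges are therefore level, and `walk-crosses` makes that edge join
    -- equal labels, against the rule.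
    kruskal-acyclic : ∀ {S es lab T} → Kruskal (n G) es lab T → (σ : Suffix S es T) →
      ∀ {a} (w : Walk G S a a) → Unique (walkEdges w) →
      (∀ {e} → e ∈ˡ walkEdges w → Level ⌊ lab ⌋ e ⊎ ∃[ j ] e ≡ emb σ j) →
      ¬ (∃[ j ] emb σ j ∈ˡ walkEdges w)
    kruskal-acyclic (done _) σ w uw cover (() , _)
    kruskal-acyclic {lab = lab} (skip k) σ w uw cover (j , j∈w) = kruskal-acyclic k (next σ) w uw cover′ (shift j j∈w)
      where
      absent : ¬ (emb σ zero ∈ˡ walkEdges w)
      absent = head-∉ lab σ ∘ walk-∈ w
      shift : ∀ j → emb σ j ∈ˡ walkEdges w → ∃[ j ] emb σ (suc j) ∈ˡ walkEdges w
      shift zero    z∈w = ⊥-elim (absent z∈w)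
      shift (suc j) j∈w = j , j∈w
      cover′ : ∀ {e} → e ∈ˡ walkEdges w → Level ⌊ lab ⌋ e ⊎ ∃[ j ] e ≡ emb σ (suc j)
      cover′ e∈ with cover e∈
      ... | inj₁ lev            = inj₁ lev
      ... | inj₂ (zero , refl)  = ⊥-elim (absent e∈)
      ... | inj₂ (suc j , refl) = inj₂ (j , refl)
    kruskal-acyclic {lab = lab} (take {u} {w = x} {es = es} u≢w k) σ w uw cover (j , j∈w)
      with Fin.any? (λ j → Any? (emb σ (suc j)) (walkEdges w))
      where
      open import Data.List.Membership.DecPropositional (Fin._≟_ {m G}) using () renaming (_∈?_ to Any?)
    ... | yes (j′ , j′∈w) = kruskal-acyclic k (next σ) w uw cover′ (j′ , j′∈w)
      where
      cover′ : ∀ {e} → e ∈ˡ walkEdges w → Level ⌊ merge lab u x ⌋ e ⊎ ∃[ j ] e ≡ emb σ (suc j)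
      cover′ e∈ with cover e∈
      ... | inj₁ lev            = inj₁ (merge-level lab u x _ lev)
      ... | inj₂ (zero , refl)  = inj₁ (head-level⁻ (merge lab u x) σ (merge-same lab u x))
      ... | inj₂ (suc j , refl) = inj₂ (j , refl)
    ... | no none = u≢w (head-level lab σ (walk-crosses {L = ⌊ lab ⌋} w uw (only j j∈w) others refl))
      where
      only : ∀ j → emb σ j ∈ˡ walkEdges w → emb σ zero ∈ˡ walkEdges w
      only zero    z∈w = z∈w
      only (suc j) j∈w = ⊥-elim (none (j , j∈w))
      others : ∀ {e} → e ∈ˡ walkEdges w → e ≢ emb σ zero → Level ⌊ lab ⌋ e
      others e∈ e≢ with cover e∈
      ... | inj₁ lev            = lev
      ... | inj₂ (zero , refl)  = ⊥-elim (e≢ refl)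
      ... | inj₂ (suc j , refl) = ⊥-elim (none (j , e∈))

    -- `P` bounds the edges that a connecting walk may use. In the completeness proof it holds for
    -- the edges taken so far, which keeps such a walk clear of the edge under consideration.
    LabelsJoined : Sub → (E → Set) → Lab → Set
    LabelsJoined S P lab = ∀ a b → ⌊ lab ⌋ a ≡ ⌊ lab ⌋ b →
      Σ (Walk G S a b) λ w → ∀ {e} → e ∈ˡ walkEdges w → P e

    labelsJoined-merge : ∀ {S u x es T} {P P′ : E → Set} lab (σ : Suffix S ((u , x) ∷ es) (inside ∷ T)) →
      (∀ {e} → P e → P′ e) → P′ (emb σ zero) →
      LabelsJoined S P lab → LabelsJoined S P′ (merge lab u x)
    labelsJoined-merge {S} {u} {x} {P = P} {P′} lab σ P⊆P′ p₀ joined a b eq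
      with lab (toℕ a) ≟ lab x | lab (toℕ b) ≟ lab x
    ... | no _   | no _   = weaken (joined a b eq)
      where
      weaken : ∀ {a b} → Σ (Walk G S a b) (λ w → ∀ {e} → e ∈ˡ walkEdges w → P e) →
               Σ (Walk G S a b) (λ w → ∀ {e} → e ∈ˡ walkEdges w → P′ e)
      weaken (w , p) = w , P⊆P′ ∘ p
    ... | yes a≡x | yes b≡x = let w , p = joined a b (trans a≡x (sym b≡x)) in w , P⊆P′ ∘ p
    ... | yes a≡x | no _ =
        let w₁ , p₁ = joined a (tgt e₀) (trans a≡x (cong (lab ∘ proj₂) (edge σ zero)))
            w₂ , p₂ = joined (src e₀) b (trans (cong (lab ∘ proj₁) (sym (edge σ zero))) eq)
        in w₁ ++ʷ cons e₀ (head-∈ lab σ) (inj₂ refl) w₂ ,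
           λ e∈ → [ P⊆P′ ∘ p₁ , (λ { (here refl) → p₀ ; (there q) → P⊆P′ (p₂ q) }) ]′ (++ʷ-∈ w₁ e∈)
      where e₀ = emb σ zero
    ... | no _ | yes b≡x =
        let w₁ , p₁ = joined a (src e₀) (trans eq (cong (lab ∘ proj₁) (edge σ zero)))
            w₂ , p₂ = joined (tgt e₀) b (trans (cong (lab ∘ proj₂) (sym (edge σ zero))) (sym b≡x))
        in w₁ ++ʷ cons e₀ (head-∈ lab σ) (inj₁ refl) w₂ ,
           λ e∈ → [ P⊆P′ ∘ p₁ , (λ { (here refl) → p₀ ; (there q) → P⊆P′ (p₂ q) }) ]′ (++ʷ-∈ w₁ e∈)
      where e₀ = emb σ zero

    kruskal-connected : ∀ {S es lab T} → Kruskal (n G) es lab T → Suffix S es T →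
      LabelsJoined S (λ _ → E) lab → ∀ u v → Walk G S u v
    kruskal-connected (done same) σ joined u v =
      proj₁ (joined u v (trans (same (Fin.toℕ<n u)) (sym (same (Fin.toℕ<n v)))))
    kruskal-connected (skip k) σ joined = kruskal-connected k (next σ) joined
    kruskal-connected {lab = lab} (take _ k) σ joined =
      kruskal-connected k (next σ) (labelsJoined-merge lab σ id (emb σ zero) joined)

    -- If the ends of a selected edge already shared a label, a trail of earlier selected edges
    -- would close with it to a cycle. Once the list is used up every edge of S is level, and
    -- connectedness makes the labelling constant.
    spanning⇒kruskal : ∀ {S} → IsSpanningTree G S → V → ∀ es lab T (σ : Suffix S es T) (P : E → Set) →
      (∀ j → ¬ P (emb σ j)) → LabelsJoined S P lab →
      (∀ {e} → e ∈ S → Level ⌊ lab ⌋ e ⊎ ∃[ j ] e ≡ emb σ j) → Kruskal (n G) es lab T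
    spanning⇒kruskal {S} (conn , acyc) v₀ [] lab [] σ P fresh joined cover = done same
      where
      level : ∀ {e} → e ∈ S → Level ⌊ lab ⌋ e
      level e∈ with cover e∈
      ... | inj₁ lev = lev
      const : ∀ a b → ⌊ lab ⌋ a ≡ ⌊ lab ⌋ b
      const a b = walk-level {L = ⌊ lab ⌋} (conn a b) (level ∘ walk-∈ (conn a b))
      same : AllSame (n G) lab
      same {z} z<n = subst (λ z → lab z ≡ lab 0) (Fin.toℕ-fromℕ< z<n)
        (trans (const (fromℕ< z<n) (fromℕ< 0<n)) (cong lab (Fin.toℕ-fromℕ< 0<n)))
        where
        0<n : 0 < n G
        0<n = ℕ.>-nonZero⁻¹ (n G) {{Fin.nonZeroIndex v₀}}
    spanning⇒kruskal st v₀ (e ∷ es) lab (outside ∷ T) σ P fresh joined cover =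
      skip (spanning⇒kruskal st v₀ es lab T (next σ) P (fresh ∘ suc) joined cover′)
      where
      cover′ : ∀ {e} → e ∈ _ → Level ⌊ lab ⌋ e ⊎ ∃[ j ] e ≡ emb σ (suc j)
      cover′ e∈ with cover e∈
      ... | inj₁ lev            = inj₁ lev
      ... | inj₂ (zero , refl)  = ⊥-elim (head-∉ lab σ e∈)
      ... | inj₂ (suc j , refl) = inj₂ (j , refl)
    spanning⇒kruskal {S} st v₀ ((u , x) ∷ es) lab (inside ∷ T) σ P fresh joined cover =
      take u≢x (spanning⇒kruskal st v₀ es _ T (next σ) (λ e → P e ⊎ e ≡ e₀)
        (λ j → [ fresh (suc j) , (λ eq → case-suc (injective σ eq)) ]′)
        (labelsJoined-merge lab σ inj₁ (inj₂ refl) joined) cover′)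
      where
      e₀ = emb σ zero
      case-suc : ∀ {k} {j : Fin k} → ¬ (suc j ≡ zero)
      case-suc ()
      u≢x : lab u ≢ lab x
      u≢x eq with joined (tgt e₀) (src e₀) (sym (head-level⁻ lab σ eq))
      ... | w , p with trail w
      ...   | t , ut , t⊆w = proj₂ st (src e₀ , cons e₀ (head-∈ lab σ) (inj₁ refl) t , s≤s z≤n ,
                               All.¬Any⇒All¬ _ (fresh zero ∘ p ∘ t⊆w) ∷ ut)
      cover′ : ∀ {e} → e ∈ S → Level ⌊ merge lab u x ⌋ e ⊎ ∃[ j ] e ≡ emb σ (suc j)
      cover′ e∈ with cover e∈
      ... | inj₁ lev            = inj₁ (merge-level lab u x _ lev)
      ... | inj₂ (zero , refl)  = inj₁ (head-level⁻ (merge lab u x) σ (merge-same lab u x))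
      ... | inj₂ (suc j , refl) = inj₂ (j , refl)

  -- The list es is passed separately so that m G = length es holds by computation.
  module _ (n : ℕ) (es : List Edge)
           (ordered : ∀ i → proj₁ (List.lookup es i) < proj₂ (List.lookup es i))
           (bounded : ∀ i → proj₂ (List.lookup es i) < n)
           (distinct : ∀ i j → List.lookup es i ≡ List.lookup es j → i ≡ j)
           where

    graph : SimpleGraph
    graph = record
      { n = n
      ; m = length es
      ; ends = λ i → fromℕ< (ℕ.<-trans (ordered i) (bounded i)) , fromℕ< (bounded i)
      ; ordered = λ i → subst₂ _<_ (sym (Fin.toℕ-fromℕ< _)) (sym (Fin.toℕ-fromℕ< _)) (ordered i)
      ; nomulti = λ i j eq → distinct i j (cong₂ _,_
          (trans (sym (Fin.toℕ-fromℕ< _)) (trans (cong (toℕ ∘ proj₁) eq) (Fin.toℕ-fromℕ< _)))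
          (trans (sym (Fin.toℕ-fromℕ< _)) (trans (cong (toℕ ∘ proj₂) eq) (Fin.toℕ-fromℕ< _))))
      }

    graph-edge : ∀ i → List.lookup es i ≡ (toℕ (proj₁ (ends graph i)) , toℕ (proj₂ (ends graph i)))
    graph-edge i = cong₂ _,_ (sym (Fin.toℕ-fromℕ< _)) (sym (Fin.toℕ-fromℕ< _))

    whole : ∀ S → Suffix graph S es S
    whole S = record { emb = id ; injective = id ; edge = graph-edge ; side = λ _ → refl }

    id-joined : ∀ {S P} → LabelsJoined graph S P id
    id-joined a b eq with Fin.toℕ-injective eq
    ... | refl = nil , λ ()

    numSpanningTrees : 0 < n → NumSpanningTrees graph (length (trees n es id))
    numSpanningTrees 0<n = trees n es id , trees-unique n es id , sound , complete , refl
      where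
      sound : ∀ T → T ∈ˡ trees n es id → IsSpanningTree graph T
      sound T T∈ = kruskal-connected graph k (whole T) id-joined , acyclic
        where
        k = trees-sound n es id T∈
        acyclic : ¬ HasCycle graph T
        acyclic (u , nil , () , _)
        acyclic (u , w@(cons e _ _ _) , _ , uw) =
          kruskal-acyclic graph k (whole T) w uw (λ {f} _ → inj₂ (f , refl)) (e , here refl)
      complete : ∀ T → IsSpanningTree graph T → T ∈ˡ trees n es id
      complete T st = trees-complete (spanning⇒kruskal graph st (fromℕ< 0<n) es id T (whole T)
        (λ _ → ⊥) (λ _ ()) id-joined (λ {f} _ → inj₂ (f , refl)))

open SpanningTrees

-- Construction steps as linear maps on forest counts

module Programs where

  open import Data.Integer as ℤ using (ℤ; +_; 0ℤ; 1ℤ; _+_; _*_; _-_)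
  open import Data.Integer.Tactic.RingSolver using (solve-∀)
  import Data.Integer.Properties as ℤ

  -- Every graph is drawn around two hubs A = 0 and B = 1 and is built from left to right; the
  -- operations refer to the current chain vertex c and the first unused vertex k.
  data Op : Set where
    new step spokeA spokeB pend₂ pend₃ : Op

  edges : ℕ → ℕ → List Op → List Edge
  edges c k []           = []
  edges c k (new ∷ p)    = edges k (suc k) p
  edges c k (step ∷ p)   = (c , k) ∷ edges k (suc k) p
  edges c k (spokeA ∷ p) = (0 , c) ∷ edges c k p
  edges c k (spokeB ∷ p) = (1 , c) ∷ edges c k p
  edges c k (pend₂ ∷ p)  = (c , k) ∷ (1 , k) ∷ edges c (suc k) p
  edges c k (pend₃ ∷ p)  = (c , k) ∷ (k , suc k) ∷ (1 , suc k) ∷ edges c (suc (suc k)) p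

  size : ℕ → List Op → ℕ
  size k []           = k
  size k (new ∷ p)    = size (suc k) p
  size k (step ∷ p)   = size (suc k) p
  size k (spokeA ∷ p) = size k p
  size k (spokeB ∷ p) = size k p
  size k (pend₂ ∷ p)  = size (suc k) p
  size k (pend₃ ∷ p)  = size (suc (suc k)) p

  size-≥ : ∀ k p → k ≤ size k p
  size-≥ k []           = ℕ.≤-refl
  size-≥ k (new ∷ p)    = ℕ.<⇒≤ (size-≥ (suc k) p)
  size-≥ k (step ∷ p)   = ℕ.<⇒≤ (size-≥ (suc k) p)
  size-≥ k (spokeA ∷ p) = size-≥ k p
  size-≥ k (spokeB ∷ p) = size-≥ k p
  size-≥ k (pend₂ ∷ p)  = ℕ.<⇒≤ (size-≥ (suc k) p)
  size-≥ k (pend₃ ∷ p)  = ℕ.<⇒≤ (ℕ.<⇒≤ (size-≥ (suc (suc k)) p))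

  -- Numbers of spanning forests in which every component meets {A, B, c}, by the induced partition:
  -- x = A|B|c,  r = Ac|B,  y = r + (Bc|A),  w = r + (AB|c),  t = ABc.
  record State : Set where
    constructor ⟨_,_,_,_,_⟩
    field x y r w t : ℤ
  open State

  cong₅ : ∀ {x x′ y y′ r r′ w w′ t t′} → x ≡ x′ → y ≡ y′ → r ≡ r′ → w ≡ w′ → t ≡ t′ →
    ⟨ x , y , r , w , t ⟩ ≡ ⟨ x′ , y′ , r′ , w′ , t′ ⟩
  cong₅ refl refl refl refl refl = refl

  infixl 6 _⊕_
  infixl 7 _·_

  _⊕_ : State → State → State
  ⟨ x , y , r , w , t ⟩ ⊕ ⟨ x′ , y′ , r′ , w′ , t′ ⟩ = ⟨ x + x′ , y + y′ , r + r′ , w + w′ , t + t′ ⟩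

  _·_ : ℤ → State → State
  k · ⟨ x , y , r , w , t ⟩ = ⟨ k * x , k * y , k * r , k * w , k * t ⟩

  -- When c is abandoned its component must contain a hub: `y` forests with the hubs apart and `t`
  -- with the hubs together survive. In `joinA` the last entry is the number of forests of type A|Bc
  -- or AB|c, since r is included in both y and w. With these coordinates (x, y) evolves
  -- independently of the rest.
  renew joinA joinB : State → State
  renew ⟨ x , y , r , w , t ⟩ = ⟨ y , 0ℤ , 0ℤ , t , 0ℤ ⟩
  joinA ⟨ x , y , r , w , t ⟩ = ⟨ 0ℤ , x , x , x , y + w - + 2 * r ⟩
  joinB ⟨ x , y , r , w , t ⟩ = ⟨ 0ℤ , x , 0ℤ , 0ℤ , w ⟩

  -- Each summand is a way to use the new edges. A path of two or three edges from c to B may lose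
  -- any one edge, which leaves the partition as it was, or be kept whole, which joins c to B;
  -- losing two edges would strand an interior vertex.
  act : Op → State → State
  act new    s = renew s
  act step   s = renew s ⊕ s
  act spokeA s = s ⊕ joinA s
  act spokeB s = s ⊕ joinB s
  act pend₂  s = s ⊕ (s ⊕ joinB s)
  act pend₃  s = s ⊕ (s ⊕ (s ⊕ joinB s))

  run : List Op → State → State
  run []      s = s
  run (o ∷ p) s = run p (act o s)

  run-++ : ∀ p q s → run (p ++ q) s ≡ run q (run p s)
  run-++ []      q s = refl
  run-++ (o ∷ p) q s = run-++ p q (act o s)

  ⊕-interchange : ∀ a b c d → (a ⊕ b) ⊕ (c ⊕ d) ≡ (a ⊕ c) ⊕ (b ⊕ d)
  ⊕-interchange a b c d = cong₅ (ic (x a) (x b) (x c) (x d)) (ic (y a) (y b) (y c) (y d))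
    (ic (r a) (r b) (r c) (r d)) (ic (w a) (w b) (w c) (w d)) (ic (t a) (t b) (t c) (t d))
    where
    ic : ∀ a b c d → (a + b) + (c + d) ≡ (a + c) + (b + d)
    ic = solve-∀

  joinA-⊕ : ∀ s s′ → joinA (s ⊕ s′) ≡ joinA s ⊕ joinA s′
  joinA-⊕ s s′ = cong₅ refl refl refl refl (eq (y s) (y s′) (w s) (w s′) (r s) (r s′))
    where
    eq : ∀ y y′ w w′ r r′ → (y + y′) + (w + w′) - + 2 * (r + r′) ≡ (y + w - + 2 * r) + (y′ + w′ - + 2 * r′)
    eq = solve-∀

  act-⊕ : ∀ o s s′ → act o (s ⊕ s′) ≡ act o s ⊕ act o s′
  act-⊕ new    s s′ = refl
  act-⊕ step   s s′ = ⊕-interchange (renew s) (renew s′) s s′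
  act-⊕ spokeA s s′ = trans (cong (s ⊕ s′ ⊕_) (joinA-⊕ s s′)) (⊕-interchange s s′ (joinA s) (joinA s′))
  act-⊕ spokeB s s′ = ⊕-interchange s s′ (joinB s) (joinB s′)
  act-⊕ pend₂  s s′ = trans (cong (s ⊕ s′ ⊕_) (⊕-interchange s s′ (joinB s) (joinB s′)))
                            (⊕-interchange s s′ (s ⊕ joinB s) (s′ ⊕ joinB s′))
  act-⊕ pend₃  s s′ = trans (cong (λ u → s ⊕ s′ ⊕ (s ⊕ s′ ⊕ u)) (⊕-interchange s s′ (joinB s) (joinB s′)))
    (trans (cong (s ⊕ s′ ⊕_) (⊕-interchange s s′ (s ⊕ joinB s) (s′ ⊕ joinB s′)))
           (⊕-interchange s s′ (s ⊕ (s ⊕ joinB s)) (s′ ⊕ (s′ ⊕ joinB s′))))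

  run-⊕ : ∀ p s s′ → run p (s ⊕ s′) ≡ run p s ⊕ run p s′
  run-⊕ []      s s′ = refl
  run-⊕ (o ∷ p) s s′ = trans (cong (run p) (act-⊕ o s s′)) (run-⊕ p (act o s) (act o s′))

  data Pattern : Set where
    A|B|c Ac|B A|Bc AB|c ABc : Pattern

  basis : Pattern → State
  basis A|B|c = ⟨ 1ℤ , 0ℤ , 0ℤ , 0ℤ , 0ℤ ⟩
  basis Ac|B  = ⟨ 0ℤ , 1ℤ , 1ℤ , 1ℤ , 0ℤ ⟩
  basis A|Bc  = ⟨ 0ℤ , 1ℤ , 0ℤ , 0ℤ , 0ℤ ⟩
  basis AB|c  = ⟨ 0ℤ , 0ℤ , 0ℤ , 1ℤ , 0ℤ ⟩
  basis ABc   = ⟨ 0ℤ , 0ℤ , 0ℤ , 0ℤ , 1ℤ ⟩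

  zeroState : State
  zeroState = ⟨ 0ℤ , 0ℤ , 0ℤ , 0ℤ , 0ℤ ⟩

  run-zero : ∀ p → run p zeroState ≡ zeroState
  run-zero []           = refl
  run-zero (new ∷ p)    = run-zero p
  run-zero (step ∷ p)   = run-zero p
  run-zero (spokeA ∷ p) = run-zero p
  run-zero (spokeB ∷ p) = run-zero p
  run-zero (pend₂ ∷ p)  = run-zero p
  run-zero (pend₃ ∷ p)  = run-zero p

  -- Counting completions by deletion and contraction

  HasPattern : Pattern → ℕ → ℕ → ℕ → Set
  HasPattern A|B|c a b c = a ≢ b × a ≢ c × b ≢ c
  HasPattern Ac|B  a b c = a ≡ c × a ≢ b
  HasPattern A|Bc  a b c = b ≡ c × a ≢ b
  HasPattern AB|c  a b c = a ≡ b × a ≢ c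
  HasPattern ABc   a b c = a ≡ b × a ≡ c

  count : ℕ → List Edge → Lab → ℕ
  count n es lab = length (trees n es lab)

  count-blocked : ∀ n u w es lab → lab u ≡ lab w → count n ((u , w) ∷ es) lab ≡ count n es lab
  count-blocked n u w es lab eq with lab u ≟ lab w
  ... | yes _ = length-map _ (trees n es lab)
  ... | no ¬e = ⊥-elim (¬e eq)

  count-open : ∀ n u w es lab → lab u ≢ lab w →
    count n ((u , w) ∷ es) lab ≡ count n es lab ℕ.+ count n es (merge lab u w)
  count-open n u w es lab ne with lab u ≟ lab w
  ... | yes e = ⊥-elim (ne e)
  ... | no _  = trans (length-++ (map _ (trees n es lab)))
                      (cong₂ ℕ._+_ (length-map _ (trees n es lab)) (length-map _ (trees n es (merge lab u w))))

  Avoids : Lab → ℕ → Edge → Set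
  Avoids lab z (u , w) = lab u ≢ lab z × lab w ≢ lab z

  merge-miss : ∀ lab u {w z} → lab z ≢ lab w → merge lab u w z ≡ lab z
  merge-miss lab u = relabel-miss (lab u)

  merge-avoid : ∀ lab {u w z v} → lab u ≢ lab z → lab w ≢ lab z → lab v ≢ lab z →
    merge lab u w v ≢ merge lab u w z
  merge-avoid lab {u} {w} {z} {v} u≢z w≢z v≢z eq with trans eq (merge-miss lab u (w≢z ∘ sym))
  ... | eq′ with lab v ≟ lab w
  ...   | yes _ = u≢z eq′
  ...   | no _  = v≢z eq′

  count-stranded : ∀ n es lab z → z < n → lab 0 ≢ lab z → All (Avoids lab z) es → count n es lab ≡ 0
  count-stranded n [] lab z z<n 0≢z [] with allSame? n lab
  ... | yes same = ⊥-elim (0≢z (sym (same z<n)))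
  ... | no _     = refl
  count-stranded n ((u , w) ∷ es) lab z z<n 0≢z ((u≢z , w≢z) ∷ av) with lab u ≟ lab w
  ... | yes _ = trans (length-map _ (trees n es lab)) (count-stranded n es lab z z<n 0≢z av)
  ... | no _  = trans (length-++ (map _ (trees n es lab)))
    (cong₂ ℕ._+_ (trans (length-map _ (trees n es lab)) (count-stranded n es lab z z<n 0≢z av))
      (trans (length-map _ (trees n es (merge lab u w)))
        (count-stranded n es (merge lab u w) z z<n (merge-avoid lab u≢z w≢z 0≢z)
          (All.map (λ (a , b) → merge-avoid lab u≢z w≢z a , merge-avoid lab u≢z w≢z b) av))))

  Touch : ℕ → ℕ → ℕ → Set
  Touch c k z = z ≡ 0 ⊎ z ≡ 1 ⊎ z ≡ c ⊎ k ≤ z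

  touch-later : ∀ {c c′ k k′ z} → k ≤ k′ → Touch c k c′ → Touch c′ k′ z → Touch c k z
  touch-later le tc (inj₁ e)                      = inj₁ e
  touch-later le tc (inj₂ (inj₁ e))               = inj₂ (inj₁ e)
  touch-later le tc (inj₂ (inj₂ (inj₁ refl)))     = tc
  touch-later le tc (inj₂ (inj₂ (inj₂ k′≤z)))     = inj₂ (inj₂ (inj₂ (ℕ.≤-trans le k′≤z)))

  TouchE : ℕ → ℕ → Edge → Set
  TouchE c k (u , w) = Touch c k u × Touch c k w

  private
    t0 : ∀ {c k} → Touch c k 0
    t0 = inj₁ refl
    t1 : ∀ {c k} → Touch c k 1
    t1 = inj₂ (inj₁ refl)
    tc : ∀ {c k} → Touch c k c
    tc = inj₂ (inj₂ (inj₁ refl))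
    tk : ∀ {c k z} → k ≤ z → Touch c k z
    tk le = inj₂ (inj₂ (inj₂ le))

  edges-touch : ∀ c k p → All (TouchE c k) (edges c k p)
  later : ∀ {c c′ k k′} p → k ≤ k′ → Touch c k c′ → All (TouchE c k) (edges c′ k′ p)
  later {c′ = c′} {k′ = k′} p le t′ = All.map (λ (a , b) → touch-later le t′ a , touch-later le t′ b) (edges-touch c′ k′ p)
  edges-touch c k []           = []
  edges-touch c k (new ∷ p)    = later p (ℕ.n≤1+n k) (tk ℕ.≤-refl)
  edges-touch c k (step ∷ p)   = (tc , tk ℕ.≤-refl) ∷ later p (ℕ.n≤1+n k) (tk ℕ.≤-refl)
  edges-touch c k (spokeA ∷ p) = (t0 , tc) ∷ edges-touch c k p
  edges-touch c k (spokeB ∷ p) = (t1 , tc) ∷ edges-touch c k p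
  edges-touch c k (pend₂ ∷ p)  = (tc , tk ℕ.≤-refl) ∷ (t1 , tk ℕ.≤-refl) ∷ later p (ℕ.n≤1+n k) tc
  edges-touch c k (pend₃ ∷ p)  = (tc , tk ℕ.≤-refl) ∷ (tk ℕ.≤-refl , tk (ℕ.n≤1+n k)) ∷ (t1 , tk (ℕ.n≤1+n k)) ∷
    later p (ℕ.m≤n⇒m≤1+n (ℕ.n≤1+n k)) tc

  record Stranded (c k : ℕ) (lab : Lab) (z : ℕ) : Set where
    field
      ≢A : lab 0 ≢ lab z
      ≢B : lab 1 ≢ lab z
      ≢c : lab c ≢ lab z
      ≢k : ∀ {i} → k ≤ i → lab i ≢ lab z

    touch-≢ : ∀ {i} → Touch c k i → lab i ≢ lab z
    touch-≢ (inj₁ refl)               = ≢A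
    touch-≢ (inj₂ (inj₁ refl))        = ≢B
    touch-≢ (inj₂ (inj₂ (inj₁ refl))) = ≢c
    touch-≢ (inj₂ (inj₂ (inj₂ le)))   = ≢k le

  stranded-zero : ∀ {n c k lab z} es → z < n → Stranded c k lab z → All (TouchE c k) es → count n es lab ≡ 0
  stranded-zero es z<n st touches = count-stranded _ es _ _ z<n ≢A
    (All.map (λ (a , b) → touch-≢ a , touch-≢ b) touches)
    where open Stranded st

  record Ready (c k : ℕ) (σ : Pattern) (lab : Lab) : Set where
    field
      1<k      : 1 < k
      c<k      : c < k
      pattern′ : HasPattern σ (lab 0) (lab 1) (lab c)
      attached : ∀ {z} → z < k → lab z ≡ lab 0 ⊎ lab z ≡ lab 1 ⊎ lab z ≡ lab c
      small    : ∀ {z} → z < k → lab z < k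
      fresh    : ∀ {z} → k ≤ z → lab z ≡ z

    0<k : 0 < k
    0<k = ℕ.<-trans (s≤s z≤n) 1<k

    ≢-fresh : ∀ {z i} → z < k → k ≤ i → lab z ≢ lab i
    ≢-fresh z<k k≤i eq = ℕ.<⇒≢ (ℕ.<-≤-trans (small z<k) k≤i) (trans eq (fresh k≤i))

    fresh-injective : ∀ {i j} → k ≤ i → k ≤ j → lab i ≡ lab j → i ≡ j
    fresh-injective k≤i k≤j eq = trans (sym (fresh k≤i)) (trans eq (fresh k≤j))

    stranded-fresh : ∀ {k′ z} → k ≤ z → z < k′ → Stranded c k′ lab z
    stranded-fresh k≤z z<k′ = record
      { ≢A = ≢-fresh 0<k k≤z ; ≢B = ≢-fresh 1<k k≤z ; ≢c = ≢-fresh c<k k≤z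
      ; ≢k = λ k′≤i eq → ℕ.<⇒≢ (ℕ.<-≤-trans z<k′ k′≤i)
          (sym (fresh-injective (ℕ.≤-trans (ℕ.≤-trans k≤z (ℕ.<⇒≤ z<k′)) k′≤i) k≤z eq)) }

  ready-ext : ∀ {c k σ lab lab′} → (∀ z → lab z ≡ lab′ z) → Ready c k σ lab → Ready c k σ lab′
  ready-ext {c} {k} {σ} {lab} {lab′} eq R = record
    { 1<k = 1<k ; c<k = c<k
    ; pattern′ = subst (λ a → HasPattern σ a (lab′ 1) (lab′ c)) (eq 0)
        (subst (λ b → HasPattern σ (lab 0) b (lab′ c)) (eq 1) (subst (HasPattern σ (lab 0) (lab 1)) (eq c) pattern′))
    ; attached = λ {z} z<k → [ inj₁ ∘ via z , [ inj₂ ∘ inj₁ ∘ via z , inj₂ ∘ inj₂ ∘ via z ]′ ]′ (attached z<k)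
    ; small = λ {z} z<k → subst (_< k) (eq z) (small z<k)
    ; fresh = λ {z} k≤z → trans (sym (eq z)) (fresh k≤z) }
    where
    open Ready R
    via : ∀ z {v} → lab z ≡ lab v → lab′ z ≡ lab′ v
    via z {v} e = trans (sym (eq z)) (trans e (eq v))

  module _ {c k : ℕ} {σ : Pattern} {lab : Lab} (R : Ready c k σ lab) where
    open Ready R

    ready-attach : ∀ {q} → q < k → Ready c (suc k) σ (relabel (lab q) k ∘ lab)
    ready-attach {q} q<k = record
      { 1<k = ℕ.m<n⇒m<1+n 1<k
      ; c<k = ℕ.m<n⇒m<1+n c<k
      ; pattern′ = subst₃ (HasPattern σ) (sym (old 0<k)) (sym (old 1<k)) (sym (old c<k)) pattern′
      ; attached = λ z<1+k → att (ℕ.m<1+n⇒m<n∨m≡n z<1+k)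
      ; small = λ z<1+k → sm (ℕ.m<1+n⇒m<n∨m≡n z<1+k)
      ; fresh = λ {z} k<z → trans (relabel-miss (lab q) {k} (λ eq → ℕ.<⇒≢ k<z (sym (trans (sym (fresh (ℕ.<⇒≤ k<z))) eq)))) (fresh (ℕ.<⇒≤ k<z))
      }
      where
      subst₃ : ∀ (P : ℕ → ℕ → ℕ → Set) {a a′ b b′ d d′} → a ≡ a′ → b ≡ b′ → d ≡ d′ → P a b d → P a′ b′ d′
      subst₃ P refl refl refl p = p
      lab′ : Lab
      lab′ = relabel (lab q) k ∘ lab
      old : ∀ {z} → z < k → lab′ z ≡ lab z
      old z<k = relabel-miss (lab q) {k} (ℕ.<⇒≢ (small z<k))
      hit : lab′ k ≡ lab q
      hit = relabel-hit (lab q) {k} (fresh ℕ.≤-refl)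
      att< : ∀ {z a} → z < k → a ≡ lab z → a ≡ lab′ 0 ⊎ a ≡ lab′ 1 ⊎ a ≡ lab′ c
      att< z<k eq with attached z<k
      ... | inj₁ e        = inj₁ (trans eq (trans e (sym (old 0<k))))
      ... | inj₂ (inj₁ e) = inj₂ (inj₁ (trans eq (trans e (sym (old 1<k)))))
      ... | inj₂ (inj₂ e) = inj₂ (inj₂ (trans eq (trans e (sym (old c<k)))))
      att : ∀ {z} → z < k ⊎ z ≡ k → lab′ z ≡ lab′ 0 ⊎ lab′ z ≡ lab′ 1 ⊎ lab′ z ≡ lab′ c
      att (inj₁ z<k)  = att< z<k (old z<k)
      att (inj₂ refl) = att< q<k hit
      sm : ∀ {z} → z < k ⊎ z ≡ k → lab′ z < suc k
      sm (inj₁ z<k)  = subst (_< suc k) (sym (old z<k)) (ℕ.m<n⇒m<1+n (small z<k))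
      sm (inj₂ refl) = subst (_< suc k) (sym hit) (ℕ.m<n⇒m<1+n (small q<k))

    ready-join : ∀ {q} τ → q < k → HasPattern τ (relabel (lab q) (lab c) (lab 0)) (relabel (lab q) (lab c) (lab 1)) (relabel (lab q) (lab c) (lab c)) →
      Ready c k τ (relabel (lab q) (lab c) ∘ lab)
    ready-join {q} τ q<k pat = record
      { 1<k = 1<k ; c<k = c<k ; pattern′ = pat
      ; attached = λ z<k → [ inj₁ ∘ cong ρ , [ inj₂ ∘ inj₁ ∘ cong ρ , inj₂ ∘ inj₂ ∘ cong ρ ]′ ]′ (attached z<k)
      ; small = λ z<k → sm z<k
      ; fresh = λ k≤z → trans (relabel-miss (lab q) {lab c} (≢-fresh c<k k≤z ∘ sym)) (fresh k≤z)
      }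
      where
      ρ : ℕ → ℕ
      ρ = relabel (lab q) (lab c)
      sm : ∀ {z} → z < k → ρ (lab z) < k
      sm {z} z<k with lab z ≟ lab c
      ... | yes _ = small q<k
      ... | no _  = small z<k

    ready-current : ∀ {c′} → c′ < k → lab c′ ≡ lab c → Ready c′ k σ lab
    ready-current c′<k eq = record
      { 1<k = 1<k ; c<k = c′<k ; pattern′ = subst (HasPattern σ (lab 0) (lab 1)) (sym eq) pattern′
      ; attached = λ z<k → [ inj₁ , [ inj₂ ∘ inj₁ , inj₂ ∘ inj₂ ∘ (λ e → trans e (sym eq)) ]′ ]′ (attached z<k)
      ; small = small ; fresh = fresh }

    ready-renew : ∀ τ → HasPattern τ (lab 0) (lab 1) (lab k) → lab c ≡ lab 0 ⊎ lab c ≡ lab 1 → Ready k (suc k) τ lab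
    ready-renew τ pat anchored = record
      { 1<k = ℕ.m<n⇒m<1+n 1<k ; c<k = ℕ.≤-refl ; pattern′ = pat
      ; attached = λ z<1+k → [ (λ z<k → [ inj₁ , [ inj₂ ∘ inj₁ , (λ e → [ (λ e′ → inj₁ (trans e e′)) , (λ e′ → inj₂ (inj₁ (trans e e′))) ]′ anchored) ]′ ]′ (attached z<k))
                            , (λ { refl → inj₂ (inj₂ refl) }) ]′ (ℕ.m<1+n⇒m<n∨m≡n z<1+k)
      ; small = λ z<1+k → [ (λ z<k → ℕ.m<n⇒m<1+n (small z<k)) , (λ { refl → subst (_< suc k) (sym (fresh ℕ.≤-refl)) ℕ.≤-refl }) ]′ (ℕ.m<1+n⇒m<n∨m≡n z<1+k)
      ; fresh = fresh ∘ ℕ.<⇒≤ }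

  -- The dual reading of the transfer map: completions of a forest of pattern σ are counted by the
  -- functional `t ∘ run p` at the basis vector of σ. Induction on the rest of the program then
  -- needs only linearity of `run`.
  Counts : ℕ → ℕ → ℕ → List Op → Set
  Counts n c k p = ∀ σ {lab} → Ready c k σ lab → + count n (edges c k p) lab ≡ t (run p (basis σ))

  +-split : ∀ p s s′ {a b} → + a ≡ t (run p s) → + b ≡ t (run p s′) → + (a ℕ.+ b) ≡ t (run p (s ⊕ s′))
  +-split p s s′ {a} {b} ea eb =
    trans (ℤ.pos-+ a b) (trans (cong₂ _+_ ea eb) (sym (cong t (run-⊕ p s s′))))

  module _ {n c k : ℕ} {p : List Op} (IH : Counts n c k p) where

    -- Only the labels of u and v are fixed, not the vertices themselves. Thus the lemma also covers
    -- the closing edge of a pendant path, whose lower end has by then been merged with c.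
    count-joinB : ∀ σ {lab u v} → Ready c k σ lab → lab u ≡ lab 1 → lab v ≡ lab c →
      + count n ((u , v) ∷ edges c k p) lab ≡ t (run p (act spokeB (basis σ)))
    count-joinB σ {lab} {u} {v} R u≡1 v≡c = go σ R
      where
      es = edges c k p
      blocked : ∀ σ → Ready c k σ lab → lab 1 ≡ lab c → act spokeB (basis σ) ≡ basis σ →
        + count n ((u , v) ∷ es) lab ≡ t (run p (act spokeB (basis σ)))
      blocked σ R eq fix = trans (cong +_ (count-blocked n u v es lab (trans u≡1 (trans eq (sym v≡c)))))
        (trans (IH σ R) (cong (t ∘ run p) (sym fix)))
      joined : Lab
      joined = relabel (lab 1) (lab c) ∘ lab
      open′ : ∀ σ τ → Ready c k σ lab → lab 1 ≢ lab c → Ready c k τ joined →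
        + count n ((u , v) ∷ es) lab ≡ t (run p (basis σ ⊕ basis τ))
      open′ σ τ R ne R′ = trans (cong +_ (trans (count-open n u v es lab (λ e → ne (trans (sym u≡1) (trans e v≡c))))
          (cong (λ l → count n es lab ℕ.+ count n es l) (cong₂ (λ a b → relabel a b ∘ lab) u≡1 v≡c))))
        (+-split p (basis σ) (basis τ) (IH σ R) (IH τ R′))
      hit : ∀ {z} → lab z ≡ lab c → joined z ≡ lab 1
      hit = relabel-hit (lab 1)
      miss : ∀ {z} → lab z ≢ lab c → joined z ≡ lab z
      miss = relabel-miss (lab 1)
      go : ∀ σ → Ready c k σ lab → + count n ((u , v) ∷ es) lab ≡ t (run p (act spokeB (basis σ)))
      go A|B|c R = let (0≢1 , 0≢c , 1≢c) = pattern′ in open′ A|B|c A|Bc R 1≢c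
        (ready-join R A|Bc 1<k (trans (miss 1≢c) (sym (hit refl)) ,
          λ e → 0≢1 (trans (sym (miss 0≢c)) (trans e (miss 1≢c)))))
        where open Ready R
      go Ac|B R = let (0≡c , 0≢1) = pattern′ ; 1≢c = λ e → 0≢1 (trans 0≡c (sym e)) in open′ Ac|B ABc R 1≢c
        (ready-join R ABc 1<k (trans (hit 0≡c) (sym (miss 1≢c)) , trans (hit 0≡c) (sym (hit refl))))
        where open Ready R
      go A|Bc R = let (1≡c , _) = pattern′ in blocked A|Bc R 1≡c refl
        where open Ready R
      go AB|c R = let (0≡1 , 0≢c) = pattern′ ; 1≢c = λ e → 0≢c (trans 0≡1 e) in open′ AB|c ABc R 1≢c
        (ready-join R ABc 1<k (trans (miss 0≢c) (trans 0≡1 (sym (miss 1≢c))) ,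
          trans (miss 0≢c) (trans 0≡1 (sym (hit refl)))))
        where open Ready R
      go ABc R = let (0≡1 , 0≡c) = pattern′ in blocked ABc R (trans (sym 0≡1) 0≡c) refl
        where open Ready R

    count-spokeA : ∀ σ {lab} → Ready c k σ lab →
      + count n ((0 , c) ∷ edges c k p) lab ≡ t (run p (act spokeA (basis σ)))
    count-spokeA σ {lab} R = go σ R
      where
      es = edges c k p
      blocked : ∀ σ → Ready c k σ lab → lab 0 ≡ lab c → act spokeA (basis σ) ≡ basis σ →
        + count n ((0 , c) ∷ es) lab ≡ t (run p (act spokeA (basis σ)))
      blocked σ R eq fix = trans (cong +_ (count-blocked n 0 c es lab eq)) (trans (IH σ R) (cong (t ∘ run p) (sym fix)))
      joined : Lab
      joined = relabel (lab 0) (lab c) ∘ lab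
      open′ : ∀ σ τ → Ready c k σ lab → lab 0 ≢ lab c → Ready c k τ joined →
        + count n ((0 , c) ∷ es) lab ≡ t (run p (basis σ ⊕ basis τ))
      open′ σ τ R ne R′ = trans (cong +_ (count-open n 0 c es lab ne))
        (+-split p (basis σ) (basis τ) (IH σ R) (IH τ R′))
      hit : ∀ {z} → lab z ≡ lab c → joined z ≡ lab 0
      hit = relabel-hit (lab 0)
      miss : ∀ {z} → lab z ≢ lab c → joined z ≡ lab z
      miss = relabel-miss (lab 0)
      go : ∀ σ → Ready c k σ lab → + count n ((0 , c) ∷ es) lab ≡ t (run p (act spokeA (basis σ)))
      go A|B|c R = let (0≢1 , 0≢c , 1≢c) = pattern′ in open′ A|B|c Ac|B R 0≢c
        (ready-join R Ac|B 0<k (trans (miss 0≢c) (sym (hit refl)) ,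
          λ e → 0≢1 (trans (sym (miss 0≢c)) (trans e (miss 1≢c)))))
        where open Ready R
      go Ac|B R = let (0≡c , _) = pattern′ in blocked Ac|B R 0≡c refl
        where open Ready R
      go A|Bc R = let (1≡c , 0≢1) = pattern′ ; 0≢c = λ e → 0≢1 (trans e (sym 1≡c)) in open′ A|Bc ABc R 0≢c
        (ready-join R ABc 0<k (trans (miss 0≢c) (sym (hit 1≡c)) , trans (miss 0≢c) (sym (hit refl))))
        where open Ready R
      go AB|c R = let (0≡1 , 0≢c) = pattern′ ; 1≢c = λ e → 0≢c (trans 0≡1 e) in open′ AB|c ABc R 0≢c
        (ready-join R ABc 0<k (trans (miss 0≢c) (trans 0≡1 (sym (miss 1≢c))) ,
          trans (miss 0≢c) (sym (hit refl))))
        where open Ready R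
      go ABc R = let (0≡1 , 0≡c) = pattern′ in blocked ABc R 0≡c refl
        where open Ready R

  -- If c is in the component of neither hub, no later edge can reach it and the count is 0.
  -- Otherwise its component is represented by a hub, and the new vertex starts as a component of
  -- its own.
  count-renew : ∀ {n c k p} → Counts n k (suc k) p → k < n → ∀ σ {lab} → Ready c k σ lab →
    + count n (edges k (suc k) p) lab ≡ t (run p (renew (basis σ)))
  count-renew {n} {c} {k} {p} IH k<n σ {lab} R = go σ R
    where
    dead : ∀ σ → Ready c k σ lab → lab 0 ≢ lab c → lab 1 ≢ lab c → renew (basis σ) ≡ zeroState →
      + count n (edges k (suc k) p) lab ≡ t (run p (renew (basis σ)))
    dead σ R 0≢c 1≢c eq = trans
      (cong +_ (stranded-zero (edges k (suc k) p) (ℕ.<-trans c<k k<n)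
        (record { ≢A = 0≢c ; ≢B = 1≢c ; ≢c = ≢-fresh c<k ℕ.≤-refl ∘ sym ; ≢k = λ le → ≢-fresh c<k (ℕ.<⇒≤ le) ∘ sym })
        (edges-touch k (suc k) p)))
      (sym (cong t (trans (cong (run p) eq) (run-zero p))))
      where open Ready R
    go : ∀ σ → Ready c k σ lab → + count n (edges k (suc k) p) lab ≡ t (run p (renew (basis σ)))
    go A|B|c R = let (_ , 0≢c , 1≢c) = pattern′ in dead A|B|c R 0≢c 1≢c refl
      where open Ready R
    go Ac|B R = let (0≡c , 0≢1) = pattern′ in
      IH A|B|c (ready-renew R A|B|c (0≢1 , ≢-fresh 0<k ℕ.≤-refl , ≢-fresh 1<k ℕ.≤-refl) (inj₁ (sym 0≡c)))
      where open Ready R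
    go A|Bc R = let (1≡c , 0≢1) = pattern′ in
      IH A|B|c (ready-renew R A|B|c (0≢1 , ≢-fresh 0<k ℕ.≤-refl , ≢-fresh 1<k ℕ.≤-refl) (inj₂ (sym 1≡c)))
      where open Ready R
    go AB|c R = let (0≡1 , 0≢c) = pattern′ in dead AB|c R 0≢c (λ e → 0≢c (trans 0≡1 e)) refl
      where open Ready R
    go ABc R = let (0≡1 , 0≡c) = pattern′ in
      IH AB|c (ready-renew R AB|c (0≡1 , ≢-fresh 0<k ℕ.≤-refl) (inj₁ (sym 0≡c)))
      where open Ready R

  merge-fresh : ∀ {c k σ lab q} → Ready c k σ lab → merge lab q k ≡ relabel (lab q) k ∘ lab
  merge-fresh {lab = lab} {q} R = cong (λ b → relabel (lab q) b ∘ lab) (Ready.fresh R ℕ.≤-refl)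

  counts-[] : ∀ k c → Counts k c k []
  counts-[] k c σ {lab} R = go σ R
    where
    same⇒ : ∀ σ → Ready c k σ lab → lab 0 ≡ lab 1 → lab 0 ≡ lab c → count k [] lab ≡ 1
    same⇒ σ R 0≡1 0≡c with allSame? k lab
    ... | yes _ = refl
    ... | no ¬s = ⊥-elim (¬s λ z<k → [ id , [ (λ e → trans e (sym 0≡1)) , (λ e → trans e (sym 0≡c)) ]′ ]′ (Ready.attached R z<k))
    differ⇒ : ∀ {z} → z < k → lab 0 ≢ lab z → count k [] lab ≡ 0
    differ⇒ {z} z<k 0≢z = count-stranded k [] lab z z<k 0≢z []
    go : ∀ σ → Ready c k σ lab → + count k [] lab ≡ t (basis σ)
    go A|B|c R = let (0≢1 , _ , _) = pattern′ in cong +_ (differ⇒ 1<k 0≢1)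
      where open Ready R
    go Ac|B R = let (_ , 0≢1) = pattern′ in cong +_ (differ⇒ 1<k 0≢1)
      where open Ready R
    go A|Bc R = let (_ , 0≢1) = pattern′ in cong +_ (differ⇒ 1<k 0≢1)
      where open Ready R
    go AB|c R = let (_ , 0≢c) = pattern′ in cong +_ (differ⇒ c<k 0≢c)
      where open Ready R
    go ABc R = let (0≡1 , 0≡c) = pattern′ in cong +_ (same⇒ ABc R 0≡1 0≡c)
      where open Ready R

  counts : ∀ p c k → Counts (size k p) c k p
  counts []           c k = counts-[] k c
  counts (new ∷ p)    c k σ R = count-renew {p = p} (counts p k (suc k)) (size-≥ (suc k) p) σ R
  counts (step ∷ p)   c k σ {lab} R =
    trans (cong +_ (count-open N c k es lab (≢-fresh c<k ℕ.≤-refl)))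
      (+-split p (renew (basis σ)) (basis σ)
        (count-renew {p = p} IH (size-≥ (suc k) p) σ R)
        (trans (cong (+_ ∘ count N es) (merge-fresh {q = c} R))
          (IH σ (ready-current (ready-attach R c<k) ℕ.≤-refl
            (trans (relabel-hit (lab c) {k} (fresh ℕ.≤-refl)) (sym (relabel-miss (lab c) {k} (ℕ.<⇒≢ (small c<k)))))))))
    where
    open Ready R
    N = size (suc k) p
    es = edges k (suc k) p
    IH = counts p k (suc k)
  counts (spokeA ∷ p) c k σ R = count-spokeA {p = p} (counts p c k) σ R
  counts (spokeB ∷ p) c k σ R = count-joinB {p = p} (counts p c k) σ R refl refl
  counts (pend₂ ∷ p)  c k σ {lab} R =
    trans (cong +_ (count-open N c k ((1 , k) ∷ es) lab (≢-fresh c<k ℕ.≤-refl)))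
      (+-split p (basis σ) (act spokeB (basis σ)) skipped
        (trans (cong (+_ ∘ count N ((1 , k) ∷ es)) (merge-fresh {q = c} R))
          (count-joinB {p = p} IH σ (ready-attach R c<k) refl
            (trans (relabel-hit (lab c) {k} (fresh ℕ.≤-refl)) (sym (relabel-miss (lab c) {k} (ℕ.<⇒≢ (small c<k))))))))
    where
    open Ready R
    N = size (suc k) p
    es = edges c (suc k) p
    IH = counts p c (suc k)
    -- With the edge to c dropped, k can be reached only from B, and dropping that edge too would
    -- strand it.
    skipped : + count N ((1 , k) ∷ es) lab ≡ t (run p (basis σ))
    skipped = trans (cong +_ (trans (count-open N 1 k es lab (≢-fresh 1<k ℕ.≤-refl))
        (cong (ℕ._+ count N es (merge lab 1 k)) (stranded-zero es (size-≥ (suc k) p) (stranded-fresh ℕ.≤-refl ℕ.≤-refl) (edges-touch c (suc k) p)))))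
      (trans (cong (+_ ∘ count N es) (merge-fresh {q = 1} R)) (IH σ (ready-attach R 1<k)))
  counts (pend₃ ∷ p)  c k σ {lab} R =
    trans (cong +_ (count-open N c k ((k , suc k) ∷ (1 , suc k) ∷ es) lab (≢-fresh c<k ℕ.≤-refl)))
      (+-split p (basis σ) (basis σ ⊕ act spokeB (basis σ)) skipped
        (trans (cong (+_ ∘ count N ((k , suc k) ∷ (1 , suc k) ∷ es)) (merge-fresh {q = c} R)) taken))
    where
    N = size (suc (suc k)) p
    es = edges c (suc (suc k)) p
    IH = counts p c (suc (suc k))
    k<n : k < N
    k<n = ℕ.<-trans (ℕ.n<1+n k) (size-≥ (suc (suc k)) p)
    lab₁ : Lab
    lab₁ = relabel (lab c) k ∘ lab
    open Ready R
    R₁ : Ready c (suc k) σ lab₁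
    R₁ = ready-attach R c<k
    module R₁ = Ready R₁
    lab₁k : lab₁ k ≡ lab₁ c
    lab₁k = trans (relabel-hit (lab c) {k} (fresh ℕ.≤-refl)) (sym (relabel-miss (lab c) {k} (ℕ.<⇒≢ (small c<k))))
    taken : + count N ((k , suc k) ∷ (1 , suc k) ∷ es) lab₁ ≡ t (run p (basis σ ⊕ act spokeB (basis σ)))
    taken = trans (cong +_ (count-open N k (suc k) ((1 , suc k) ∷ es) lab₁ (R₁.≢-fresh ℕ.≤-refl ℕ.≤-refl)))
      (+-split p (basis σ) (act spokeB (basis σ))
        (trans (cong +_ (trans (count-open N 1 (suc k) es lab₁ (R₁.≢-fresh R₁.1<k ℕ.≤-refl))
            (cong (ℕ._+ count N es (merge lab₁ 1 (suc k))) (stranded-zero es (size-≥ (suc (suc k)) p) (R₁.stranded-fresh ℕ.≤-refl ℕ.≤-refl) (edges-touch c (suc (suc k)) p)))))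
          (trans (cong (+_ ∘ count N es) (merge-fresh {q = 1} R₁)) (IH σ (ready-attach R₁ R₁.1<k))))
        (trans (cong (+_ ∘ count N ((1 , suc k) ∷ es)) (merge-fresh {q = k} R₁))
          (count-joinB {p = p} IH σ (ready-attach R₁ (ℕ.n<1+n k)) refl
            (trans (relabel-hit (lab₁ k) {suc k} (R₁.fresh ℕ.≤-refl))
              (trans lab₁k (sym (relabel-miss (lab₁ k) {suc k} (ℕ.<⇒≢ (R₁.small R₁.c<k)))))))))
    -- Without the edge from c, both other edges of the path are forced. `lab₃` merges the two
    -- interior vertices before joining them to B, whereas `ready-attach` adds them to B one at a
    -- time; `lab₃≗` shows that the labellings agree.
    lab₂ lab₃ : Lab
    lab₂ = merge lab k (suc k)
    lab₃ = merge lab₂ 1 (suc k)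
    L : Lab
    L = relabel (lab 1) k ∘ lab
    RL : Ready c (suc k) σ L
    RL = ready-attach R 1<k
    lab₂1 : lab₂ 1 ≡ lab 1
    lab₂1 = merge-miss lab k (≢-fresh 1<k (ℕ.n≤1+n k))
    lab₂k : lab₂ k ≡ k
    lab₂k = trans (merge-miss lab k (λ e → ℕ.1+n≢n (sym (fresh-injective ℕ.≤-refl (ℕ.n≤1+n k) e)))) (fresh ℕ.≤-refl)
    lab₂sk : lab₂ (suc k) ≡ k
    lab₂sk = trans (relabel-hit (lab k) {lab (suc k)} refl) (fresh ℕ.≤-refl)
    swap : ∀ {l} a → l < k → relabel l k (relabel k (suc k) a) ≡ relabel l (suc k) (relabel l k a)
    swap {l} a l<k = cases (a ≟ suc k) (a ≟ k)
      where
      l≢ : l ≢ suc k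
      l≢ = ℕ.<⇒≢ (ℕ.m<n⇒m<1+n l<k)
      cases : Dec (a ≡ suc k) → Dec (a ≡ k) → relabel l k (relabel k (suc k) a) ≡ relabel l (suc k) (relabel l k a)
      cases (yes a≡) _ = trans (relabel-hit l {k} (relabel-hit k {suc k} a≡))
        (sym (relabel-hit l {suc k} (trans (relabel-miss l {k} (λ e → ℕ.1+n≢n (trans (sym a≡) e))) a≡)))
      cases (no a≢) (yes a≡k) = trans (relabel-hit l {k} (trans (relabel-miss k {suc k} a≢) a≡k))
        (trans (sym (relabel-miss l {suc k} l≢)) (cong (relabel l (suc k)) (sym (relabel-hit l {k} a≡k))))
      cases (no a≢) (no a≢k) = trans (relabel-miss l {k} (λ e → a≢k (trans (sym (relabel-miss k {suc k} a≢)) e)))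
        (trans (relabel-miss k {suc k} a≢) (sym (trans (cong (relabel l (suc k)) (relabel-miss l {k} a≢k)) (relabel-miss l {suc k} a≢))))
    lab₃≗ : ∀ z → relabel (L 1) (suc k) (L z) ≡ lab₃ z
    lab₃≗ z = trans (cong (λ l → relabel l (suc k) (L z)) (relabel-miss (lab 1) {k} (ℕ.<⇒≢ (small 1<k))))
      (trans (sym (swap (lab z) (small 1<k)))
        (trans (cong (relabel (lab 1) k) (cong₂ (λ a b → relabel a b (lab z)) (sym (fresh ℕ.≤-refl)) (sym (fresh (ℕ.n≤1+n k)))))
          (cong₂ (λ a b → relabel a b (lab₂ z)) (sym lab₂1) (sym lab₂sk))))
    stranded₂ : Stranded c (suc (suc k)) lab₂ k
    stranded₂ = record
      { ≢A = old 0<k ; ≢B = old 1<k ; ≢c = old c<k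
      ; ≢k = λ {i} le e → ℕ.<⇒≢ (ℕ.<-trans (ℕ.n<1+n k) le)
          (sym (trans (sym (trans (merge-miss lab k (λ e′ → ℕ.<⇒≢ le (sym (fresh-injective (k≤ le) (ℕ.n≤1+n k) e′)))) (fresh (k≤ le)))) (trans e lab₂k))) }
      where
      k≤ : ∀ {i} → suc (suc k) ≤ i → k ≤ i
      k≤ le = ℕ.≤-trans (ℕ.m≤n⇒m≤1+n (ℕ.n≤1+n k)) le
      old : ∀ {z} → z < k → lab₂ z ≢ lab₂ k
      old z<k e = ℕ.<⇒≢ (small z<k) (trans (sym (merge-miss lab k (≢-fresh z<k (ℕ.n≤1+n k)))) (trans e lab₂k))
    skipped : + count N ((k , suc k) ∷ (1 , suc k) ∷ es) lab ≡ t (run p (basis σ))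
    skipped = trans (cong +_ (trans (count-open N k (suc k) ((1 , suc k) ∷ es) lab
          (λ e → ℕ.1+n≢n (sym (fresh-injective ℕ.≤-refl (ℕ.n≤1+n k) e))))
        (cong₂ ℕ._+_ (stranded-zero ((1 , suc k) ∷ es) k<n (stranded-fresh ℕ.≤-refl ℕ.≤-refl)
            ((t1 , tk ℕ.≤-refl) ∷ later p (ℕ.n≤1+n (suc k)) tc))
          (trans (count-open N 1 (suc k) es lab₂ (λ e → ℕ.<⇒≢ (small 1<k) (trans (sym lab₂1) (trans e lab₂sk))))
            (cong (ℕ._+ count N es lab₃) (stranded-zero es k<n stranded₂ (edges-touch c (suc (suc k)) p)))))))
      (IH σ (ready-ext lab₃≗ (ready-attach RL RL.1<k)))
      where module RL = Ready RL

open Programs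

-- Straight-line drawings and separating lines

module Drawings where

  open import Data.Nat.Tactic.RingSolver using (solve-∀)
  open import Data.Rational as ℚ using (ℚ; 0ℚ; 1ℚ)
  import Data.Rational.Properties as ℚ
  import Data.Rational.Solver as ℚ
  open import Relation.Binary.Definitions using (tri<; tri≈; tri>)
  open import Data.Nat using (_∸_; _+_; _*_)

  ι : ℕ → ℚ
  ι zero    = 0ℚ
  ι (suc n) = 1ℚ ℚ.+ ι n

  ι-+ : ∀ a b → ι (a ℕ.+ b) ≡ ι a ℚ.+ ι b
  ι-+ zero    b = sym (ℚ.+-identityˡ (ι b))
  ι-+ (suc a) b = trans (cong (1ℚ ℚ.+_) (ι-+ a b)) (sym (ℚ.+-assoc 1ℚ (ι a) (ι b)))

  ι-* : ∀ a b → ι (a ℕ.* b) ≡ ι a ℚ.* ι b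
  ι-* zero    b = sym (ℚ.*-zeroˡ (ι b))
  ι-* (suc a) b = trans (ι-+ b (a ℕ.* b)) (trans (cong (ι b ℚ.+_) (ι-* a b))
    (trans (cong (ℚ._+ ι a ℚ.* ι b) (sym (ℚ.*-identityˡ (ι b)))) (sym (ℚ.*-distribʳ-+ (ι b) 1ℚ (ι a)))))

  ι-< : ∀ {a b} → a < b → ι a ℚ.< ι b
  ι-< {zero}  {suc zero}    _ = ℚ.positive⁻¹ 1ℚ
  ι-< {zero}  {suc (suc b)} _ = subst (ℚ._< ι (suc (suc b))) (ℚ.+-identityʳ 0ℚ) (ℚ.+-mono-< (ℚ.positive⁻¹ 1ℚ) (ι-< {zero} {suc b} (s≤s z≤n)))
  ι-< {suc a} {suc b} (s≤s lt) = ℚ.+-monoʳ-< 1ℚ (ι-< lt)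

  ι-≤ : ∀ {a b} → a ≤ b → ι a ℚ.≤ ι b
  ι-≤ le with ℕ.m≤n⇒m<n∨m≡n le
  ... | inj₁ lt   = ℚ.<⇒≤ (ι-< lt)
  ... | inj₂ refl = ℚ.≤-refl

  ι-injective : ∀ {a b} → ι a ≡ ι b → a ≡ b
  ι-injective {a} {b} eq with ℕ.<-cmp a b
  ... | tri< lt _ _ = ⊥-elim (ℚ.<-irrefl eq (ι-< lt))
  ... | tri≈ _ e _  = e
  ... | tri> _ _ gt = ⊥-elim (ℚ.<-irrefl (sym eq) (ι-< gt))

  GridPoint : Set
  GridPoint = ℕ × ℕ

  grid : GridPoint → Point
  grid (x , y) = ι x , ι y

  grid-injective : ∀ {P Q} → grid P ≡ grid Q → P ≡ Q
  grid-injective eq = cong₂ _,_ (ι-injective (cong proj₁ eq)) (ι-injective (cong proj₂ eq))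

  -- A line is given as the locus G = H of two functionals with natural coefficients.
  record Linear : Set where
    constructor lin
    field α β γ : ℕ

  _at_ : Linear → GridPoint → ℕ
  lin α β γ at (x , y) = α ℕ.* x ℕ.+ β ℕ.* y ℕ.+ γ

  diff : Linear → Linear → Point → ℚ
  diff (lin α β γ) (lin α′ β′ γ′) (x , y) =
    (ι α ℚ.- ι α′) ℚ.* x ℚ.+ (ι β ℚ.- ι β′) ℚ.* y ℚ.+ (ι γ ℚ.- ι γ′)

  ι-at : ∀ G P → ι (G at P) ≡ ι (Linear.α G) ℚ.* ι (proj₁ P) ℚ.+ ι (Linear.β G) ℚ.* ι (proj₂ P) ℚ.+ ι (Linear.γ G)
  ι-at (lin α β γ) (x , y) = trans (ι-+ (α ℕ.* x ℕ.+ β ℕ.* y) γ)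
    (cong (ℚ._+ ι γ) (trans (ι-+ (α ℕ.* x) (β ℕ.* y)) (cong₂ ℚ._+_ (ι-* α x) (ι-* β y))))

  diff-grid : ∀ G H P → diff G H (grid P) ≡ ι (G at P) ℚ.- ι (H at P)
  diff-grid G@(lin α β γ) H@(lin α′ β′ γ′) P@(x , y) =
    trans (solve 8 (λ a b c a′ b′ c′ x y →
        (a :- a′) :* x :+ (b :- b′) :* y :+ (c :- c′) := (a :* x :+ b :* y :+ c) :- (a′ :* x :+ b′ :* y :+ c′))
      refl (ι α) (ι β) (ι γ) (ι α′) (ι β′) (ι γ′) (ι x) (ι y))
    (sym (cong₂ ℚ._-_ (ι-at G P) (ι-at H P)))
    where open ℚ.+-*-Solver

  diff-segment : ∀ G H t p a b → OnSegAt t p a b →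
    diff G H p ≡ diff G H a ℚ.+ t ℚ.* (diff G H b ℚ.- diff G H a)
  diff-segment (lin α β γ) (lin α′ β′ γ′) t _ (x₁ , y₁) (x₂ , y₂) (refl , refl) =
    solve 8 (λ k l m x₁ y₁ x₂ y₂ t →
        k :* (x₁ :+ t :* (x₂ :- x₁)) :+ l :* (y₁ :+ t :* (y₂ :- y₁)) :+ m :=
        (k :* x₁ :+ l :* y₁ :+ m) :+ t :* ((k :* x₂ :+ l :* y₂ :+ m) :- (k :* x₁ :+ l :* y₁ :+ m)))
      refl (ι α ℚ.- ι α′) (ι β ℚ.- ι β′) (ι γ ℚ.- ι γ′) x₁ y₁ x₂ y₂ t
    where open ℚ.+-*-Solver

  q-p≥0 : ∀ {p q} → p ℚ.≤ q → 0ℚ ℚ.≤ q ℚ.- p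
  q-p≥0 {p} {q} le = subst (ℚ._≤ q ℚ.- p) (ℚ.+-inverseʳ p) (ℚ.+-monoˡ-≤ (ℚ.- p) le)

  q-p>0 : ∀ {p q} → p ℚ.< q → 0ℚ ℚ.< q ℚ.- p
  q-p>0 {p} {q} lt = subst (ℚ._< q ℚ.- p) (ℚ.+-inverseʳ p) (ℚ.+-monoˡ-< (ℚ.- p) lt)

  p-q≤0 : ∀ {p q} → p ℚ.≤ q → p ℚ.- q ℚ.≤ 0ℚ
  p-q≤0 {p} {q} le = subst (p ℚ.- q ℚ.≤_) (ℚ.+-inverseʳ q) (ℚ.+-monoˡ-≤ (ℚ.- q) le)

  0≤* : ∀ {p q} → 0ℚ ℚ.≤ p → 0ℚ ℚ.≤ q → 0ℚ ℚ.≤ p ℚ.* q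
  0≤* {p} {q} 0≤p 0≤q = ℚ.nonNegative⁻¹ (p ℚ.* q) {{ℚ.nonNeg*nonNeg⇒nonNeg p {{ℚ.nonNegative 0≤p}} q {{ℚ.nonNegative 0≤q}}}}

  interpolate-end : ∀ {t fa fb} → 0ℚ ℚ.≤ t → t ℚ.≤ 1ℚ → 0ℚ ℚ.< fa → 0ℚ ℚ.≤ fb →
    fa ℚ.+ t ℚ.* (fb ℚ.- fa) ℚ.≤ 0ℚ → t ≡ 1ℚ
  interpolate-end {t} {fa} {fb} 0≤t t≤1 0<fa 0≤fb le with ℚ.<-cmp t 1ℚ
  ... | tri≈ _ eq _ = eq
  ... | tri> _ _ gt = ⊥-elim (ℚ.<-irrefl refl (ℚ.<-≤-trans gt t≤1))
  ... | tri< t<1 _ _ = ⊥-elim (ℚ.<-irrefl refl (ℚ.<-≤-trans pos le))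
    where
    instance
      _ = ℚ.positive 0<fa
    pos : 0ℚ ℚ.< fa ℚ.+ t ℚ.* (fb ℚ.- fa)
    pos = subst₂ ℚ._<_ (ℚ.+-identityʳ 0ℚ)
      (solve 3 (λ t a b → (con 1ℚ :- t) :* a :+ t :* b := a :+ t :* (b :- a)) refl t fa fb)
      (ℚ.+-mono-<-≤ (subst (ℚ._< (1ℚ ℚ.- t) ℚ.* fa) (ℚ.*-zeroˡ fa) (ℚ.*-monoˡ-<-pos fa (q-p>0 t<1))) (0≤* 0≤t 0≤fb))
      where open ℚ.+-*-Solver

  interpolate-≤0 : ∀ {t fa fb} → 0ℚ ℚ.≤ t → t ℚ.≤ 1ℚ → fa ℚ.≤ 0ℚ → fb ℚ.≤ 0ℚ →
    fa ℚ.+ t ℚ.* (fb ℚ.- fa) ℚ.≤ 0ℚ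
  interpolate-≤0 {t} {fa} {fb} 0≤t t≤1 fa≤0 fb≤0 =
    subst₂ ℚ._≤_ (solve 3 (λ t a b → (con 1ℚ :- t) :* a :+ t :* b := a :+ t :* (b :- a)) refl t fa fb) (ℚ.+-identityʳ 0ℚ)
      (ℚ.+-mono-≤ (scale (q-p≥0 t≤1) fa≤0) (scale 0≤t fb≤0))
    where
    open ℚ.+-*-Solver
    scale : ∀ {s f} → 0ℚ ℚ.≤ s → f ℚ.≤ 0ℚ → s ℚ.* f ℚ.≤ 0ℚ
    scale {s} {f} 0≤s f≤0 = subst (s ℚ.* f ℚ.≤_) (ℚ.*-zeroʳ s) (ℚ.*-monoˡ-≤-nonNeg s {{ℚ.nonNegative 0≤s}} f≤0)

  segment-end : ∀ p a b → OnSegAt 1ℚ p a b → p ≡ b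
  segment-end _ (x₁ , y₁) (x₂ , y₂) (refl , refl) = cong₂ _,_ (eq x₁ x₂) (eq y₁ y₂)
    where
    open ℚ.+-*-Solver
    eq : ∀ a b → a ℚ.+ 1ℚ ℚ.* (b ℚ.- a) ≡ b
    eq = solve 2 (λ a b → a :+ con 1ℚ :* (b :- a) := b) refl

  -- A record, so that the end points U and V can be recovered from the type; they would be lost in
  -- the unfolded `OnSeg`.
  record OnGrid (p : Point) (U V : GridPoint) : Set where
    constructor onGrid
    field onSeg : OnSeg p (grid U) (grid V)

  record Hits (Z U V : GridPoint) : Set where
    constructor hits
    field onSeg : OnSeg (grid Z) (grid U) (grid V)

  flip-segment : ∀ {p U V} → OnGrid p U V → OnGrid p V U
  flip-segment {_} {U} {V} (onGrid (t , 0≤t , t≤1 , refl , refl)) = onGrid (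
    1ℚ ℚ.- t , q-p≥0 t≤1 , subst (1ℚ ℚ.- t ℚ.≤_) (ℚ.+-identityʳ 1ℚ) (ℚ.+-monoʳ-≤ 1ℚ (subst (ℚ.- t ℚ.≤_) refl (ℚ.neg-antimono-≤ 0≤t))) ,
    eq (ι (proj₁ U)) (ι (proj₁ V)) t , eq (ι (proj₂ U)) (ι (proj₂ V)) t)
    where
    open ℚ.+-*-Solver
    eq : ∀ a b t → a ℚ.+ t ℚ.* (b ℚ.- a) ≡ b ℚ.+ (1ℚ ℚ.- t) ℚ.* (a ℚ.- b)
    eq = solve 3 (λ a b t → a :+ t :* (b :- a) := b :+ (con 1ℚ :- t) :* (a :- b)) refl

  trivial-segment : ∀ Z → OnGrid (grid Z) Z Z
  trivial-segment (x , y) = onGrid (0ℚ , ℚ.≤-refl , ℚ.<⇒≤ (ℚ.positive⁻¹ 1ℚ) , eq (ι x) , eq (ι y))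
    where
    open ℚ.+-*-Solver
    eq : ∀ a → a ≡ a ℚ.+ 0ℚ ℚ.* (a ℚ.- a)
    eq = solve 1 (λ a → a := a :+ con 0ℚ :* (a :- a)) refl

  module _ (G H : Linear) where

    private
      ≤0 : ∀ P → G at P ≤ H at P → diff G H (grid P) ℚ.≤ 0ℚ
      ≤0 P le = subst (ℚ._≤ 0ℚ) (sym (diff-grid G H P)) (p-q≤0 (ι-≤ le))

    -- The line G = H separates the two segments, and U does not lie on it.
    separated : ∀ {U V P Q p} → H at U < G at U → H at V ≤ G at V → G at P ≤ H at P → G at Q ≤ H at Q →
      OnGrid p U V → OnGrid p P Q → p ≡ grid V
    separated {U} {V} {P} {Q} {p} U> V≥ P≤ Q≤ (onGrid (t , 0≤t , t≤1 , on)) (onGrid (s , 0≤s , s≤1 , on′)) =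
      segment-end p (grid U) (grid V) (subst (λ t → OnSegAt t p (grid U) (grid V)) t≡1 on)
      where
      t≡1 : t ≡ 1ℚ
      t≡1 = interpolate-end 0≤t t≤1
        (subst (0ℚ ℚ.<_) (sym (diff-grid G H U)) (q-p>0 (ι-< U>)))
        (subst (0ℚ ℚ.≤_) (sym (diff-grid G H V)) (q-p≥0 (ι-≤ V≥)))
        (subst (ℚ._≤ 0ℚ) (trans (sym (diff-segment G H s p (grid P) (grid Q) on′)) (diff-segment G H t p (grid U) (grid V) on))
          (interpolate-≤0 0≤s s≤1 (≤0 P P≤) (≤0 Q Q≤)))

    off-segment : ∀ {Z P Q} → H at Z < G at Z → G at P ≤ H at P → G at Q ≤ H at Q → ¬ Hits Z P Q
    off-segment {Z} {P} {Q} Z> P≤ Q≤ (hits (s , 0≤s , s≤1 , on)) =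
      ℚ.<-irrefl refl (ℚ.<-≤-trans (subst (0ℚ ℚ.<_) (sym (diff-grid G H Z)) (q-p>0 (ι-< Z>)))
        (subst (ℚ._≤ 0ℚ) (sym (diff-segment G H s (grid Z) (grid P) (grid Q) on)) (interpolate-≤0 0≤s s≤1 (≤0 P P≤) (≤0 Q Q≤))))

  -- Upper vertices lie on the line y = M, lower vertices on y = M - 1, and every vertex v ≥ 2 has
  -- abscissa v.  The hub B is the origin and A lies on the y-axis at height M + 1.  Since M exceeds
  -- all vertices, the slopes of the segments from B decrease with v.
  module Layout (H : ℕ) (lower : ℕ → Bool) where

    M : ℕ
    M = suc H

    height : ℕ → ℕ
    height z = if lower z then H else M

    loc : ℕ → GridPoint
    loc zero          = 0 , suc M
    loc (suc zero)    = 0 , 0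
    loc (suc (suc v)) = suc (suc v) , height (suc (suc v))

    loc-≥2 : ∀ {v} → 2 ≤ v → loc v ≡ (v , height v)
    loc-≥2 (s≤s (s≤s z≤n)) = refl

    height≥H : ∀ z → H ≤ height z
    height≥H z with lower z
    ... | true  = ℕ.≤-refl
    ... | false = ℕ.n≤1+n H

    height≤M : ∀ z → height z ≤ M
    height≤M z with lower z
    ... | true  = ℕ.n≤1+n H
    ... | false = ℕ.≤-refl

    upper-height : ∀ {z} → lower z ≡ false → height z ≡ M
    upper-height eq rewrite eq = refl

    lower-height : ∀ {z} → lower z ≡ true → height z ≡ H
    lower-height eq rewrite eq = refl

    -- Heights differ by at most 1, so it suffices that c (H + 1) < H (c + 1), that is c < H. This
    -- is where M has to exceed all vertices.
    slope : ∀ {c z} → c < z → z < M → c * height z < height c * z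
    slope {c} {z} c<z z<M = ℕ.<-≤-trans (ℕ.≤-<-trans (ℕ.*-monoʳ-≤ c (height≤M z)) strict) (ℕ.*-monoˡ-≤ z (height≥H c))
      where
      c<H : c < H
      c<H = ℕ.<-≤-trans c<z (ℕ.≤-pred z<M)
      strict : c * M < H * z
      strict = ℕ.<-≤-trans (subst₂ _<_ (sym (ℕ.*-comm c M)) (sym (ℕ.*-suc H c)) (ℕ.+-monoˡ-< (H * c) c<H))
                           (ℕ.*-monoʳ-≤ H c<z)

    record Vertex (v : ℕ) : Set where
      constructor vtx
      field
        ≥2 : 2 ≤ v
        <M : v < M
    open Vertex

    -- Besides the spokes there are chain edges between consecutive upper vertices, and the first
    -- (`hang`) and middle (`along`) edges of pendant paths. The last argument of `chain` and `hang`
    -- says that no upper vertex stands strictly between the ends; lower ones may.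
    data Kind : Edge → Set where
      hubA  : ∀ {c} → Vertex c → lower c ≡ false → Kind (0 , c)
      hubB  : ∀ {v} → Vertex v → Kind (1 , v)
      chain : ∀ {c v} → Vertex c → Vertex v → c < v → lower c ≡ false → lower v ≡ false →
              (∀ {u} → lower u ≡ false → u ≤ c ⊎ v ≤ u) → Kind (c , v)
      hang  : ∀ {c v} → Vertex c → Vertex v → c < v → lower c ≡ false → lower v ≡ true →
              (∀ {u} → lower u ≡ false → u ≤ c ⊎ v < u) → Kind (c , v)
      along : ∀ {v} → Vertex v → Vertex (suc v) → lower v ≡ true → lower (suc v) ≡ true → Kind (v , suc v)

    kind-ordered : ∀ {e} → Kind e → proj₁ e < proj₂ e
    kind-ordered (hubA vc _)            = ℕ.<-trans (s≤s z≤n) (≥2 vc)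
    kind-ordered (hubB vc)              = ≥2 vc
    kind-ordered (chain _ _ c<v _ _ _)  = c<v
    kind-ordered (hang _ _ c<v _ _ _)   = c<v
    kind-ordered (along {v} _ _ _ _)    = ℕ.n<1+n v

    kind-bounded : ∀ {e} → Kind e → proj₂ e < M
    kind-bounded (hubA vc _)          = <M vc
    kind-bounded (hubB vc)            = <M vc
    kind-bounded (chain _ vv _ _ _ _) = <M vv
    kind-bounded (hang _ vv _ _ _ _)  = <M vv
    kind-bounded (along _ vsv _ _)    = <M vsv

    On : Point → Edge → Set
    On p (u , v) = OnGrid p (loc u) (loc v)

    EndOf : ℕ → Edge → Set
    EndOf z (u , v) = u ≡ z ⊎ v ≡ z

    const↑ xAxis yAxis : ℕ → Linear
    const↑ a = lin 0 0 a
    xAxis a  = lin a 0 0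
    yAxis a  = lin 0 a 0

    private
      x-val : ∀ a x y → xAxis a at (x , y) ≡ a * x
      x-val a x y = trans (ℕ.+-identityʳ _) (ℕ.+-identityʳ _)
      y-val : ∀ a x y → yAxis a at (x , y) ≡ a * y
      y-val a x y = ℕ.+-identityʳ _
      y₁ : ∀ P → yAxis 1 at P ≡ proj₂ P
      y₁ (x , y) = trans (y-val 1 x y) (ℕ.*-identityˡ y)
      x₁ : ∀ P → xAxis 1 at P ≡ proj₁ P
      x₁ (x , y) = trans (x-val 1 x y) (ℕ.*-identityˡ x)

    module _ {U V P Q : GridPoint} {p : Point} where

      above : ∀ h → h < proj₂ U → h ≤ proj₂ V → proj₂ P ≤ h → proj₂ Q ≤ h →
        OnGrid p U V → OnGrid p P Q → p ≡ grid V
      above h a b c d = separated (yAxis 1) (const↑ h)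
        (subst (h <_) (sym (y₁ U)) a) (subst (h ≤_) (sym (y₁ V)) b)
        (subst (_≤ h) (sym (y₁ P)) c) (subst (_≤ h) (sym (y₁ Q)) d)

      below : ∀ h → proj₂ U < h → proj₂ V ≤ h → h ≤ proj₂ P → h ≤ proj₂ Q →
        OnGrid p U V → OnGrid p P Q → p ≡ grid V
      below h a b c d = separated (const↑ h) (yAxis 1)
        (subst (_< h) (sym (y₁ U)) a) (subst (_≤ h) (sym (y₁ V)) b)
        (subst (h ≤_) (sym (y₁ P)) c) (subst (h ≤_) (sym (y₁ Q)) d)

      right : ∀ h → h < proj₁ U → h ≤ proj₁ V → proj₁ P ≤ h → proj₁ Q ≤ h →
        OnGrid p U V → OnGrid p P Q → p ≡ grid V
      right h a b c d = separated (xAxis 1) (const↑ h)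
        (subst (h <_) (sym (x₁ U)) a) (subst (h ≤_) (sym (x₁ V)) b)
        (subst (_≤ h) (sym (x₁ P)) c) (subst (_≤ h) (sym (x₁ Q)) d)

    module _ {Z P Q : GridPoint} where

      off-above : ∀ h → h < proj₂ Z → proj₂ P ≤ h → proj₂ Q ≤ h → ¬ Hits Z P Q
      off-above h a c d = off-segment (yAxis 1) (const↑ h)
        (subst (h <_) (sym (y₁ Z)) a) (subst (_≤ h) (sym (y₁ P)) c) (subst (_≤ h) (sym (y₁ Q)) d)

      off-below : ∀ h → proj₂ Z < h → h ≤ proj₂ P → h ≤ proj₂ Q → ¬ Hits Z P Q
      off-below h a c d = off-segment (const↑ h) (yAxis 1)
        (subst (_< h) (sym (y₁ Z)) a) (subst (h ≤_) (sym (y₁ P)) c) (subst (h ≤_) (sym (y₁ Q)) d)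

      off-right : ∀ h → h < proj₁ Z → proj₁ P ≤ h → proj₁ Q ≤ h → ¬ Hits Z P Q
      off-right h a c d = off-segment (xAxis 1) (const↑ h)
        (subst (h <_) (sym (x₁ Z)) a) (subst (_≤ h) (sym (x₁ P)) c) (subst (_≤ h) (sym (x₁ Q)) d)

      off-left : ∀ h → proj₁ Z < h → h ≤ proj₁ P → h ≤ proj₁ Q → ¬ Hits Z P Q
      off-left h a c d = off-segment (const↑ h) (xAxis 1)
        (subst (_< h) (sym (x₁ Z)) a) (subst (h ≤_) (sym (x₁ P)) c) (subst (h ≤_) (sym (x₁ Q)) d)

    -- The line through B and the vertex c is  height c · x = c · y.
    rayˣ rayʸ : ℕ → Linear
    rayˣ c = xAxis (height c)
    rayʸ c = yAxis c

    module _ {c : ℕ} where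

      ray-B : rayˣ c at (0 , 0) ≡ rayʸ c at (0 , 0)
      ray-B = trans (trans (x-val (height c) 0 0) (ℕ.*-zeroʳ (height c))) (sym (trans (y-val c 0 0) (ℕ.*-zeroʳ c)))

      ray-right : ∀ {z} → c < z → z < M → rayʸ c at (z , height z) < rayˣ c at (z , height z)
      ray-right {z} c<z z<M = subst₂ _<_ (sym (y-val c z (height z))) (sym (x-val (height c) z (height z))) (slope c<z z<M)

      ray-self : rayʸ c at (c , height c) ≡ rayˣ c at (c , height c)
      ray-self = trans (y-val c c (height c)) (trans (ℕ.*-comm c (height c)) (sym (x-val (height c) c (height c))))

      ray-left : ∀ {z} → z < c → c < M → rayˣ c at (z , height z) < rayʸ c at (z , height z)
      ray-left {z} z<c c<M = subst₂ _<_ (sym (x-val (height c) z (height z))) (sym (y-val c z (height z)))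
        (subst₂ _<_ (ℕ.*-comm z (height c)) (ℕ.*-comm (height z) c) (slope z<c c<M))

      ray-≥ : ∀ {z} → c ≤ z → z < M → rayʸ c at (z , height z) ≤ rayˣ c at (z , height z)
      ray-≥ c≤z z<M with ℕ.m≤n⇒m<n∨m≡n c≤z
      ... | inj₁ c<z  = ℕ.<⇒≤ (ray-right c<z z<M)
      ... | inj₂ refl = ℕ.≤-reflexive ray-self

      ray-≤ : ∀ {z} → z ≤ c → c < M → rayˣ c at (z , height z) ≤ rayʸ c at (z , height z)
      ray-≤ z≤c c<M with ℕ.m≤n⇒m<n∨m≡n z≤c
      ... | inj₁ z<c  = ℕ.<⇒≤ (ray-left z<c c<M)
      ... | inj₂ refl = ℕ.≤-reflexive (sym ray-self)

    -- The line through A and the upper vertex c is  x + c · y = c · (M + 1).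
    fan : ℕ → Linear
    fan c = lin 1 c 0

    fan-A : ∀ c → fan c at (0 , suc M) ≡ c * suc M
    fan-A c = ℕ.+-identityʳ (c * suc M)

    fan-upper : ∀ c z → fan c at (z , M) ≡ z + c * M
    fan-upper c z = trans (ℕ.+-identityʳ _) (cong (_+ c * M) (ℕ.+-identityʳ z))

    fan-self : ∀ c → fan c at (c , M) ≡ c * suc M
    fan-self c = trans (fan-upper c c) (sym (ℕ.*-suc c M))

    fan-right : ∀ {c z} → c < z → c * suc M < fan c at (z , M)
    fan-right {c} {z} c<z = subst₂ _<_ (sym (ℕ.*-suc c M)) (sym (fan-upper c z)) (ℕ.+-monoˡ-< (c * M) c<z)

    fan-left : ∀ {c z} → z < c → fan c at (z , M) < c * suc M
    fan-left {c} {z} z<c = subst₂ _<_ (sym (fan-upper c z)) (sym (ℕ.*-suc c M)) (ℕ.+-monoˡ-< (c * M) z<c)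

    -- The line through the upper vertex c and the lower vertex c + d is  x + d · y = c + d · M.
    module _ (c d : ℕ) where

      lean-upper : lin 1 d 0 at (c , M) ≡ c + d * M
      lean-upper = trans (ℕ.+-identityʳ _) (cong (_+ d * M) (ℕ.+-identityʳ c))

      lean-lower : ∀ e → lin 1 d 0 at (c + (d + e) , H) ≡ e + (c + d * M)
      lean-lower e = eq c d e H
        where
        eq : ∀ c d e H → 1 * (c + (d + e)) + d * H + 0 ≡ e + (c + d * suc H)
        eq = solve-∀

    loc-injective : ∀ {u v} → loc u ≡ loc v → u ≡ v
    loc-injective {zero}        {zero}        eq = refl
    loc-injective {zero}        {suc zero}    eq with () ← cong proj₂ eq
    loc-injective {zero}        {suc (suc _)} eq with () ← cong proj₁ eq
    loc-injective {suc zero}    {zero}        eq with () ← cong proj₂ eq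
    loc-injective {suc zero}    {suc zero}    eq = refl
    loc-injective {suc zero}    {suc (suc _)} eq with () ← cong proj₁ eq
    loc-injective {suc (suc _)} {zero}        eq with () ← cong proj₁ eq
    loc-injective {suc (suc _)} {suc zero}    eq with () ← cong proj₁ eq
    loc-injective {suc (suc _)} {suc (suc _)} eq = cong proj₁ eq

    data Place : ℕ → Set where
      hubA  : Place 0
      hubB  : Place 1
      upper : ∀ {z} → 2 ≤ z → lower z ≡ false → Place z
      low   : ∀ {z} → 2 ≤ z → lower z ≡ true → Place z

    place : ∀ z → Place z
    place zero       = hubA
    place (suc zero) = hubB
    place z@(suc (suc _)) with lower z in eq
    ... | false = upper (s≤s (s≤s z≤n)) eq
    ... | true  = low (s≤s (s≤s z≤n)) eq

    loc-upper : ∀ {v} → 2 ≤ v → lower v ≡ false → loc v ≡ (v , M)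
    loc-upper 2≤v up = trans (loc-≥2 2≤v) (cong (_ ,_) (upper-height up))

    loc-lower : ∀ {v} → 2 ≤ v → lower v ≡ true → loc v ≡ (v , H)
    loc-lower 2≤v lo = trans (loc-≥2 2≤v) (cong (_ ,_) (lower-height lo))

    module Drawing (0<H : 0 < H) where

      at₂ : ∀ {p u v U V} → loc u ≡ U → loc v ≡ V → On p (u , v) → OnGrid p U V
      at₂ refl refl on = on

      at₁ : ∀ z {Z U V} → loc z ≡ Z → OnGrid (grid (loc z)) U V → Hits Z U V
      at₁ z refl (onGrid on) = hits on

      off-ray : ∀ {v z} → 2 ≤ v → v < M → 2 ≤ z → z < M → z ≢ v → ¬ On (grid (loc z)) (1 , v)
      off-ray {v} {z} 2≤v v<M 2≤z z<M z≢v on with ℕ.<-cmp z v | at₁ z (loc-≥2 2≤z) (at₂ {u = 1} refl (loc-≥2 2≤v) on)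
      ... | tri< z<v _ _ | on′ = off-segment (rayʸ v) (rayˣ v) (ray-left z<v v<M) (ℕ.≤-reflexive (sym ray-B)) (ℕ.≤-reflexive ray-self) on′
      ... | tri≈ _ z≡v _ | _   = z≢v z≡v
      ... | tri> _ _ v<z | on′ = off-segment (rayˣ v) (rayʸ v) (ray-right v<z z<M) (ℕ.≤-reflexive ray-B) (ℕ.≤-reflexive (sym ray-self)) on′

      off-edge : ∀ {z e} → z < M → Kind e → ¬ EndOf z e → ¬ On (grid (loc z)) e
      off-edge {z} z<M (hubA {c} (vtx 2≤c c<M) up) away on with at₂ {u = 0} refl (loc-upper 2≤c up) on | place z
      ... | on′ | hubA = away (inj₁ refl)
      ... | on′ | hubB = off-below M (s≤s z≤n) (ℕ.n≤1+n M) ℕ.≤-refl (at₁ 1 refl on′)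
      ... | on′ | low 2≤z lo = off-below M (ℕ.n<1+n H) (ℕ.n≤1+n M) ℕ.≤-refl (at₁ z (loc-lower 2≤z lo) on′)
      ... | on′ | upper 2≤z up′ with ℕ.<-cmp z c
      ...   | tri< z<c _ _ = off-segment (const↑ (c * suc M)) (fan c) (fan-left z<c) (ℕ.≤-reflexive (sym (fan-A c))) (ℕ.≤-reflexive (sym (fan-self c))) (at₁ z (loc-upper 2≤z up′) on′)
      ...   | tri≈ _ z≡c _ = away (inj₂ (sym z≡c))
      ...   | tri> _ _ c<z = off-segment (fan c) (const↑ (c * suc M)) (fan-right c<z) (ℕ.≤-reflexive (fan-A c)) (ℕ.≤-reflexive (fan-self c)) (at₁ z (loc-upper 2≤z up′) on′)
      off-edge {z} z<M (hubB {v} (vtx 2≤v v<M)) away on with place z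
      ... | hubA = off-above M (ℕ.n<1+n M) z≤n (height≤M v) (at₁ 0 refl (at₂ {u = 1} refl (loc-≥2 2≤v) on))
      ... | hubB = away (inj₁ refl)
      ... | upper 2≤z _ = off-ray 2≤v v<M 2≤z z<M (away ∘ inj₂ ∘ sym) on
      ... | low 2≤z _   = off-ray 2≤v v<M 2≤z z<M (away ∘ inj₂ ∘ sym) on
      off-edge {z} z<M (chain {c} {v} (vtx 2≤c _) (vtx 2≤v _) c<v upc upv between) away on
        with at₂ (loc-upper 2≤c upc) (loc-upper 2≤v upv) on | place z
      ... | on′ | hubA = off-above M (ℕ.n<1+n M) ℕ.≤-refl ℕ.≤-refl (at₁ 0 refl on′)
      ... | on′ | hubB = off-below M (s≤s z≤n) ℕ.≤-refl ℕ.≤-refl (at₁ 1 refl on′)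
      ... | on′ | low 2≤z lo = off-below M (ℕ.n<1+n H) ℕ.≤-refl ℕ.≤-refl (at₁ z (loc-lower 2≤z lo) on′)
      ... | on′ | upper 2≤z up with between up
      ...   | inj₁ z≤c = off-left c (ℕ.≤∧≢⇒< z≤c (away ∘ inj₁ ∘ sym)) ℕ.≤-refl (ℕ.<⇒≤ c<v) (at₁ z (loc-upper 2≤z up) on′)
      ...   | inj₂ v≤z = off-right v (ℕ.≤∧≢⇒< v≤z (away ∘ inj₂)) (ℕ.<⇒≤ c<v) ℕ.≤-refl (at₁ z (loc-upper 2≤z up) on′)
      off-edge {z} z<M (hang {c} {v} (vtx 2≤c _) (vtx 2≤v _) c<v upc lov between) away on
        with at₂ (loc-upper 2≤c upc) (loc-lower 2≤v lov) on | place z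
      ... | on′ | hubA = off-above M (ℕ.n<1+n M) ℕ.≤-refl (ℕ.n≤1+n H) (at₁ 0 refl on′)
      ... | on′ | hubB = off-below H 0<H (ℕ.n≤1+n H) ℕ.≤-refl (at₁ 1 refl on′)
      ... | on′ | low 2≤z lo = away (inj₂ (sym (loc-injective (grid-injective {loc z} {loc v}
              (trans (above H (ℕ.n<1+n H) ℕ.≤-refl (ℕ.≤-reflexive (trans (cong proj₂ (loc-lower 2≤z lo)) refl)) (ℕ.≤-reflexive (trans (cong proj₂ (loc-lower 2≤z lo)) refl)) on′ (trivial-segment (loc z)))
                (cong grid (sym (loc-lower 2≤v lov))))))))
      ... | on′ | upper 2≤z up with between up
      ...   | inj₁ z≤c = off-left c (ℕ.≤∧≢⇒< z≤c (away ∘ inj₁ ∘ sym)) ℕ.≤-refl (ℕ.<⇒≤ c<v) (at₁ z (loc-upper 2≤z up) on′)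
      ...   | inj₂ v<z = off-right v v<z (ℕ.<⇒≤ c<v) ℕ.≤-refl (at₁ z (loc-upper 2≤z up) on′)
      off-edge {z} z<M (along {v} (vtx 2≤v _) (vtx 2≤sv _) lov losv) away on
        with at₂ (loc-lower 2≤v lov) (loc-lower 2≤sv losv) on | place z
      ... | on′ | hubA = off-above M (ℕ.n<1+n M) (ℕ.n≤1+n H) (ℕ.n≤1+n H) (at₁ 0 refl on′)
      ... | on′ | hubB = off-below H 0<H ℕ.≤-refl ℕ.≤-refl (at₁ 1 refl on′)
      ... | on′ | upper 2≤z up = off-above H (ℕ.n<1+n H) ℕ.≤-refl ℕ.≤-refl (at₁ z (loc-upper 2≤z up) on′)
      ... | on′ | low 2≤z lo with ℕ.<-cmp z v
      ...   | tri< z<v _ _ = off-left v z<v ℕ.≤-refl (ℕ.n≤1+n v) (at₁ z (loc-lower 2≤z lo) on′)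
      ...   | tri≈ _ z≡v _ = away (inj₁ (sym z≡v))
      ...   | tri> _ _ v<z = off-right (suc v) (ℕ.≤∧≢⇒< v<z (away ∘ inj₂)) (ℕ.n≤1+n v) ℕ.≤-refl (at₁ z (loc-lower 2≤z lo) on′)

      MeetAtEnd : Edge → Edge → Set
      MeetAtEnd e f = ∀ {p} → On p e → On p f → ∃[ v ] (EndOf v e ⊎ EndOf v f) × p ≡ grid (loc v)

      swapMeet : ∀ {e f} → MeetAtEnd e f → MeetAtEnd f e
      swapMeet meet on on′ with meet on′ on
      ... | v , inj₁ end , eq = v , inj₂ end , eq
      ... | v , inj₂ end , eq = v , inj₁ end , eq

      -- What is needed of an edge away from the hubs when it is compared with a spoke from B. The
      -- last field speaks only of edges that pass some vertex, so `along` edges, which join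
      -- neighbours, satisfy it vacuously.
      data Inner : Edge → Set where
        inner : ∀ {c v} → Vertex c → Vertex v → c < v →
          (∀ {u} → lower u ≡ false → u ≤ c ⊎ v ≤ u) →
          (∀ {u} → c < u → u < v → H < height c × H ≤ height v) → Inner (c , v)

      innerChain : ∀ {c v} → Vertex c → Vertex v → c < v → lower c ≡ false → lower v ≡ false →
        (∀ {u} → lower u ≡ false → u ≤ c ⊎ v ≤ u) → Inner (c , v)
      innerChain vc vv c<v upc upv between = inner vc vv c<v between
        (λ _ _ → ℕ.≤-reflexive (sym (upper-height upc)) , height≥H _)

      innerHang : ∀ {c v} → Vertex c → Vertex v → c < v → lower c ≡ false →
        (∀ {u} → lower u ≡ false → u ≤ c ⊎ v < u) → Inner (c , v)
      innerHang vc vv c<v upc between = inner vc vv c<v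
        ([ inj₁ , inj₂ ∘ ℕ.<⇒≤ ]′ ∘ between)
        (λ _ _ → ℕ.≤-reflexive (sym (upper-height upc)) , height≥H _)

      innerAlong : ∀ {v} → Vertex v → Vertex (suc v) → Inner (v , suc v)
      innerAlong {v} vv vsv = inner vv vsv ℕ.≤-refl (λ {u} _ → ℕ.≤-<-connex u v)
        (λ v<u u<sv → ⊥-elim (ℕ.<-irrefl refl (ℕ.<-≤-trans v<u (ℕ.≤-pred u<sv))))

      meet-A-A : ∀ {c d} → Vertex c → lower c ≡ false → Vertex d → lower d ≡ false → c ≢ d → MeetAtEnd (0 , c) (0 , d)
      meet-A-A {c} {d} (vtx 2≤c _) upc (vtx 2≤d _) upd c≢d on on′ with ℕ.<-cmp c d
                    | flip-segment (at₂ {u = 0} refl (loc-upper 2≤c upc) on) | at₂ {u = 0} refl (loc-upper 2≤d upd) on′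
      ... | tri< c<d _ _ | s | s′ = 0 , inj₁ (inj₁ refl) ,
            separated (const↑ (d * suc M)) (fan d) (fan-left c<d) (ℕ.≤-reflexive (fan-A d)) (ℕ.≤-reflexive (sym (fan-A d))) (ℕ.≤-reflexive (sym (fan-self d))) s s′
      ... | tri≈ _ c≡d _ | _ | _ = ⊥-elim (c≢d c≡d)
      ... | tri> _ _ d<c | s | s′ = 0 , inj₁ (inj₁ refl) ,
            separated (fan d) (const↑ (d * suc M)) (fan-right d<c) (ℕ.≤-reflexive (sym (fan-A d))) (ℕ.≤-reflexive (fan-A d)) (ℕ.≤-reflexive (fan-self d)) s s′

      meet-A-low : ∀ {c u v} → Vertex c → lower c ≡ false → proj₂ (loc u) ≤ M → proj₂ (loc v) ≤ M → MeetAtEnd (0 , c) (u , v)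
      meet-A-low {c} (vtx 2≤c _) upc hu hv on on′ = c , inj₁ (inj₂ refl) ,
        trans (above M (ℕ.n<1+n M) ℕ.≤-refl hu hv (at₂ {u = 0} refl (loc-upper 2≤c upc) on) on′) (cong grid (sym (loc-upper 2≤c upc)))

      vertex-low : ∀ {v} → Vertex v → proj₂ (loc v) ≤ M
      vertex-low {v} (vtx 2≤v _) = subst (_≤ M) (cong proj₂ (sym (loc-≥2 2≤v))) (height≤M v)

      meet-B-B : ∀ {c d} → Vertex c → Vertex d → c ≢ d → MeetAtEnd (1 , c) (1 , d)
      meet-B-B {c} {d} (vtx 2≤c c<M) (vtx 2≤d d<M) c≢d on on′ with ℕ.<-cmp c d
                    | flip-segment (at₂ {u = 1} refl (loc-≥2 2≤c) on) | at₂ {u = 1} refl (loc-≥2 2≤d) on′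
      ... | tri< c<d _ _ | s | s′ = 1 , inj₁ (inj₁ refl) ,
            separated (rayʸ d) (rayˣ d) (ray-left c<d d<M) (ℕ.≤-reflexive ray-B) (ℕ.≤-reflexive (sym ray-B)) (ℕ.≤-reflexive ray-self) s s′
      ... | tri≈ _ c≡d _ | _ | _ = ⊥-elim (c≢d c≡d)
      ... | tri> _ _ d<c | s | s′ = 1 , inj₁ (inj₁ refl) ,
            separated (rayˣ d) (rayʸ d) (ray-right d<c c<M) (ℕ.≤-reflexive (sym ray-B)) (ℕ.≤-reflexive ray-B) (ℕ.≤-reflexive (sym ray-self)) s s′

      -- If d is not strictly between c and v, the line of its ray separates the two segments. If it
      -- is, d must be a lower vertex; its ray then stays at height at most H, while the edge starts
      -- above H and does not go below it.
      meet-inner-B : ∀ {d e} → Inner e → Vertex d → MeetAtEnd e (1 , d)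
      meet-inner-B {d} (inner {c} {v} (vtx 2≤c c<M) (vtx 2≤v v<M) c<v between high) (vtx 2≤d d<M) on on′
        with ℕ.≤-<-connex d c | ℕ.≤-<-connex v d | at₂ (loc-≥2 2≤c) (loc-≥2 2≤v) on | at₂ {u = 1} refl (loc-≥2 2≤d) on′
      ... | inj₁ d≤c | _ | s | s′ = c , inj₁ (inj₁ refl) , trans
            (separated (rayˣ d) (rayʸ d) (ray-right (ℕ.≤-<-trans d≤c c<v) v<M) (ray-≥ d≤c c<M) (ℕ.≤-reflexive ray-B) (ℕ.≤-reflexive (sym ray-self)) (flip-segment s) s′)
            (cong grid (sym (loc-≥2 2≤c)))
      ... | inj₂ _ | inj₁ v≤d | s | s′ = v , inj₁ (inj₂ refl) , trans
            (separated (rayʸ d) (rayˣ d) (ray-left (ℕ.<-≤-trans c<v v≤d) d<M) (ray-≤ v≤d d<M) (ℕ.≤-reflexive (sym ray-B)) (ℕ.≤-reflexive ray-self) s s′)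
            (cong grid (sym (loc-≥2 2≤v)))
      ... | inj₂ c<d | inj₂ d<v | s | s′ with lower d in eq
      ...   | false = ⊥-elim ([ (λ d≤c → ℕ.<-irrefl refl (ℕ.<-≤-trans c<d d≤c)) , (λ v≤d → ℕ.<-irrefl refl (ℕ.<-≤-trans d<v v≤d)) ]′ (between eq))
      ...   | true  = v , inj₁ (inj₂ refl) , trans
            (above H (proj₁ (high c<d d<v)) (proj₂ (high c<d d<v)) z≤n ℕ.≤-refl s s′)
            (cong grid (sym (loc-≥2 2≤v)))

      meet-apart : ∀ {a b c d} → Vertex a → Vertex b → Vertex c → Vertex d → a < b → b ≤ c → c < d → MeetAtEnd (a , b) (c , d)
      meet-apart {c = c} (vtx 2≤a _) (vtx 2≤b _) (vtx 2≤c _) (vtx 2≤d _) a<b b≤c c<d on on′ = c , inj₂ (inj₁ refl) , trans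
        (right c c<d ℕ.≤-refl (ℕ.≤-trans (ℕ.<⇒≤ a<b) b≤c) b≤c
          (flip-segment (at₂ (loc-≥2 2≤c) (loc-≥2 2≤d) on′)) (at₂ (loc-≥2 2≤a) (loc-≥2 2≤b) on))
        (cong grid (sym (loc-≥2 2≤c)))

      meet-hang-chain : ∀ {c v a b} → Vertex c → Vertex v → lower c ≡ false → lower v ≡ true →
        Vertex a → Vertex b → lower a ≡ false → lower b ≡ false → MeetAtEnd (c , v) (a , b)
      meet-hang-chain {c} (vtx 2≤c _) (vtx 2≤v _) upc lov (vtx 2≤a _) (vtx 2≤b _) upa upb on on′ =
        c , inj₁ (inj₁ refl) , trans
        (below M (ℕ.n<1+n H) ℕ.≤-refl ℕ.≤-refl ℕ.≤-refl
          (flip-segment (at₂ (loc-upper 2≤c upc) (loc-lower 2≤v lov) on)) (at₂ (loc-upper 2≤a upa) (loc-upper 2≤b upb) on′))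
        (cong grid (sym (loc-upper 2≤c upc)))

      meet-above-along : ∀ {c v a b} → Vertex c → Vertex v → lower c ≡ false →
        Vertex a → Vertex b → lower a ≡ true → lower b ≡ true → MeetAtEnd (c , v) (a , b)
      meet-above-along {c} {v} (vtx 2≤c _) (vtx 2≤v _) upc (vtx 2≤a _) (vtx 2≤b _) loa lob on on′ =
        v , inj₁ (inj₂ refl) , trans
        (above H (ℕ.n<1+n H) (height≥H v) ℕ.≤-refl ℕ.≤-refl
          (at₂ (loc-upper 2≤c upc) (loc-≥2 2≤v) on) (at₂ (loc-lower 2≤a loa) (loc-lower 2≤b lob) on′))
        (cong grid (sym (loc-≥2 2≤v)))

      -- Both edges start at c. The line through c and the nearer lower vertex v has w strictly on
      -- its right, so the segments share only c.
      meet-hang-hang : ∀ {c v w} → Vertex c → Vertex v → Vertex w → c < v → v < w →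
        lower c ≡ false → lower v ≡ true → lower w ≡ true → MeetAtEnd (c , v) (c , w)
      meet-hang-hang {c} {v} {w} (vtx 2≤c _) (vtx 2≤v _) (vtx 2≤w _) c<v v<w upc lov low′ on on′ =
        c , inj₁ (inj₁ refl) , trans
        (separated (lin 1 d 0) (const↑ (c + d * M)) strict (ℕ.≤-reflexive (sym (lean-upper c d)))
          (ℕ.≤-reflexive (lean-upper c d)) (ℕ.≤-reflexive flat)
          (flip-segment (at₂ (loc-upper 2≤c upc) (loc-lower 2≤w low′) on′)) (at₂ (loc-upper 2≤c upc) (loc-lower 2≤v lov) on))
        (cong grid (sym (loc-upper 2≤c upc)))
        where
        d e : ℕ
        d = v ∸ c
        e = w ∸ v
        c+d : c + d ≡ v
        c+d = ℕ.m+[n∸m]≡n (ℕ.<⇒≤ c<v)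
        v≡ : c + (d + 0) ≡ v
        v≡ = trans (cong (c +_) (ℕ.+-identityʳ d)) c+d
        w≡ : c + (d + e) ≡ w
        w≡ = trans (sym (ℕ.+-assoc c d e)) (trans (cong (_+ e) c+d) (ℕ.m+[n∸m]≡n (ℕ.<⇒≤ v<w)))
        flat : lin 1 d 0 at (v , H) ≡ c + d * M
        flat = subst (λ v → lin 1 d 0 at (v , H) ≡ c + d * M) v≡ (lean-lower c d 0)
        strict : c + d * M < lin 1 d 0 at (w , H)
        strict = subst (λ w → c + d * M < lin 1 d 0 at (w , H)) w≡
          (subst (c + d * M <_) (sym (lean-lower c d e)) (ℕ.m<n+m (c + d * M) (ℕ.m<n⇒0<n∸m v<w)))

      meet-inner-inner : ∀ {e f} → Kind e → Kind f → Inner e → Inner f → e ≢ f → MeetAtEnd e f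
      meet-inner-inner (hubA _ _) _ (inner (vtx () _) _ _ _ _) _ _
      meet-inner-inner (hubB _) _ (inner (vtx (s≤s ()) _) _ _ _ _) _ _
      meet-inner-inner _ (hubA _ _) _ (inner (vtx () _) _ _ _ _) _
      meet-inner-inner _ (hubB _) _ (inner (vtx (s≤s ()) _) _ _ _ _) _
      meet-inner-inner (chain vc vv c<v upc upv btw) (chain va vb a<b upa upb btw′) _ _ e≢f with btw upa | btw′ upc
      ... | inj₂ v≤a | _ = meet-apart vc vv va vb c<v v≤a a<b
      ... | inj₁ _ | inj₂ b≤c = swapMeet (meet-apart va vb vc vv a<b b≤c c<v)
      ... | inj₁ a≤c | inj₁ c≤a with ℕ.≤-antisym a≤c c≤a
      ...   | refl with btw upb | btw′ upv
      ...     | inj₁ b≤c | _ = ⊥-elim (ℕ.<-irrefl refl (ℕ.<-≤-trans a<b b≤c))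
      ...     | inj₂ _ | inj₁ v≤a = ⊥-elim (ℕ.<-irrefl refl (ℕ.<-≤-trans c<v v≤a))
      ...     | inj₂ v≤b | inj₂ b≤v = ⊥-elim (e≢f (cong (_ ,_) (ℕ.≤-antisym v≤b b≤v)))
      meet-inner-inner (chain vc vv _ upc upv _) (hang va vb _ upa lob _) _ _ _ =
        swapMeet (meet-hang-chain va vb upa lob vc vv upc upv)
      meet-inner-inner (chain vc vv _ upc _ _) (along va vb loa lob) _ _ _ = meet-above-along vc vv upc va vb loa lob
      meet-inner-inner (hang vc vv _ upc lov _) (chain va vb _ upa upb _) _ _ _ = meet-hang-chain vc vv upc lov va vb upa upb
      meet-inner-inner (hang {v = v} vc vv c<v upc lov btw) (hang {v = b} va vb a<b upa lob btw′) _ _ e≢f with btw upa | btw′ upc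
      ... | inj₂ v<a | _ = meet-apart vc vv va vb c<v (ℕ.<⇒≤ v<a) a<b
      ... | inj₁ _ | inj₂ b<c = swapMeet (meet-apart va vb vc vv a<b (ℕ.<⇒≤ b<c) c<v)
      ... | inj₁ a≤c | inj₁ c≤a with ℕ.≤-antisym a≤c c≤a
      ...   | refl with ℕ.<-cmp v b
      ...     | tri< v<b _ _ = meet-hang-hang vc vv vb c<v v<b upc lov lob
      ...     | tri≈ _ refl _ = ⊥-elim (e≢f refl)
      ...     | tri> _ _ b<v = swapMeet (meet-hang-hang vc vb vv a<b b<v upc lob lov)
      meet-inner-inner (hang vc vv _ upc _ _) (along va vb loa lob) _ _ _ = meet-above-along vc vv upc va vb loa lob
      meet-inner-inner (along va vb loa lob) (chain vc vv _ upc _ _) _ _ _ = swapMeet (meet-above-along vc vv upc va vb loa lob)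
      meet-inner-inner (along va vb loa lob) (hang vc vv _ upc _ _) _ _ _ = swapMeet (meet-above-along vc vv upc va vb loa lob)
      meet-inner-inner (along {v} vv vsv _ _) (along {a} va vsa _ _) _ _ e≢f with ℕ.<-cmp v a
      ... | tri< v<a _ _ = meet-apart vv vsv va vsa ℕ.≤-refl v<a ℕ.≤-refl
      ... | tri≈ _ refl _ = ⊥-elim (e≢f refl)
      ... | tri> _ _ a<v = swapMeet (meet-apart va vsa vv vsv ℕ.≤-refl a<v ℕ.≤-refl)

      data Class : Edge → Set where
        spokeA : ∀ {c} → Vertex c → lower c ≡ false → Class (0 , c)
        spokeB : ∀ {c} → Vertex c → Class (1 , c)
        within : ∀ {e} → Inner e → Class e

      classify : ∀ {e} → Kind e → Class e
      classify (hubA vc up)                    = spokeA vc up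
      classify (hubB vc)                       = spokeB vc
      classify (chain vc vv c<v upc upv btw)   = within (innerChain vc vv c<v upc upv btw)
      classify (hang vc vv c<v upc _ btw)      = within (innerHang vc vv c<v upc btw)
      classify (along vv vsv _ _)              = within (innerAlong vv vsv)

      meet : ∀ {e f} → Kind e → Kind f → e ≢ f → MeetAtEnd e f
      meet k k′ e≢f with classify k | classify k′
      ... | spokeA vc up | spokeA vd up′ = meet-A-A vc up vd up′ (e≢f ∘ cong (0 ,_))
      ... | spokeA vc up | spokeB vd     = meet-A-low vc up z≤n (vertex-low vd)
      ... | spokeA vc up | within (inner va vb _ _ _) = meet-A-low vc up (vertex-low va) (vertex-low vb)
      ... | spokeB vd    | spokeA vc up  = swapMeet (meet-A-low vc up z≤n (vertex-low vd))
      ... | spokeB vc    | spokeB vd     = meet-B-B vc vd (e≢f ∘ cong (1 ,_))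
      ... | spokeB vd    | within i      = swapMeet (meet-inner-B i vd)
      ... | within (inner va vb _ _ _) | spokeA vc up = swapMeet (meet-A-low vc up (vertex-low va) (vertex-low vb))
      ... | within i     | spokeB vd     = meet-inner-B i vd
      ... | within i     | within j      = meet-inner-inner k k′ i j e≢f

      -- Separation shows only that the common point is an end of one of the edges. That end lies on
      -- the other edge too, and by `off-edge` a vertex lies on no edge except those ending in it.
      meet-common : ∀ {e f} → Kind e → Kind f → e ≢ f → ∀ {p} → On p e → On p f →
        ∃[ v ] EndOf v e × EndOf v f × p ≡ grid (loc v)
      meet-common {e} {f} k k′ e≢f on on′ with meet k k′ e≢f on on′
      ... | v , end , refl = v , both end
        where
        endOf? : ∀ e → Dec (EndOf v e)
        endOf? (a , b) with a ≟ v | b ≟ v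
        ... | yes p | _     = yes (inj₁ p)
        ... | no _  | yes q = yes (inj₂ q)
        ... | no p  | no q  = no [ p , q ]′
        <M-of : ∀ {e} → Kind e → EndOf v e → v < M
        <M-of kg (inj₁ refl) = ℕ.<-trans (kind-ordered kg) (kind-bounded kg)
        <M-of kg (inj₂ refl) = kind-bounded kg
        other : ∀ {g} → Kind g → v < M → On (grid (loc v)) g → EndOf v g
        other {g} kg v<M ong with endOf? g
        ... | yes q = q
        ... | no ¬q = ⊥-elim (off-edge v<M kg ¬q ong)
        both : EndOf v e ⊎ EndOf v f → EndOf v e × EndOf v f × grid (loc v) ≡ grid (loc v)
        both (inj₁ q) = q , other k′ (<M-of k q) on′ , refl
        both (inj₂ q) = other k (<M-of k′ q) on , q , refl

    module _ (0<H : 0 < H) (es : List Edge)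
             (distinct : ∀ i j → List.lookup es i ≡ List.lookup es j → i ≡ j)
             (kinds : All Kind es) where

      open Drawing 0<H

      private
        kind : ∀ i → Kind (List.lookup es i)
        kind i = All.lookup kinds (∈-lookup i)

      edge-ordered : ∀ i → proj₁ (List.lookup es i) < proj₂ (List.lookup es i)
      edge-ordered i = kind-ordered (kind i)

      edge-bounded : ∀ i → proj₂ (List.lookup es i) < M
      edge-bounded i = kind-bounded (kind i)

      layoutGraph : SimpleGraph
      layoutGraph = graph M es edge-ordered edge-bounded distinct

      private
        G : SimpleGraph
        G = layoutGraph

        edge≡ : ∀ i → List.lookup es i ≡ (toℕ (proj₁ (ends G i)) , toℕ (proj₂ (ends G i)))
        edge≡ = graph-edge M es edge-ordered edge-bounded distinct

        on : ∀ {p} i → OnEdge G (grid ∘ loc ∘ toℕ) p i → On p (List.lookup es i)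
        on {p} i onE = subst (On p) (sym (edge≡ i)) (onGrid onE)

        incident : ∀ i z → EndOf (toℕ z) (List.lookup es i) → Incident G i z
        incident i z end with subst (EndOf (toℕ z)) (edge≡ i) end
        ... | inj₁ eq = inj₁ (Fin.toℕ-injective eq)
        ... | inj₂ eq = inj₂ (Fin.toℕ-injective eq)

        end< : ∀ i {v} → EndOf v (List.lookup es i) → v < M
        end< i (inj₁ refl) = ℕ.<-trans (edge-ordered i) (edge-bounded i)
        end< i (inj₂ refl) = edge-bounded i

      planeDrawing : PlaneDrawing G
      planeDrawing = record
        { pos = grid ∘ loc ∘ toℕ
        ; pos-inj = λ u v eq → Fin.toℕ-injective (loc-injective (grid-injective eq))
        ; vertex-off-edge = λ v i ¬inc onE → off-edge (Fin.toℕ<n v) (kind i) (¬inc ∘ incident i v) (on i onE)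
        ; edges-meet-at-ends = λ i j i≢j p onI onJ →
            let v , endI , endJ , eq = meet-common (kind i) (kind j) (i≢j ∘ distinct i j) (on i onI) (on j onJ)
                v<M = end< i endI
                v̂ = Fin.fromℕ< v<M
                v̂≡ = Fin.toℕ-fromℕ< v<M
            in v̂ , incident i v̂ (subst (λ v → EndOf v (List.lookup es i)) (sym v̂≡) endI) ,
               incident j v̂ (subst (λ v → EndOf v (List.lookup es j)) (sym v̂≡) endJ) ,
               trans (cong (grid ∘ loc) v̂≡) (sym eq)
        }

  -- Programs fit the layout and yield no parallel edges

  mark : ℕ → (ℕ → Bool) → ℕ → Bool
  mark v low z with z ≟ v
  ... | yes _ = true
  ... | no  _ = low z

  mark-hit : ∀ v low → mark v low v ≡ true
  mark-hit v low with v ≟ v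
  ... | yes _ = refl
  ... | no ¬e = ⊥-elim (¬e refl)

  mark-miss : ∀ v {z} low → z ≢ v → mark v low z ≡ low z
  mark-miss v {z} low z≢v with z ≟ v
  ... | yes e = ⊥-elim (z≢v e)
  ... | no _  = refl

  -- Picks out the interior vertices of pendant paths. It is read off the whole program in advance
  -- because the layout fixes all heights before any edge is examined.
  lowers : ℕ → List Op → ℕ → Bool
  lowers k []           = λ _ → false
  lowers k (new ∷ p)    = lowers (suc k) p
  lowers k (step ∷ p)   = lowers (suc k) p
  lowers k (spokeA ∷ p) = lowers k p
  lowers k (spokeB ∷ p) = lowers k p
  lowers k (pend₂ ∷ p)  = mark k (lowers (suc k) p)
  lowers k (pend₃ ∷ p)  = mark k (mark (suc k) (lowers (suc (suc k)) p))

  lowers-old : ∀ k p {z} → z < k → lowers k p z ≡ false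
  lowers-old k []           z<k = refl
  lowers-old k (new ∷ p)    z<k = lowers-old (suc k) p (ℕ.m<n⇒m<1+n z<k)
  lowers-old k (step ∷ p)   z<k = lowers-old (suc k) p (ℕ.m<n⇒m<1+n z<k)
  lowers-old k (spokeA ∷ p) z<k = lowers-old k p z<k
  lowers-old k (spokeB ∷ p) z<k = lowers-old k p z<k
  lowers-old k (pend₂ ∷ p)  z<k = trans (mark-miss k (lowers (suc k) p) (ℕ.<⇒≢ z<k)) (lowers-old (suc k) p (ℕ.m<n⇒m<1+n z<k))
  lowers-old k (pend₃ ∷ p)  z<k = trans (mark-miss k (mark (suc k) (lowers (suc (suc k)) p)) (ℕ.<⇒≢ z<k))
    (trans (mark-miss (suc k) (lowers (suc (suc k)) p) (ℕ.<⇒≢ (ℕ.m<n⇒m<1+n z<k))) (lowers-old (suc (suc k)) p (ℕ.m<n⇒m<1+n (ℕ.m<n⇒m<1+n z<k))))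

  module _ (H : ℕ) (lower : ℕ → Bool) where
    open Layout H lower

    -- The vertices strictly between c and k are interior vertices of the pendant paths hung at c.
    -- They are all lower, which gives the gap condition required of the next chain edge or pendant
    -- edge.
    record Front (c k : ℕ) (p : List Op) : Set where
      field
        2≤c     : 2 ≤ c
        c<k     : c < k
        size≤M  : size k p ≤ M
        upper-c : lower c ≡ false
        behind  : ∀ {z} → c < z → z < k → lower z ≡ true
        ahead   : ∀ {z} → k ≤ z → lower z ≡ lowers k p z

      between : ∀ {u} → lower u ≡ false → u ≤ c ⊎ k ≤ u
      between {u} up with ℕ.≤-<-connex u c | ℕ.≤-<-connex k u
      ... | inj₁ u≤c | _        = inj₁ u≤c
      ... | inj₂ _   | inj₁ k≤u = inj₂ k≤u
      ... | inj₂ c<u | inj₂ u<k with () ← trans (sym up) (behind c<u u<k)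

      vertex-c : Vertex c
      vertex-c = vtx 2≤c (ℕ.<-≤-trans c<k (ℕ.≤-trans (size-≥ k p) size≤M))

      2≤k : 2 ≤ k
      2≤k = ℕ.≤-trans 2≤c (ℕ.<⇒≤ c<k)

    edges-kind : ∀ c k p → Front c k p → All Kind (edges c k p)
    edges-kind c k []        F = []
    edges-kind c k (new ∷ p) F = edges-kind k (suc k) p record
      { 2≤c = 2≤k ; c<k = ℕ.n<1+n k ; size≤M = size≤M
      ; upper-c = trans (ahead ℕ.≤-refl) (lowers-old (suc k) p (ℕ.n<1+n k))
      ; behind = λ k<z z<1+k → ⊥-elim (ℕ.<-irrefl refl (ℕ.<-≤-trans k<z (ℕ.≤-pred z<1+k)))
      ; ahead = ahead ∘ ℕ.<⇒≤ }
      where open Front F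
    edges-kind c k (step ∷ p) F =
      chain vertex-c (vtx 2≤k (ℕ.<-≤-trans (size-≥ (suc k) p) size≤M)) c<k upper-c upper-k between ∷
      edges-kind k (suc k) p record
      { 2≤c = 2≤k ; c<k = ℕ.n<1+n k ; size≤M = size≤M
      ; upper-c = upper-k
      ; behind = λ k<z z<1+k → ⊥-elim (ℕ.<-irrefl refl (ℕ.<-≤-trans k<z (ℕ.≤-pred z<1+k)))
      ; ahead = ahead ∘ ℕ.<⇒≤ }
      where
      open Front F
      upper-k = trans (ahead ℕ.≤-refl) (lowers-old (suc k) p (ℕ.n<1+n k))
    edges-kind c k (spokeA ∷ p) F = hubA vertex-c upper-c ∷ edges-kind c k p record
      { 2≤c = 2≤c ; c<k = c<k ; size≤M = size≤M ; upper-c = upper-c ; behind = behind ; ahead = ahead }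
      where open Front F
    edges-kind c k (spokeB ∷ p) F = hubB vertex-c ∷ edges-kind c k p record
      { 2≤c = 2≤c ; c<k = c<k ; size≤M = size≤M ; upper-c = upper-c ; behind = behind ; ahead = ahead }
      where open Front F
    edges-kind c k (pend₂ ∷ p) F =
      hang vertex-c vertex-k c<k upper-c lower-k between′ ∷ hubB vertex-k ∷ edges-kind c (suc k) p record
      { 2≤c = 2≤c ; c<k = ℕ.m<n⇒m<1+n c<k ; size≤M = size≤M ; upper-c = upper-c
      ; behind = λ c<z z<1+k → [ behind c<z , (λ { refl → lower-k }) ]′ (ℕ.m<1+n⇒m<n∨m≡n z<1+k)
      ; ahead = λ k<z → trans (ahead (ℕ.<⇒≤ k<z)) (mark-miss k (lowers (suc k) p) (ℕ.<⇒≢ k<z ∘ sym)) }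
      where
      open Front F
      vertex-k : Vertex k
      vertex-k = vtx 2≤k (ℕ.<-≤-trans (size-≥ (suc k) p) size≤M)
      lower-k = trans (ahead ℕ.≤-refl) (mark-hit k (lowers (suc k) p))
      between′ : ∀ {u} → lower u ≡ false → u ≤ c ⊎ k < u
      between′ up with between up
      ... | inj₁ u≤c = inj₁ u≤c
      ... | inj₂ k≤u = inj₂ (ℕ.≤∧≢⇒< k≤u λ { refl → case (trans (sym up) lower-k) })
        where
        case : ¬ (false ≡ true)
        case ()
    edges-kind c k (pend₃ ∷ p) F =
      hang vertex-c vertex-k c<k upper-c lower-k between′ ∷ along vertex-k vertex-sk lower-k lower-sk ∷ hubB vertex-sk ∷
      edges-kind c (suc (suc k)) p record
      { 2≤c = 2≤c ; c<k = ℕ.m<n⇒m<1+n (ℕ.m<n⇒m<1+n c<k) ; size≤M = size≤M ; upper-c = upper-c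
      ; behind = λ c<z z<2+k → [ (λ z<1+k → [ behind c<z , (λ { refl → lower-k }) ]′ (ℕ.m<1+n⇒m<n∨m≡n z<1+k)) , (λ { refl → lower-sk }) ]′ (ℕ.m<1+n⇒m<n∨m≡n z<2+k)
      ; ahead = λ sk<z → trans (ahead (ℕ.<⇒≤ (ℕ.<⇒≤ sk<z))) (trans (mark-miss k (mark (suc k) rest) (ℕ.<⇒≢ (ℕ.<⇒≤ sk<z) ∘ sym)) (mark-miss (suc k) rest (ℕ.<⇒≢ sk<z ∘ sym))) }
      where
      open Front F
      rest = lowers (suc (suc k)) p
      sk<M : suc k < M
      sk<M = ℕ.<-≤-trans (size-≥ (suc (suc k)) p) size≤M
      vertex-k : Vertex k
      vertex-k = vtx 2≤k (ℕ.<-trans (ℕ.n<1+n k) sk<M)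
      vertex-sk : Vertex (suc k)
      vertex-sk = vtx (ℕ.m≤n⇒m≤1+n 2≤k) sk<M
      lower-k = trans (ahead ℕ.≤-refl) (mark-hit k (mark (suc k) rest))
      lower-sk = trans (ahead (ℕ.n≤1+n k)) (trans (mark-miss k (mark (suc k) rest) ℕ.1+n≢n) (mark-hit (suc k) rest))
      between′ : ∀ {u} → lower u ≡ false → u ≤ c ⊎ k < u
      between′ up with between up
      ... | inj₁ u≤c = inj₁ u≤c
      ... | inj₂ k≤u = inj₂ (ℕ.≤∧≢⇒< k≤u λ { refl → case (trans (sym up) lower-k) })
        where
        case : ¬ (false ≡ true)
        case ()

  -- The flags record whether the current vertex is already joined to A, respectively to B.
  data Simple : Bool → Bool → List Op → Set where
    []     : ∀ {a b} → Simple a b []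
    new    : ∀ {a b p} → Simple false false p → Simple a b (new ∷ p)
    step   : ∀ {a b p} → Simple false false p → Simple a b (step ∷ p)
    spokeA : ∀ {b p} → Simple true b p → Simple false b (spokeA ∷ p)
    spokeB : ∀ {a p} → Simple a true p → Simple a false (spokeB ∷ p)
    pend₂  : ∀ {a b p} → Simple a b p → Simple a b (pend₂ ∷ p)
    pend₃  : ∀ {a b p} → Simple a b p → Simple a b (pend₃ ∷ p)

  -- Formulated with an arbitrary continuation and arbitrary flags on both sides, so that it
  -- composes: p may start at a vertex already joined to both hubs and may stop at such a vertex.
  Safe : List Op → Set
  Safe p = ∀ {a b q} → (∀ {a b} → Simple a b q) → Simple a b (p ++ q)

  safe-++ : ∀ {p q} → Safe p → Safe q → Safe (p ++ q)
  safe-++ {p} {q} sp sq {q = r} sr = subst (Simple _ _) (sym (++-assoc p q r)) (sp (sq sr))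

  safe⇒simple : ∀ {p a b} → Safe p → Simple a b p
  safe⇒simple {p} sp = subst (Simple _ _) (++-identityʳ p) (sp [])

  Later : ℕ → ℕ → Bool → Bool → Edge → Set
  Later c k a b e = k ≤ proj₂ e ⊎ (e ≡ (0 , c) × a ≡ false) ⊎ (e ≡ (1 , c) × b ≡ false)

  later-new : ∀ {c k k′ a b a′ b′ e} → k ≤ k′ → Later k′ (suc k′) a b e → Later c k a′ b′ e
  later-new le (inj₁ k<)                = inj₁ (ℕ.≤-trans le (ℕ.<⇒≤ k<))
  later-new le (inj₂ (inj₁ (refl , _))) = inj₁ le
  later-new le (inj₂ (inj₂ (refl , _))) = inj₁ le

  later-≤ : ∀ {c k k′ a b e} → k ≤ k′ → Later c k′ a b e → Later c k a b e
  later-≤ le (inj₁ k′≤) = inj₁ (ℕ.≤-trans le k′≤)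
  later-≤ le (inj₂ q)   = inj₂ q

  edges-later : ∀ {c k a b p} → Simple a b p → All (Later c k a b) (edges c k p)
  edges-later []         = []
  edges-later (new s)    = All.map (later-new ℕ.≤-refl) (edges-later s)
  edges-later (step s)   = inj₁ ℕ.≤-refl ∷ All.map (later-new ℕ.≤-refl) (edges-later s)
  edges-later (spokeA s) = inj₂ (inj₁ (refl , refl)) ∷
    All.map (λ { (inj₁ le) → inj₁ le ; (inj₂ (inj₁ (eq , ()))) ; (inj₂ (inj₂ q)) → inj₂ (inj₂ q) }) (edges-later s)
  edges-later (spokeB s) = inj₂ (inj₂ (refl , refl)) ∷
    All.map (λ { (inj₁ le) → inj₁ le ; (inj₂ (inj₁ q)) → inj₂ (inj₁ q) ; (inj₂ (inj₂ (eq , ()))) }) (edges-later s)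
  edges-later {k = k} (pend₂ s) = inj₁ ℕ.≤-refl ∷ inj₁ ℕ.≤-refl ∷ All.map (later-≤ (ℕ.n≤1+n k)) (edges-later s)
  edges-later {k = k} (pend₃ s) = inj₁ ℕ.≤-refl ∷ inj₁ (ℕ.n≤1+n k) ∷ inj₁ (ℕ.n≤1+n k) ∷
    All.map (later-≤ (ℕ.m≤n⇒m≤1+n (ℕ.n≤1+n k))) (edges-later s)

  later-≢ : ∀ {c k′ j a b u} → j < k′ → j ≢ c → ∀ {e} → Later c k′ a b e → (u , j) ≢ e
  later-≢ j<k′ j≢c (inj₁ k′≤)               refl = ℕ.<-irrefl refl (ℕ.<-≤-trans j<k′ k′≤)
  later-≢ j<k′ j≢c (inj₂ (inj₁ (refl , _))) refl = j≢c refl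
  later-≢ j<k′ j≢c (inj₂ (inj₂ (refl , _))) refl = j≢c refl

  edges-unique : ∀ {c k a b p} → 2 ≤ c → c < k → Simple a b p → Unique (edges c k p)
  edges-unique 2≤c c<k [] = []
  edges-unique {k = k} 2≤c c<k (new s) = edges-unique (ℕ.≤-trans 2≤c (ℕ.<⇒≤ c<k)) (ℕ.n<1+n k) s
  edges-unique {c} {k} 2≤c c<k (step s) = All.map differs (edges-later s) ∷ edges-unique (ℕ.≤-trans 2≤c (ℕ.<⇒≤ c<k)) (ℕ.n<1+n k) s
    where
    differs : ∀ {e} → Later k (suc k) false false e → (c , k) ≢ e
    differs (inj₁ k<k)                refl = ℕ.<-irrefl refl k<k
    differs (inj₂ (inj₁ (refl , _))) refl = ℕ.n≮0 2≤c
    differs (inj₂ (inj₂ (refl , _))) refl = ℕ.<-irrefl refl 2≤c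
  edges-unique {c} {k} 2≤c c<k (spokeA s) = All.map differs (edges-later s) ∷ edges-unique 2≤c c<k s
    where
    differs : ∀ {b e} → Later c k true b e → (0 , c) ≢ e
    differs (inj₁ k≤c) refl = ℕ.<-irrefl refl (ℕ.<-≤-trans c<k k≤c)
    differs (inj₂ (inj₁ (_ , ())))
    differs (inj₂ (inj₂ (refl , _))) ()
  edges-unique {c} {k} 2≤c c<k (spokeB s) = All.map differs (edges-later s) ∷ edges-unique 2≤c c<k s
    where
    differs : ∀ {a e} → Later c k a true e → (1 , c) ≢ e
    differs (inj₁ k≤c) refl = ℕ.<-irrefl refl (ℕ.<-≤-trans c<k k≤c)
    differs (inj₂ (inj₁ (refl , _))) ()
    differs (inj₂ (inj₂ (_ , ())))
  edges-unique {c} {k} 2≤c c<k (pend₂ s) =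
    ((λ { refl → ℕ.<-irrefl refl 2≤c }) ∷ All.map (later-≢ (ℕ.n<1+n k) k≢c) (edges-later s)) ∷
    All.map (later-≢ (ℕ.n<1+n k) k≢c) (edges-later s) ∷
    edges-unique 2≤c (ℕ.m<n⇒m<1+n c<k) s
    where
    k≢c : k ≢ c
    k≢c = ℕ.<⇒≢ c<k ∘ sym
  edges-unique {c} {k} 2≤c c<k (pend₃ s) =
    ((λ { eq → ℕ.1+n≢n (sym (cong proj₂ eq)) }) ∷ (λ { eq → ℕ.1+n≢n (sym (cong proj₂ eq)) }) ∷
      All.map (later-≢ (ℕ.m<n⇒m<1+n (ℕ.n<1+n k)) (ℕ.<⇒≢ c<k ∘ sym)) (edges-later s)) ∷
    ((λ eq → ℕ.<⇒≢ (ℕ.<-trans 2≤c c<k) (sym (cong proj₁ eq))) ∷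
      All.map (later-≢ (ℕ.n<1+n (suc k)) (ℕ.<⇒≢ c<sk ∘ sym)) (edges-later s)) ∷
    All.map (later-≢ (ℕ.n<1+n (suc k)) (ℕ.<⇒≢ c<sk ∘ sym)) (edges-later s) ∷
    edges-unique 2≤c (ℕ.m<n⇒m<1+n c<sk) s
    where
    c<sk : c < suc k
    c<sk = ℕ.m<n⇒m<1+n c<k

  lookup-injective : ∀ {es : List Edge} → Unique es → ∀ i j → List.lookup es i ≡ List.lookup es j → i ≡ j
  lookup-injective (_ ∷ _)  Fin.zero    Fin.zero    eq = refl
  lookup-injective (h ∷ _)  Fin.zero    (Fin.suc j) eq = ⊥-elim (All.lookup h (∈-lookup j) eq)
  lookup-injective (h ∷ _)  (Fin.suc i) Fin.zero    eq = ⊥-elim (All.lookup h (∈-lookup i) (sym eq))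
  lookup-injective (_ ∷ us) (Fin.suc i) (Fin.suc j) eq = cong Fin.suc (lookup-injective us i j eq)

open Drawings

-- Linear algebra of words, digits and blocks

module Gadgets where

  open import Data.Integer as ℤ using (ℤ; +_; 0ℤ; 1ℤ; -1ℤ; _+_; _*_; _-_; -_)
  import Data.Integer.Properties as ℤ
  open import Data.Integer.Tactic.RingSolver using (solve-∀)
  open import Data.Nat.ListAction using (sum)

  open State

  ·-distrib-⊕ : ∀ k s s′ → k · (s ⊕ s′) ≡ k · s ⊕ k · s′
  ·-distrib-⊕ k s s′ = cong₅ (ℤ.*-distribˡ-+ k (x s) (x s′)) (ℤ.*-distribˡ-+ k (y s) (y s′)) (ℤ.*-distribˡ-+ k (r s) (r s′))
    (ℤ.*-distribˡ-+ k (w s) (w s′)) (ℤ.*-distribˡ-+ k (t s) (t s′))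

  renew-· : ∀ k s → renew (k · s) ≡ k · renew s
  renew-· k s = cong₅ refl (sym (ℤ.*-zeroʳ k)) (sym (ℤ.*-zeroʳ k)) refl (sym (ℤ.*-zeroʳ k))

  joinA-· : ∀ k s → joinA (k · s) ≡ k · joinA s
  joinA-· k s = cong₅ (sym (ℤ.*-zeroʳ k)) refl refl refl (eq k (y s) (w s) (r s))
    where
    eq : ∀ k y w r → k * y + k * w - + 2 * (k * r) ≡ k * (y + w - + 2 * r)
    eq = solve-∀

  joinB-· : ∀ k s → joinB (k · s) ≡ k · joinB s
  joinB-· k s = cong₅ (sym (ℤ.*-zeroʳ k)) refl (sym (ℤ.*-zeroʳ k)) (sym (ℤ.*-zeroʳ k)) refl

  act-· : ∀ o k s → act o (k · s) ≡ k · act o s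
  act-· new    k s = renew-· k s
  act-· step   k s = trans (cong (_⊕ k · s) (renew-· k s)) (sym (·-distrib-⊕ k (renew s) s))
  act-· spokeA k s = trans (cong (k · s ⊕_) (joinA-· k s)) (sym (·-distrib-⊕ k s (joinA s)))
  act-· spokeB k s = trans (cong (k · s ⊕_) (joinB-· k s)) (sym (·-distrib-⊕ k s (joinB s)))
  act-· pend₂  k s = trans (cong (k · s ⊕_) (act-·-B k s)) (sym (·-distrib-⊕ k s (s ⊕ joinB s)))
    where
    act-·-B : ∀ k s → k · s ⊕ joinB (k · s) ≡ k · (s ⊕ joinB s)
    act-·-B k s = trans (cong (k · s ⊕_) (joinB-· k s)) (sym (·-distrib-⊕ k s (joinB s)))
  act-· pend₃  k s = trans (cong (λ u → k · s ⊕ (k · s ⊕ (k · s ⊕ u))) (joinB-· k s))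
    (trans (cong (λ u → k · s ⊕ (k · s ⊕ u)) (sym (·-distrib-⊕ k s (joinB s))))
      (trans (cong (k · s ⊕_) (sym (·-distrib-⊕ k s (s ⊕ joinB s)))) (sym (·-distrib-⊕ k s (s ⊕ (s ⊕ joinB s))))))

  run-· : ∀ p k s → run p (k · s) ≡ k · run p s
  run-· []      k s = refl
  run-· (o ∷ p) k s = trans (cong (run p) (act-· o k s)) (run-· p k (act o s))

  unitX unitY unitR unitW unitT : State
  unitX = ⟨ 1ℤ , 0ℤ , 0ℤ , 0ℤ , 0ℤ ⟩
  unitY = ⟨ 0ℤ , 1ℤ , 0ℤ , 0ℤ , 0ℤ ⟩
  unitR = ⟨ 0ℤ , 0ℤ , 1ℤ , 0ℤ , 0ℤ ⟩
  unitW = ⟨ 0ℤ , 0ℤ , 0ℤ , 1ℤ , 0ℤ ⟩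
  unitT = ⟨ 0ℤ , 0ℤ , 0ℤ , 0ℤ , 1ℤ ⟩

  -- For a concrete program p the right-hand side evaluates to a combination with numerical coefficients.
  expand : ∀ p s → run p s ≡
    x s · run p unitX ⊕ (y s · run p unitY ⊕ (r s · run p unitR ⊕ (w s · run p unitW ⊕ t s · run p unitT)))
  expand p s@(⟨ x , y , r , w , t ⟩) = trans (cong (run p) split)
    (trans (scaled p x unitX _) (cong (x · run p unitX ⊕_) (trans (scaled p y unitY _) (cong (y · run p unitY ⊕_)
      (trans (scaled p r unitR _) (cong (r · run p unitR ⊕_) (trans (scaled p w unitW _) (cong (w · run p unitW ⊕_) (run-· p t unitT)))))))))
    where
    scaled : ∀ p k s s′ → run p (k · s ⊕ s′) ≡ k · run p s ⊕ run p s′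
    scaled p k s s′ = trans (run-⊕ p (k · s) s′) (cong (_⊕ run p s′) (run-· p k s))
    c₁ : ∀ x y r w t → x ≡ x * 1ℤ + (y * 0ℤ + (r * 0ℤ + (w * 0ℤ + t * 0ℤ)))
    c₁ = solve-∀
    c₂ : ∀ x y r w t → y ≡ x * 0ℤ + (y * 1ℤ + (r * 0ℤ + (w * 0ℤ + t * 0ℤ)))
    c₂ = solve-∀
    c₃ : ∀ x y r w t → r ≡ x * 0ℤ + (y * 0ℤ + (r * 1ℤ + (w * 0ℤ + t * 0ℤ)))
    c₃ = solve-∀
    c₄ : ∀ x y r w t → w ≡ x * 0ℤ + (y * 0ℤ + (r * 0ℤ + (w * 1ℤ + t * 0ℤ)))
    c₄ = solve-∀
    c₅ : ∀ x y r w t → t ≡ x * 0ℤ + (y * 0ℤ + (r * 0ℤ + (w * 0ℤ + t * 1ℤ)))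
    c₅ = solve-∀
    split : s ≡ x · unitX ⊕ (y · unitY ⊕ (r · unitR ⊕ (w · unitW ⊕ t · unitT)))
    split = cong₅ (c₁ x y r w t) (c₂ x y r w t) (c₃ x y r w t) (c₄ x y r w t) (c₅ x y r w t)

  letter : Bool → List Op
  letter false = step ∷ spokeB ∷ []
  letter true  = step ∷ step ∷ spokeB ∷ spokeA ∷ []

  forward backward : List Bool → List Op
  forward []        = []
  forward (c ∷ cs)  = forward cs ++ letter c
  backward []       = []
  backward (c ∷ cs) = letter c ++ backward cs

  turn : List Bool → List Bool → List Op
  turn X Y = forward Y ++ (step ∷ step ∷ step ∷ []) ++ backward X

  record Matrix : Set where
    constructor mat
    field a b c d : ℤ

  infixr 7 _⊗_ _⊙_

  _⊗_ : Matrix → Matrix → Matrix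
  mat a b c d ⊗ mat a′ b′ c′ d′ = mat (a * a′ + b * c′) (a * b′ + b * d′) (c * a′ + d * c′) (c * b′ + d * d′)

  _⊙_ : Matrix → ℤ × ℤ → ℤ × ℤ
  mat a b c d ⊙ (u , v) = a * u + b * v , c * u + d * v

  transpose : Matrix → Matrix
  transpose (mat a b c d) = mat a c b d

  det : Matrix → ℤ
  det (mat a b c d) = a * d - b * c

  -- Both matrices, written in the order (y, x), are symmetric, so running a word in the opposite
  -- order transposes its product.
  letterMatrix : Bool → Matrix
  letterMatrix false = mat (+ 2) (+ 1) (+ 1) (+ 1)
  letterMatrix true  = mat (+ 5) (+ 2) (+ 2) (+ 1)

  product : List Bool → Matrix
  product []       = mat 1ℤ 0ℤ 0ℤ 1ℤ
  product (c ∷ cs) = letterMatrix c ⊗ product cs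

  yx : State → ℤ × ℤ
  yx s = y s , x s

  letter-yx : ∀ c s → yx (run (letter c) s) ≡ letterMatrix c ⊙ yx s
  letter-yx false s@(⟨ x , y , r , w , t ⟩) = trans (cong yx (expand (letter false) s)) (cong₂ _,_ (e₁ x y r w t) (e₂ x y r w t))
    where
    e₁ : ∀ x y r w t → x * 1ℤ + (y * + 2 + (r * 0ℤ + (w * 0ℤ + t * 0ℤ))) ≡ + 2 * y + + 1 * x
    e₁ = solve-∀
    e₂ : ∀ x y r w t → x * 1ℤ + (y * + 1 + (r * 0ℤ + (w * 0ℤ + t * 0ℤ))) ≡ + 1 * y + + 1 * x
    e₂ = solve-∀
  letter-yx true s@(⟨ x , y , r , w , t ⟩) = trans (cong yx (expand (letter true) s)) (cong₂ _,_ (e₁ x y r w t) (e₂ x y r w t))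
    where
    e₁ : ∀ x y r w t → x * + 2 + (y * + 5 + (r * 0ℤ + (w * 0ℤ + t * 0ℤ))) ≡ + 5 * y + + 2 * x
    e₁ = solve-∀
    e₂ : ∀ x y r w t → x * 1ℤ + (y * + 2 + (r * 0ℤ + (w * 0ℤ + t * 0ℤ))) ≡ + 2 * y + + 1 * x
    e₂ = solve-∀

  ⊗-⊙ : ∀ M M′ v → (M ⊗ M′) ⊙ v ≡ M ⊙ (M′ ⊙ v)
  ⊗-⊙ (mat a b c d) (mat a′ b′ c′ d′) (u , v) = cong₂ _,_ (eq a b a′ b′ c′ d′ u v) (eq c d a′ b′ c′ d′ u v)
    where
    eq : ∀ a b a′ b′ c′ d′ u v → (a * a′ + b * c′) * u + (a * b′ + b * d′) * v ≡ a * (a′ * u + b′ * v) + b * (c′ * u + d′ * v)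
    eq = solve-∀

  transpose-⊗-letter : ∀ c M v → transpose (letterMatrix c ⊗ M) ⊙ v ≡ transpose M ⊙ (letterMatrix c ⊙ v)
  transpose-⊗-letter false (mat a b c d) (u , v) = cong₂ _,_ (eq a c u v) (eq b d u v)
    where
    eq : ∀ a c u v → (+ 2 * a + + 1 * c) * u + (+ 1 * a + + 1 * c) * v ≡ a * (+ 2 * u + + 1 * v) + c * (+ 1 * u + + 1 * v)
    eq = solve-∀
  transpose-⊗-letter true (mat a b c d) (u , v) = cong₂ _,_ (eq a c u v) (eq b d u v)
    where
    eq : ∀ a c u v → (+ 5 * a + + 2 * c) * u + (+ 2 * a + + 1 * c) * v ≡ a * (+ 5 * u + + 2 * v) + c * (+ 2 * u + + 1 * v)
    eq = solve-∀

  identity-⊙ : ∀ v → mat 1ℤ 0ℤ 0ℤ 1ℤ ⊙ v ≡ v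
  identity-⊙ (u , v) = cong₂ _,_ (e₁ u v) (e₂ u v)
    where
    e₁ : ∀ u v → 1ℤ * u + 0ℤ * v ≡ u
    e₁ = solve-∀
    e₂ : ∀ u v → 0ℤ * u + 1ℤ * v ≡ v
    e₂ = solve-∀

  forward-yx : ∀ cs s → yx (run (forward cs) s) ≡ product cs ⊙ yx s
  forward-yx []       s = sym (identity-⊙ (yx s))
  forward-yx (c ∷ cs) s = begin
    yx (run (forward cs ++ letter c) s)        ≡⟨ cong yx (run-++ (forward cs) (letter c) s) ⟩
    yx (run (letter c) (run (forward cs) s))   ≡⟨ letter-yx c (run (forward cs) s) ⟩
    letterMatrix c ⊙ yx (run (forward cs) s)   ≡⟨ cong (letterMatrix c ⊙_) (forward-yx cs s) ⟩
    letterMatrix c ⊙ (product cs ⊙ yx s)       ≡⟨ ⊗-⊙ (letterMatrix c) (product cs) (yx s) ⟨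
    product (c ∷ cs) ⊙ yx s                    ∎
    where open ≡-Reasoning

  backward-yx : ∀ cs s → yx (run (backward cs) s) ≡ transpose (product cs) ⊙ yx s
  backward-yx []       s = sym (identity-⊙ (yx s))
  backward-yx (c ∷ cs) s = begin
    yx (run (letter c ++ backward cs) s)                  ≡⟨ cong yx (run-++ (letter c) (backward cs) s) ⟩
    yx (run (backward cs) (run (letter c) s))             ≡⟨ backward-yx cs (run (letter c) s) ⟩
    transpose (product cs) ⊙ yx (run (letter c) s)        ≡⟨ cong (transpose (product cs) ⊙_) (letter-yx c s) ⟩
    transpose (product cs) ⊙ (letterMatrix c ⊙ yx s)      ≡⟨ transpose-⊗-letter c (product cs) (yx s) ⟨
    transpose (product (c ∷ cs)) ⊙ yx s                   ∎
    where open ≡-Reasoning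

  det-letter : ∀ c M → det (letterMatrix c ⊗ M) ≡ det M
  det-letter false (mat a b c d) = eq a b c d
    where
    eq : ∀ a b c d → (+ 2 * a + + 1 * c) * (+ 1 * b + + 1 * d) - (+ 2 * b + + 1 * d) * (+ 1 * a + + 1 * c) ≡ a * d - b * c
    eq = solve-∀
  det-letter true (mat a b c d) = eq a b c d
    where
    eq : ∀ a b c d → (+ 5 * a + + 2 * c) * (+ 2 * b + + 1 * d) - (+ 5 * b + + 2 * d) * (+ 2 * a + + 1 * c) ≡ a * d - b * c
    eq = solve-∀

  det-product : ∀ cs → det (product cs) ≡ 1ℤ
  det-product []       = refl
  det-product (c ∷ cs) = trans (det-letter c (product cs)) (det-product cs)

  steps³-yx : ∀ s → yx (run (step ∷ step ∷ step ∷ []) s) ≡ (y s , + 3 * y s + x s)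
  steps³-yx s@(⟨ x , y , r , w , t ⟩) = trans (cong yx (expand (step ∷ step ∷ step ∷ []) s)) (cong₂ _,_ (e₁ x y r w t) (e₂ x y r w t))
    where
    e₁ : ∀ x y r w t → x * 0ℤ + (y * 1ℤ + (r * 0ℤ + (w * 0ℤ + t * 0ℤ))) ≡ y
    e₁ = solve-∀
    e₂ : ∀ x y r w t → x * 1ℤ + (y * + 3 + (r * 0ℤ + (w * 0ℤ + t * 0ℤ))) ≡ + 3 * y + x
    e₂ = solve-∀

  turn-yx : ∀ X Y s → let (u , v) = product Y ⊙ yx s in
    yx (run (turn X Y) s) ≡ transpose (product X) ⊙ (u , + 3 * u + v)
  turn-yx X Y s = begin
    yx (run (turn X Y) s)
      ≡⟨ cong yx (trans (run-++ (forward Y) _ s) (run-++ (step ∷ step ∷ step ∷ []) (backward X) s₁)) ⟩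
    yx (run (backward X) s₂)                         ≡⟨ backward-yx X s₂ ⟩
    transpose (product X) ⊙ yx s₂                    ≡⟨ cong (transpose (product X) ⊙_) (steps³-yx s₁) ⟩
    transpose (product X) ⊙ (y s₁ , + 3 * y s₁ + x s₁)
      ≡⟨ cong (λ (u , v) → transpose (product X) ⊙ (u , + 3 * u + v)) (forward-yx Y s) ⟩
    _ ∎
    where
    open ≡-Reasoning
    s₁ = run (forward Y) s
    s₂ = run (step ∷ step ∷ step ∷ []) s₁

  data Unimodular : Op → Set where
    step   : Unimodular step
    spokeA : Unimodular spokeA
    spokeB : Unimodular spokeB

  letter-unimodular : ∀ c → All Unimodular (letter c)
  letter-unimodular false = step ∷ spokeB ∷ []
  letter-unimodular true  = step ∷ step ∷ spokeB ∷ spokeA ∷ []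

  forward-unimodular : ∀ cs → All Unimodular (forward cs)
  forward-unimodular []       = []
  forward-unimodular (c ∷ cs) = All.++⁺ (forward-unimodular cs) (letter-unimodular c)

  backward-unimodular : ∀ cs → All Unimodular (backward cs)
  backward-unimodular []       = []
  backward-unimodular (c ∷ cs) = All.++⁺ (letter-unimodular c) (backward-unimodular cs)

  turn-unimodular : ∀ X Y → All Unimodular (turn X Y)
  turn-unimodular X Y = All.++⁺ (forward-unimodular Y) (step ∷ step ∷ step ∷ backward-unimodular X)

  -- If p, q, s count the forests of types Ac|B, A|Bc and AB|c, this is x t - (p q + q s + s p),
  -- which vanishes on the forest counts of every graph with three terminals: a Dodgson-type
  -- identity among minors of the Laplacian.
  form : State → ℤ
  form s = x s * t s - y s * w s + r s * r s

  form-invariant : ∀ {p} → All Unimodular p → ∀ s → form (run p s) ≡ form s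
  form-invariant []       s = refl
  form-invariant {o ∷ p} (u ∷ us) s = trans (form-invariant us (act o s)) (one u s)
    where
    e₁ : ∀ x y r w t → (y + x) * (0ℤ + t) - (0ℤ + y) * (t + w) + (0ℤ + r) * (0ℤ + r) ≡ x * t - y * w + r * r
    e₁ = solve-∀
    e₂ : ∀ x y r w t → (x + 0ℤ) * (t + (y + w - + 2 * r)) - (y + x) * (w + x) + (r + x) * (r + x) ≡ x * t - y * w + r * r
    e₂ = solve-∀
    e₃ : ∀ x y r w t → (x + 0ℤ) * (t + w) - (y + x) * (w + 0ℤ) + (r + 0ℤ) * (r + 0ℤ) ≡ x * t - y * w + r * r
    e₃ = solve-∀
    one : ∀ {o} → Unimodular o → ∀ s → form (act o s) ≡ form s
    one step   ⟨ x , y , r , w , t ⟩ = e₁ x y r w t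
    one spokeA ⟨ x , y , r , w , t ⟩ = e₂ x y r w t
    one spokeB ⟨ x , y , r , w , t ⟩ = e₃ x y r w t

  -- States with x = y = r = 0 evolve in (w, t) as other states do in (x, y).
  record Shifted (s s′ : State) : Set where
    field
      x≡0 : x s ≡ 0ℤ
      y≡0 : y s ≡ 0ℤ
      r≡0 : r s ≡ 0ℤ
      w≡x : w s ≡ x s′
      t≡y : t s ≡ y s′

  shifted-run : ∀ {p} → All Unimodular p → ∀ {s s′} → Shifted s s′ → Shifted (run p s) (run p s′)
  shifted-run []       σ = σ
  shifted-run (u ∷ us) σ = shifted-run us (one u σ)
    where
    one : ∀ {o} → Unimodular o → ∀ {s s′} → Shifted s s′ → Shifted (act o s) (act o s′)
    one step σ = record { x≡0 = cong₂ _+_ y≡0 x≡0 ; y≡0 = cong (λ z → 0ℤ + z) y≡0 ; r≡0 = cong (λ z → 0ℤ + z) r≡0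
      ; w≡x = cong₂ _+_ t≡y w≡x ; t≡y = cong (λ z → 0ℤ + z) t≡y }
      where open Shifted σ
    one spokeA {s} {s′} σ = record { x≡0 = cong (_+ 0ℤ) x≡0 ; y≡0 = cong₂ _+_ y≡0 x≡0 ; r≡0 = cong₂ _+_ r≡0 x≡0
      ; w≡x = cong₂ _+_ w≡x x≡0
      ; t≡y = cong₂ _+_ t≡y (trans (cong₂ (λ y r → y + w s - + 2 * r) y≡0 r≡0) (trans (eq (w s)) w≡x)) }
      where
      open Shifted σ
      eq : ∀ w → 0ℤ + w - + 2 * 0ℤ ≡ w
      eq = solve-∀
    one spokeB σ = record { x≡0 = cong (_+ 0ℤ) x≡0 ; y≡0 = cong₂ _+_ y≡0 x≡0 ; r≡0 = cong (_+ 0ℤ) r≡0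
      ; w≡x = cong (_+ 0ℤ) w≡x ; t≡y = cong₂ _+_ t≡y w≡x }
      where open Shifted σ

  -- Congruences and the right-angle turn

  module Congruence (n : ℤ) where

    infix 4 _≈_

    record _≈_ (a b : ℤ) : Set where
      constructor _because_
      field
        quotient : ℤ
        equation : a ≡ b + quotient * n

    ≡⇒≈ : ∀ {a b} → a ≡ b → a ≈ b
    ≡⇒≈ {a} refl = 0ℤ because sym (ℤ.+-identityʳ a)

    ≈-refl : ∀ {a} → a ≈ a
    ≈-refl = ≡⇒≈ refl

    ≈-sym : ∀ {a b} → a ≈ b → b ≈ a
    ≈-sym {a} {b} (q because refl) = (- q) because eq b q n
      where
      eq : ∀ b q n → b ≡ b + q * n + - q * n
      eq = solve-∀

    ≈-trans : ∀ {a b c} → a ≈ b → b ≈ c → a ≈ c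
    ≈-trans {c = c} (q because refl) (q′ because refl) = (q + q′) because eq c q q′ n
      where
      eq : ∀ c q q′ n → c + q′ * n + q * n ≡ c + (q + q′) * n
      eq = solve-∀

    +-cong : ∀ {a b c d} → a ≈ b → c ≈ d → a + c ≈ b + d
    +-cong {b = b} {d = d} (q because refl) (q′ because refl) = (q + q′) because eq b d q q′ n
      where
      eq : ∀ b d q q′ n → b + q * n + (d + q′ * n) ≡ b + d + (q + q′) * n
      eq = solve-∀

    *-cong : ∀ {a b c d} → a ≈ b → c ≈ d → a * c ≈ b * d
    *-cong {b = b} {d = d} (q because refl) (q′ because refl) = (b * q′ + q * d + q * q′ * n) because eq b d q q′ n
      where
      eq : ∀ b d q q′ n → (b + q * n) * (d + q′ * n) ≡ b * d + (b * q′ + q * d + q * q′ * n) * n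
      eq = solve-∀

    neg-cong : ∀ {a b} → a ≈ b → - a ≈ - b
    neg-cong {b = b} (q because refl) = (- q) because eq b q n
      where
      eq : ∀ b q n → - (b + q * n) ≡ - b + - q * n
      eq = solve-∀

    k*-cong : ∀ k {a b} → a ≈ b → k * a ≈ k * b
    k*-cong k = *-cong {k} ≈-refl

    infixr 2 _≈⟨_⟩_ _≡⟪_⟫_
    infix  3 _∎′

    _≈⟨_⟩_ : ∀ a {b c} → a ≈ b → b ≈ c → a ≈ c
    a ≈⟨ p ⟩ q = ≈-trans p q

    _≡⟪_⟫_ : ∀ a {b c} → a ≡ b → b ≈ c → a ≈ c
    a ≡⟪ p ⟫ q = ≈-trans (≡⇒≈ p) q

    _∎′ : ∀ a → a ≈ a
    a ∎′ = ≈-refl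

    infix 4 _≈ᴹ_
    record _≈ᴹ_ (M M′ : Matrix) : Set where
      constructor mat≈
      field
        a≈ : Matrix.a M ≈ Matrix.a M′
        b≈ : Matrix.b M ≈ Matrix.b M′
        c≈ : Matrix.c M ≈ Matrix.c M′
        d≈ : Matrix.d M ≈ Matrix.d M′

    -- The letters have determinant 1 over the integers; `e₁` and `e₂` are the rows of the inverse
    -- matrix, so cancellation is valid for every modulus.
    letter-cancel : ∀ c {M M′} → letterMatrix c ⊗ M ≈ᴹ letterMatrix c ⊗ M′ → M ≈ᴹ M′
    letter-cancel false {mat a b c d} {mat a′ b′ c′ d′} (mat≈ a≈ b≈ c≈ d≈) =
      mat≈ (top a c a′ c′ a≈ c≈) (top b d b′ d′ b≈ d≈) (bottom a c a′ c′ a≈ c≈) (bottom b d b′ d′ b≈ d≈)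
      where
      e₁ : ∀ a c → a ≡ (+ 2 * a + + 1 * c) - (+ 1 * a + + 1 * c)
      e₁ = solve-∀
      e₂ : ∀ a c → c ≡ + 2 * (+ 1 * a + + 1 * c) - (+ 2 * a + + 1 * c)
      e₂ = solve-∀
      top : ∀ a c a′ c′ → + 2 * a + + 1 * c ≈ + 2 * a′ + + 1 * c′ → + 1 * a + + 1 * c ≈ + 1 * a′ + + 1 * c′ → a ≈ a′
      top a c a′ c′ p q = a ≡⟪ e₁ a c ⟫ _ ≈⟨ +-cong p (neg-cong q) ⟩ _ ≡⟪ sym (e₁ a′ c′) ⟫ a′ ∎′
      bottom : ∀ a c a′ c′ → + 2 * a + + 1 * c ≈ + 2 * a′ + + 1 * c′ → + 1 * a + + 1 * c ≈ + 1 * a′ + + 1 * c′ → c ≈ c′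
      bottom a c a′ c′ p q = c ≡⟪ e₂ a c ⟫ _ ≈⟨ +-cong (k*-cong (+ 2) q) (neg-cong p) ⟩ _ ≡⟪ sym (e₂ a′ c′) ⟫ c′ ∎′
    letter-cancel true {mat a b c d} {mat a′ b′ c′ d′} (mat≈ a≈ b≈ c≈ d≈) =
      mat≈ (top a c a′ c′ a≈ c≈) (top b d b′ d′ b≈ d≈) (bottom a c a′ c′ a≈ c≈) (bottom b d b′ d′ b≈ d≈)
      where
      e₁ : ∀ a c → a ≡ (+ 5 * a + + 2 * c) - + 2 * (+ 2 * a + + 1 * c)
      e₁ = solve-∀
      e₂ : ∀ a c → c ≡ + 5 * (+ 2 * a + + 1 * c) - + 2 * (+ 5 * a + + 2 * c)
      e₂ = solve-∀
      top : ∀ a c a′ c′ → + 5 * a + + 2 * c ≈ + 5 * a′ + + 2 * c′ → + 2 * a + + 1 * c ≈ + 2 * a′ + + 1 * c′ → a ≈ a′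
      top a c a′ c′ p q = a ≡⟪ e₁ a c ⟫ _ ≈⟨ +-cong p (neg-cong (k*-cong (+ 2) q)) ⟩ _ ≡⟪ sym (e₁ a′ c′) ⟫ a′ ∎′
      bottom : ∀ a c a′ c′ → + 5 * a + + 2 * c ≈ + 5 * a′ + + 2 * c′ → + 2 * a + + 1 * c ≈ + 2 * a′ + + 1 * c′ → c ≈ c′
      bottom a c a′ c′ p q = c ≡⟪ e₂ a c ⟫ _ ≈⟨ +-cong (k*-cong (+ 5) q) (neg-cong (k*-cong (+ 2) p)) ⟩ _ ≡⟪ sym (e₂ a′ c′) ⟫ c′ ∎′

    Branching : List Bool → List Bool → Set
    Branching X Y = letterMatrix false ⊗ product X ≈ᴹ letterMatrix true ⊗ product Y

    -- If words starting with different letters a, b have products  a A ≡ b B (mod n),  then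
    -- Aᵀ S³ B = - Aᵀ (a J b) B ≡ - (a A)ᵀ J (a A) = - J,  where J = [0 1; -1 0] and S = [1 0; 1 1].
    module Turn (X Y : List Bool) (branch : Branching X Y) where
      open _≈ᴹ_ branch
      private
        A B : Matrix
        A = product X
        B = product Y
        open Matrix A using () renaming (a to a; b to b; c to c; d to d)
        open Matrix B using () renaming (a to e; b to f; c to g; d to h)

        -- `first` and `second` give the rows of B ≡ b⁻¹ a A, where a and b now denote the two
        -- letters and b⁻¹ a has rows (0, -1) and (1, 3).
        first : ∀ a c e g → + 2 * a + + 1 * c ≈ + 5 * e + + 2 * g → + 1 * a + + 1 * c ≈ + 2 * e + + 1 * g → e ≈ - c
        first a c e g p q = e ≡⟪ e₁ e g ⟫ _ ≈⟨ +-cong (≈-sym p) (neg-cong (k*-cong (+ 2) (≈-sym q))) ⟩ _ ≡⟪ e₂ a c ⟫ - c ∎′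
          where
          e₁ : ∀ e g → e ≡ (+ 5 * e + + 2 * g) - + 2 * (+ 2 * e + + 1 * g)
          e₁ = solve-∀
          e₂ : ∀ a c → (+ 2 * a + + 1 * c) - + 2 * (+ 1 * a + + 1 * c) ≡ - c
          e₂ = solve-∀

        second : ∀ a c e g → + 2 * a + + 1 * c ≈ + 5 * e + + 2 * g → + 1 * a + + 1 * c ≈ + 2 * e + + 1 * g → g ≈ a + + 3 * c
        second a c e g p q = g ≡⟪ e₁ e g ⟫ _ ≈⟨ +-cong (k*-cong (+ 5) (≈-sym q)) (neg-cong (k*-cong (+ 2) (≈-sym p))) ⟩ _ ≡⟪ e₂ a c ⟫ a + + 3 * c ∎′
          where
          e₁ : ∀ e g → g ≡ + 5 * (+ 2 * e + + 1 * g) - + 2 * (+ 5 * e + + 2 * g)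
          e₁ = solve-∀
          e₂ : ∀ a c → + 5 * (+ 1 * a + + 1 * c) - + 2 * (+ 2 * a + + 1 * c) ≡ a + + 3 * c
          e₂ = solve-∀

        module _ (s : State) where
          u v : ℤ
          u = e * y s + f * x s
          v = g * y s + h * x s
          u≈ : u ≈ - c * y s + - d * x s
          u≈ = +-cong (*-cong (first a c e g a≈ c≈) ≈-refl) (*-cong (first b d f h b≈ d≈) ≈-refl)
          v≈ : + 3 * u + v ≈ + 3 * (- c * y s + - d * x s) + ((a + + 3 * c) * y s + (b + + 3 * d) * x s)
          v≈ = +-cong (k*-cong (+ 3) u≈) (+-cong (*-cong (second a c e g a≈ c≈) ≈-refl) (*-cong (second b d f h b≈ d≈) ≈-refl))

      turn-y : ∀ s → y (run (turn X Y) s) ≈ - x s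
      turn-y s = y (run (turn X Y) s) ≡⟪ cong proj₁ (turn-yx X Y s) ⟫
        a * u s + c * (+ 3 * u s + v s) ≈⟨ +-cong (k*-cong a (u≈ s)) (k*-cong c (v≈ s)) ⟩
        _ ≡⟪ eq a b c d (x s) (y s) ⟫ - ((a * d - b * c) * x s)
          ≡⟪ cong -_ (trans (cong (_* x s) (det-product X)) (ℤ.*-identityˡ (x s))) ⟫ - x s ∎′
        where
        eq : ∀ a b c d x y → a * (- c * y + - d * x) + c * (+ 3 * (- c * y + - d * x) + ((a + + 3 * c) * y + (b + + 3 * d) * x))
             ≡ - ((a * d - b * c) * x)
        eq = solve-∀

      turn-x : ∀ s → x (run (turn X Y) s) ≈ y s
      turn-x s = x (run (turn X Y) s) ≡⟪ cong proj₂ (turn-yx X Y s) ⟫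
        b * u s + d * (+ 3 * u s + v s) ≈⟨ +-cong (k*-cong b (u≈ s)) (k*-cong d (v≈ s)) ⟩
        _ ≡⟪ eq a b c d (x s) (y s) ⟫ (a * d - b * c) * y s
          ≡⟪ trans (cong (_* y s) (det-product X)) (ℤ.*-identityˡ (y s)) ⟫ y s ∎′
        where
        eq : ∀ a b c d x y → b * (- c * y + - d * x) + d * (+ 3 * (- c * y + - d * x) + ((a + + 3 * c) * y + (b + + 3 * d) * x))
             ≡ (a * d - b * c) * y
        eq = solve-∀

    r-stable : ∀ {p} → All Unimodular p → ∀ {s} → x s ≈ 0ℤ → y s ≈ 0ℤ → r (run p s) ≈ r s
    r-stable []       x≈ y≈ = ≈-refl
    r-stable (step ∷ us)   {s} x≈ y≈ = ≈-trans (r-stable us (+-cong y≈ x≈) (+-cong {0ℤ} ≈-refl y≈)) (≡⇒≈ (ℤ.+-identityˡ (r s)))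
    r-stable (spokeA ∷ us) {s} x≈ y≈ = ≈-trans (r-stable us (+-cong x≈ (≈-refl {0ℤ})) (+-cong y≈ x≈))
      (r s + x s ≈⟨ +-cong (≈-refl {r s}) x≈ ⟩ r s + 0ℤ ≡⟪ ℤ.+-identityʳ (r s) ⟫ r s ∎′)
    r-stable (spokeB ∷ us) {s} x≈ y≈ = ≈-trans (r-stable us (+-cong x≈ (≈-refl {0ℤ})) (+-cong y≈ x≈)) (≡⇒≈ (ℤ.+-identityʳ (r s)))

    -- A unimodular word changes r by a linear function of (x, y). On opposite inputs the two
    -- changes cancel, although neither of them is known.
    r-opposite : ∀ {p} → All Unimodular p → ∀ s s′ → x s + x s′ ≈ 0ℤ → y s + y s′ ≈ 0ℤ →
      r (run p s) + r (run p s′) ≈ r s + r s′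
    r-opposite {p} us s s′ x≈ y≈ = ≈-trans (≡⇒≈ (sym (cong r (run-⊕ p s s′)))) (r-stable us x≈ y≈)

  -- Chosen to follow the vector (y, x) = (2, 3) through the block: the prelude gives (7, 5) and the
  -- first turn (-5, 7); the interlude produces (-7, -5), the negative of what entered that turn,
  -- and adds 1 to r; the second turn gives (5, -7), which the postlude sends to (0, -1).
  prelude interlude postlude : List Op
  prelude   = step ∷ spokeB ∷ []
  interlude = step ∷ spokeB ∷ spokeA ∷ step ∷ step ∷ step ∷ spokeA ∷ step ∷ step ∷ spokeB ∷ []
  postlude  = step ∷ spokeB ∷ spokeA ∷ step ∷ spokeB ∷ []

  block : List Bool → List Bool → List Op
  block X Y = prelude ++ turn X Y ++ interlude ++ turn X Y ++ postlude

  block-unimodular : ∀ X Y → All Unimodular (block X Y)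
  block-unimodular X Y = step ∷ spokeB ∷ All.++⁺ (turn-unimodular X Y)
    (step ∷ spokeB ∷ spokeA ∷ step ∷ step ∷ step ∷ spokeA ∷ step ∷ step ∷ spokeB ∷
     All.++⁺ (turn-unimodular X Y) (step ∷ spokeB ∷ spokeA ∷ step ∷ spokeB ∷ []))

  prelude-y : ∀ s → y (run prelude s) ≡ + 2 * y s + x s
  prelude-y s@(⟨ x , y , r , w , t ⟩) = trans (cong State.y (expand prelude s)) (eq x y r w t)
    where
    eq : ∀ x y r w t → x * + 1 + (y * + 2 + (r * + 0 + (w * + 0 + t * + 0))) ≡ + 2 * y + x
    eq = solve-∀

  prelude-x : ∀ s → x (run prelude s) ≡ y s + x s
  prelude-x s@(⟨ x , y , r , w , t ⟩) = trans (cong State.x (expand prelude s)) (eq x y r w t)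
    where
    eq : ∀ x y r w t → x * + 1 + (y * + 1 + (r * + 0 + (w * + 0 + t * + 0))) ≡ y + x
    eq = solve-∀

  interlude-y : ∀ s → y (run interlude s) ≡ + 49 * y s + + 34 * x s
  interlude-y s@(⟨ x , y , r , w , t ⟩) = trans (cong State.y (expand interlude s)) (eq x y r w t)
    where
    eq : ∀ x y r w t → x * + 34 + (y * + 49 + (r * + 0 + (w * + 0 + t * + 0))) ≡ + 49 * y + + 34 * x
    eq = solve-∀

  interlude-x : ∀ s → x (run interlude s) ≡ + 36 * y s + + 25 * x s
  interlude-x s@(⟨ x , y , r , w , t ⟩) = trans (cong State.x (expand interlude s)) (eq x y r w t)
    where
    eq : ∀ x y r w t → x * + 25 + (y * + 36 + (r * + 0 + (w * + 0 + t * + 0))) ≡ + 36 * y + + 25 * x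
    eq = solve-∀

  interlude-r : ∀ s → r (run interlude s) ≡ r s + (+ 11 * y s + + 8 * x s)
  interlude-r s@(⟨ x , y , r , w , t ⟩) = trans (cong State.r (expand interlude s)) (eq x y r w t)
    where
    eq : ∀ x y r w t → x * + 8 + (y * + 11 + (r * + 1 + (w * + 0 + t * + 0))) ≡ r + (+ 11 * y + + 8 * x)
    eq = solve-∀

  postlude-y : ∀ s → y (run postlude s) ≡ + 7 * y s + + 5 * x s
  postlude-y s@(⟨ x , y , r , w , t ⟩) = trans (cong State.y (expand postlude s)) (eq x y r w t)
    where
    eq : ∀ x y r w t → x * + 5 + (y * + 7 + (r * + 0 + (w * + 0 + t * + 0))) ≡ + 7 * y + + 5 * x
    eq = solve-∀

  postlude-x : ∀ s → x (run postlude s) ≡ + 4 * y s + + 3 * x s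
  postlude-x s@(⟨ x , y , r , w , t ⟩) = trans (cong State.x (expand postlude s)) (eq x y r w t)
    where
    eq : ∀ x y r w t → x * + 3 + (y * + 4 + (r * + 0 + (w * + 0 + t * + 0))) ≡ + 4 * y + + 3 * x
    eq = solve-∀

  postlude-r : ∀ s → r (run postlude s) ≡ r s + (y s + x s)
  postlude-r s@(⟨ x , y , r , w , t ⟩) = trans (cong State.r (expand postlude s)) (eq x y r w t)
    where
    eq : ∀ x y r w t → x * + 1 + (y * + 1 + (r * + 1 + (w * + 0 + t * + 0))) ≡ r + (y + x)
    eq = solve-∀

  -- On (x, y) both programs have the eigenvector (3, 2) with eigenvalue 36 and send (1, 1) to (1,
  -- 1) + d (3, 2), where d is 14 or 15. The determinant 36 = 9 · 4 comes from one `pend₃` and one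
  -- `pend₂`.
  digit : Bool → List Op
  digit false = pend₃ ∷ step ∷ spokeB ∷ pend₂ ∷ step ∷ []
  digit true  = pend₃ ∷ step ∷ step ∷ step ∷ step ∷ step ∷ pend₂ ∷ []

  digits : List Bool → List Op
  digits []       = []
  digits (b ∷ bs) = digits bs ++ digit b

  digitValue : Bool → ℕ
  digitValue false = 14
  digitValue true  = 15

  value : List Bool → ℕ
  value []       = 0
  value (b ∷ bs) = 36 ℕ.* value bs ℕ.+ digitValue b

  -- The number ξ is stored along the common eigenvector of the digits: (x, y) is u times (1, 1) + ξ
  -- (3, 2), and (w, t) is v times the same vector. Here u and v are the y and t inherited from the
  -- preceding chains.
  register : ℤ → ℤ → ℤ → State
  register u v ξ = ⟨ u * (1ℤ + + 3 * ξ) , u * (1ℤ + + 2 * ξ) , 0ℤ , v * (1ℤ + + 3 * ξ) , v * (1ℤ + + 2 * ξ) ⟩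

  open-register : ∀ s → run (new ∷ spokeB ∷ []) s ≡ register (y s) (t s) 0ℤ
  open-register ⟨ x , y , r , w , t ⟩ = cong₅ (e₁ y) (e₂ y) refl (e₁ t) (e₂ t)
    where
    e₁ : ∀ y → y + 0ℤ ≡ y * (1ℤ + + 3 * 0ℤ)
    e₁ = solve-∀
    e₂ : ∀ y → 0ℤ + y ≡ y * (1ℤ + + 2 * 0ℤ)
    e₂ = solve-∀

  digit-register : ∀ b u v ξ → run (digit b) (register u v ξ) ≡ register u v (+ 36 * ξ + + digitValue b)
  digit-register false u v ξ = trans (expand (digit false) (register u v ξ))
    (cong₅ (e₁ u v ξ) (e₂ u v ξ) (e₃ u v ξ) (e₄ u v ξ) (e₅ u v ξ))
    where
    e₁ : ∀ u v ξ → u * (1ℤ + + 3 * ξ) * + 22 + (u * (1ℤ + + 2 * ξ) * + 21 + (0ℤ * + 0 + (v * (1ℤ + + 3 * ξ) * + 0 + v * (1ℤ + + 2 * ξ) * + 0)))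
         ≡ u * (1ℤ + + 3 * (+ 36 * ξ + + 14))
    e₁ = solve-∀
    e₂ : ∀ u v ξ → u * (1ℤ + + 3 * ξ) * + 14 + (u * (1ℤ + + 2 * ξ) * + 15 + (0ℤ * + 0 + (v * (1ℤ + + 3 * ξ) * + 0 + v * (1ℤ + + 2 * ξ) * + 0)))
         ≡ u * (1ℤ + + 2 * (+ 36 * ξ + + 14))
    e₂ = solve-∀
    e₃ : ∀ u v ξ → u * (1ℤ + + 3 * ξ) * + 0 + (u * (1ℤ + + 2 * ξ) * + 0 + (0ℤ * + 6 + (v * (1ℤ + + 3 * ξ) * + 0 + v * (1ℤ + + 2 * ξ) * + 0)))
         ≡ 0ℤ
    e₃ = solve-∀
    e₄ : ∀ u v ξ → u * (1ℤ + + 3 * ξ) * + 0 + (u * (1ℤ + + 2 * ξ) * + 0 + (0ℤ * + 0 + (v * (1ℤ + + 3 * ξ) * + 22 + v * (1ℤ + + 2 * ξ) * + 21)))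
         ≡ v * (1ℤ + + 3 * (+ 36 * ξ + + 14))
    e₄ = solve-∀
    e₅ : ∀ u v ξ → u * (1ℤ + + 3 * ξ) * + 0 + (u * (1ℤ + + 2 * ξ) * + 0 + (0ℤ * + 0 + (v * (1ℤ + + 3 * ξ) * + 14 + v * (1ℤ + + 2 * ξ) * + 15)))
         ≡ v * (1ℤ + + 2 * (+ 36 * ξ + + 14))
    e₅ = solve-∀
  digit-register true u v ξ = trans (expand (digit true) (register u v ξ))
    (cong₅ (e₁ u v ξ) (e₂ u v ξ) (e₃ u v ξ) (e₄ u v ξ) (e₅ u v ξ))
    where
    e₁ : ∀ u v ξ → u * (1ℤ + + 3 * ξ) * + 16 + (u * (1ℤ + + 2 * ξ) * + 30 + (0ℤ * + 0 + (v * (1ℤ + + 3 * ξ) * + 0 + v * (1ℤ + + 2 * ξ) * + 0)))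
         ≡ u * (1ℤ + + 3 * (+ 36 * ξ + + 15))
    e₁ = solve-∀
    e₂ : ∀ u v ξ → u * (1ℤ + + 3 * ξ) * + 10 + (u * (1ℤ + + 2 * ξ) * + 21 + (0ℤ * + 0 + (v * (1ℤ + + 3 * ξ) * + 0 + v * (1ℤ + + 2 * ξ) * + 0)))
         ≡ u * (1ℤ + + 2 * (+ 36 * ξ + + 15))
    e₂ = solve-∀
    e₃ : ∀ u v ξ → u * (1ℤ + + 3 * ξ) * + 0 + (u * (1ℤ + + 2 * ξ) * + 0 + (0ℤ * + 6 + (v * (1ℤ + + 3 * ξ) * + 0 + v * (1ℤ + + 2 * ξ) * + 0)))
         ≡ 0ℤ
    e₃ = solve-∀
    e₄ : ∀ u v ξ → u * (1ℤ + + 3 * ξ) * + 0 + (u * (1ℤ + + 2 * ξ) * + 0 + (0ℤ * + 0 + (v * (1ℤ + + 3 * ξ) * + 16 + v * (1ℤ + + 2 * ξ) * + 30)))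
         ≡ v * (1ℤ + + 3 * (+ 36 * ξ + + 15))
    e₄ = solve-∀
    e₅ : ∀ u v ξ → u * (1ℤ + + 3 * ξ) * + 0 + (u * (1ℤ + + 2 * ξ) * + 0 + (0ℤ * + 0 + (v * (1ℤ + + 3 * ξ) * + 10 + v * (1ℤ + + 2 * ξ) * + 21)))
         ≡ v * (1ℤ + + 2 * (+ 36 * ξ + + 15))
    e₅ = solve-∀

  digits-register : ∀ bs u v → run (digits bs) (register u v 0ℤ) ≡ register u v (+ value bs)
  digits-register []       u v = refl
  digits-register (b ∷ bs) u v = begin
    run (digits bs ++ digit b) (register u v 0ℤ)        ≡⟨ run-++ (digits bs) (digit b) _ ⟩
    run (digit b) (run (digits bs) (register u v 0ℤ))   ≡⟨ cong (run (digit b)) (digits-register bs u v) ⟩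
    run (digit b) (register u v (+ value bs))           ≡⟨ digit-register b u v (+ value bs) ⟩
    register u v (+ 36 * + value bs + + digitValue b)   ≡⟨ cong (λ ξ → register u v (ξ + + digitValue b)) (ℤ.pos-* 36 (value bs)) ⟨
    register u v (+ value (b ∷ bs))                     ∎
    where open ≡-Reasoning

  chain : List Bool → List Bool → List Bool → List Op
  chain X Y bs = new ∷ spokeB ∷ digits bs ++ block X Y

  chains : List Bool → List Bool → List (List Bool) → List Op
  chains X Y []         = []
  chains X Y (bs ∷ bss) = chain X Y bs ++ chains X Y bss

  chain-run : ∀ X Y bs s → run (chain X Y bs) s ≡ run (block X Y) (register (y s) (t s) (+ value bs))
  chain-run X Y bs s = trans (run-++ (digits bs) (block X Y) (run (new ∷ spokeB ∷ []) s))
    (cong (run (block X Y)) (trans (cong (run (digits bs)) (open-register s)) (digits-register bs (y s) (t s))))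

  total : List (List Bool) → ℕ
  total bss = sum (map value bss)

  alternating : ℕ → ℤ
  alternating zero    = 1ℤ
  alternating (suc m) = - alternating m

  -- The block modulo n as a reset

  module _ (n : ℤ) where
    open Congruence n

    module Block (X Y : List Bool) (branch : Branching X Y) where
      open Turn X Y branch

      module Stages (s : State) where
        s₁ s₂ s₃ s₄ s₅ : State
        s₁ = run prelude s
        s₂ = run (turn X Y) s₁
        s₃ = run interlude s₂
        s₄ = run (turn X Y) s₃
        s₅ = run postlude s₄

        block-stages : run (block X Y) s ≡ s₅
        block-stages = trans (run-++ (turn X Y) (interlude ++ turn X Y ++ postlude) s₁) (trans (run-++ interlude (turn X Y ++ postlude) s₂) (run-++ (turn X Y) postlude s₃))

        y₃ : y s₃ ≈ + 49 * - x s₁ + + 34 * y s₁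
        y₃ = y s₃ ≡⟪ interlude-y s₂ ⟫ _ ≈⟨ +-cong (k*-cong (+ 49) (turn-y s₁)) (k*-cong (+ 34) (turn-x s₁)) ⟩ _ ∎′

        x₃ : x s₃ ≈ + 36 * - x s₁ + + 25 * y s₁
        x₃ = x s₃ ≡⟪ interlude-x s₂ ⟫ _ ≈⟨ +-cong (k*-cong (+ 36) (turn-y s₁)) (k*-cong (+ 25) (turn-x s₁)) ⟩ _ ∎′

        y₄ : y s₄ ≈ - (+ 36 * - x s₁ + + 25 * y s₁)
        y₄ = ≈-trans (turn-y s₃) (neg-cong x₃)

        x₄ : x s₄ ≈ + 49 * - x s₁ + + 34 * y s₁
        x₄ = ≈-trans (turn-x s₃) y₃

      block-y : ∀ s → y (run (block X Y) s) ≈ + 2 * x s - + 3 * y s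
      block-y s = y (run (block X Y) s)   ≡⟪ trans (cong y block-stages) (postlude-y s₄) ⟫
        + 7 * y s₄ + + 5 * x s₄           ≈⟨ +-cong (k*-cong (+ 7) y₄) (k*-cong (+ 5) x₄) ⟩
        _                                 ≡⟪ trans (cong₂ mixture (prelude-x s) (prelude-y s)) (eq (x s) (y s)) ⟫
        + 2 * x s - + 3 * y s             ∎′
        where
        open Stages s
        mixture : ℤ → ℤ → ℤ
        mixture x y = + 7 * - (+ 36 * - x + + 25 * y) + + 5 * (+ 49 * - x + + 34 * y)
        eq : ∀ x y → + 7 * - (+ 36 * - (y + x) + + 25 * (+ 2 * y + x)) + + 5 * (+ 49 * - (y + x) + + 34 * (+ 2 * y + x)) ≡ + 2 * x - + 3 * y
        eq = solve-∀

      block-x : ∀ s → x (run (block X Y) s) ≈ y s - x s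
      block-x s = x (run (block X Y) s)   ≡⟪ trans (cong x block-stages) (postlude-x s₄) ⟫
        + 4 * y s₄ + + 3 * x s₄           ≈⟨ +-cong (k*-cong (+ 4) y₄) (k*-cong (+ 3) x₄) ⟩
        _                                 ≡⟪ trans (cong₂ mixture (prelude-x s) (prelude-y s)) (eq (x s) (y s)) ⟫
        y s - x s                         ∎′
        where
        open Stages s
        mixture : ℤ → ℤ → ℤ
        mixture x y = + 4 * - (+ 36 * - x + + 25 * y) + + 3 * (+ 49 * - x + + 34 * y)
        eq : ∀ x y → + 4 * - (+ 36 * - (y + x) + + 25 * (+ 2 * y + x)) + + 3 * (+ 49 * - (y + x) + + 34 * (+ 2 * y + x)) ≡ y - x
        eq = solve-∀

      start : State
      start = ⟨ + 3 , + 2 , 0ℤ , 0ℤ , 0ℤ ⟩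

      -- Modulo n the second turn acts on the negative of the first one's input, so the
      -- unknown change of r is cancelled.
      block-start-r : r (run (block X Y) start) ≈ -1ℤ
      block-start-r = r (run (block X Y) start)   ≡⟪ trans (cong r block-stages) (postlude-r s₄) ⟫
        r s₄ + (y s₄ + x s₄)                      ≈⟨ +-cong r₄ (+-cong y₄ x₄) ⟩
        -1ℤ                                       ∎′
        where
        open Stages start
        opposite : r s₄ + r s₂ ≈ r s₃ + 0ℤ
        opposite = r-opposite (turn-unimodular X Y) s₃ s₁ (+-cong x₃ (≈-refl {+ 5})) (+-cong y₃ (≈-refl {+ 7}))
        r₃ : r s₃ ≈ r s₂ + 1ℤ
        r₃ = r s₃ ≡⟪ interlude-r s₂ ⟫ _ ≈⟨ +-cong (≈-refl {r s₂}) (+-cong (k*-cong (+ 11) (turn-y s₁)) (k*-cong (+ 8) (turn-x s₁))) ⟩ _ ∎′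
        e₁ : ∀ a b → a ≡ (a + b) - b
        e₁ = solve-∀
        e₂ : ∀ b → b + 1ℤ + 0ℤ - b ≡ 1ℤ
        e₂ = solve-∀
        r₄ : r s₄ ≈ 1ℤ
        r₄ = r s₄                   ≡⟪ e₁ (r s₄) (r s₂) ⟫
          r s₄ + r s₂ - r s₂        ≈⟨ +-cong (≈-trans opposite (+-cong r₃ (≈-refl {0ℤ}))) (≈-refl { - r s₂}) ⟩
          r s₂ + 1ℤ + 0ℤ - r s₂     ≡⟪ e₂ (r s₂) ⟫
          1ℤ                        ∎′

      -- The change of t inside a turn is unknown, but `form` vanishes at `start` and hence after
      -- the block. With x ≈ -1, y ≈ 0 and r ≈ -1 it becomes an equation for t with a unit
      -- coefficient, and w drops out.
      block-start-t : t (run (block X Y) start) ≈ 1ℤ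
      block-start-t = t s′          ≡⟪ e₁ (x s′) (y s′) (r s′) (w s′) (t s′) ⟫
        _                           ≡⟪ cong (λ z → r s′ * r s′ + y s′ * - w s′ + (x s′ + 1ℤ) * t s′ - z) (form-invariant (block-unimodular X Y) start) ⟫
        _                           ≈⟨ +-cong (+-cong (+-cong (*-cong block-start-r block-start-r) (*-cong (block-y start) (≈-refl { - w s′})))
                                         (*-cong (+-cong (block-x start) (≈-refl {1ℤ})) (≈-refl {t s′}))) (≈-refl { - 0ℤ}) ⟩
        1ℤ + 0ℤ * - w s′ + 0ℤ * t s′ - 0ℤ  ≡⟪ e₂ (w s′) (t s′) ⟫
        1ℤ                          ∎′
        where
        s′ = run (block X Y) start
        e₁ : ∀ x y r w t → t ≡ r * r + y * - w + (x + 1ℤ) * t - (x * t - y * w + r * r)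
        e₁ = solve-∀
        e₂ : ∀ w t → 1ℤ + 0ℤ * - w + 0ℤ * t - 0ℤ ≡ 1ℤ
        e₂ = solve-∀

      ones : State
      ones = ⟨ 1ℤ , 1ℤ , 0ℤ , 0ℤ , 0ℤ ⟩

      offset : ℤ
      offset = t (run (block X Y) ones)

      block-shifted-t : ∀ a b → t (run (block X Y) ⟨ 0ℤ , 0ℤ , 0ℤ , a , b ⟩) ≈ + 2 * a - + 3 * b
      block-shifted-t a b = ≈-trans (≡⇒≈ (Shifted.t≡y shifted)) (block-y ⟨ a , b , 0ℤ , 0ℤ , 0ℤ ⟩)
        where
        shifted = shifted-run (block-unimodular X Y)
          {⟨ 0ℤ , 0ℤ , 0ℤ , a , b ⟩} {⟨ a , b , 0ℤ , 0ℤ , 0ℤ ⟩}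
          (record { x≡0 = refl ; y≡0 = refl ; r≡0 = refl ; w≡x = refl ; t≡y = refl })

      -- The functional 2 x - 3 y of `block-y` vanishes on (3, 2), the direction that stores ξ, and
      -- takes the value -1 on (1, 1).
      register-y : ∀ u v ξ → y (run (block X Y) (register u v ξ)) ≈ - u
      register-y u v ξ = ≈-trans (block-y (register u v ξ)) (≡⇒≈ (eq u ξ))
        where
        eq : ∀ u ξ → + 2 * (u * (1ℤ + + 3 * ξ)) - + 3 * (u * (1ℤ + + 2 * ξ)) ≡ - u
        eq = solve-∀

      -- The register is split into u times `ones`, u ξ times `start` and the (w, t) part. The first
      -- contributes the unknown `offset`, which depends on neither u, v nor ξ; the second has t ≈
      -- 1; the third behaves like the (x, y) part in `register-y`.
      register-t : ∀ u v ξ → t (run (block X Y) (register u v ξ)) ≈ u * (offset + ξ) - v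
      register-t u v ξ = t (run p (register u v ξ))
          ≡⟪ cong (λ s → t (run p s)) (cong₅ (d₁ u ξ) (d₂ u ξ) (d₃ u ξ) (d₄ u v ξ) (d₅ u v ξ)) ⟫
        t (run p (u · ones ⊕ ((u * ξ) · start ⊕ rest)))
          ≡⟪ cong t (trans (run-⊕ p (u · ones) ((u * ξ) · start ⊕ rest)) (cong₂ _⊕_ (run-· p u ones) (trans (run-⊕ p ((u * ξ) · start) rest) (cong (_⊕ run p rest) (run-· p (u * ξ) start))))) ⟫
        u * offset + (u * ξ * t (run p start) + t (run p rest))
          ≈⟨ +-cong (≈-refl {u * offset}) (+-cong (k*-cong (u * ξ) block-start-t) (block-shifted-t a b)) ⟩
        u * offset + (u * ξ * 1ℤ + (+ 2 * a - + 3 * b))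
          ≡⟪ eq u v ξ offset ⟫
        u * (offset + ξ) - v ∎′
        where
        p = block X Y
        a = v * (1ℤ + + 3 * ξ)
        b = v * (1ℤ + + 2 * ξ)
        rest = ⟨ 0ℤ , 0ℤ , 0ℤ , a , b ⟩
        d₁ : ∀ u ξ → u * (1ℤ + + 3 * ξ) ≡ u * 1ℤ + (u * ξ * + 3 + 0ℤ)
        d₁ = solve-∀
        d₂ : ∀ u ξ → u * (1ℤ + + 2 * ξ) ≡ u * 1ℤ + (u * ξ * + 2 + 0ℤ)
        d₂ = solve-∀
        d₃ : ∀ u ξ → 0ℤ ≡ u * 0ℤ + (u * ξ * 0ℤ + 0ℤ)
        d₃ = solve-∀
        d₄ : ∀ u v ξ → v * (1ℤ + + 3 * ξ) ≡ u * 0ℤ + (u * ξ * 0ℤ + v * (1ℤ + + 3 * ξ))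
        d₄ = solve-∀
        d₅ : ∀ u v ξ → v * (1ℤ + + 2 * ξ) ≡ u * 0ℤ + (u * ξ * 0ℤ + v * (1ℤ + + 2 * ξ))
        d₅ = solve-∀
        eq : ∀ u v ξ β → u * β + (u * ξ * 1ℤ + (+ 2 * (v * (1ℤ + + 3 * ξ)) - + 3 * (v * (1ℤ + + 2 * ξ)))) ≡ u * (β + ξ) - v
        eq = solve-∀

      -- As y becomes - y, the quotient t / y drops by `offset` + ξ with every chain; the sign of y
      -- accumulates in `alternating`.
      chains-t : ∀ bss s → t (run (chains X Y bss) s) ≈
        alternating (length bss) * (t s - y s * (+ length bss * offset + + total bss))
      chains-t []         s = ≡⇒≈ (eq (t s) (y s) offset)
        where
        eq : ∀ t y β → t ≡ 1ℤ * (t - y * (0ℤ * β + 0ℤ))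
        eq = solve-∀
      chains-t (bs ∷ bss) s = t (run (chain X Y bs ++ chains X Y bss) s)
          ≡⟪ cong t (trans (run-++ (chain X Y bs) (chains X Y bss) s) (cong (run (chains X Y bss)) (chain-run X Y bs s))) ⟫
        t (run (chains X Y bss) s′)
          ≈⟨ chains-t bss s′ ⟩
        σ * (t s′ - y s′ * k)
          ≈⟨ k*-cong σ (+-cong (register-t (y s) (t s) (+ value bs)) (neg-cong (*-cong (register-y (y s) (t s) (+ value bs)) (≈-refl {k})))) ⟩
        σ * (y s * (offset + + value bs) - t s - - y s * k)
          ≡⟪ eq σ (t s) (y s) (+ length bss) offset (+ value bs) (+ total bss) ⟫
        - σ * (t s - y s * (+ length (bs ∷ bss) * offset + + total (bs ∷ bss))) ∎′
        where
        s′ = run (block X Y) (register (y s) (t s) (+ value bs))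
        σ = alternating (length bss)
        k = + length bss * offset + + total bss
        eq : ∀ σ t y m β ξ κ → σ * (y * (β + ξ) - t - - y * (m * β + κ)) ≡ - σ * (t - y * ((1ℤ + m) * β + (ξ + κ)))
        eq = solve-∀

open Gadgets

open import Data.Fin using (Fin; toℕ; combine; remQuot)
open import Data.Integer as ℤ using (ℤ; +_; 0ℤ; 1ℤ; -1ℤ; _-_; -_)
open import Data.Integer.DivMod using (_%ℕ_; _/ℕ_; n%ℕd<d; a≡a%ℕn+[a/ℕn]*n)
open import Data.Integer.Divisibility using (_∣_)
open import Data.Integer.Divisibility.Signed using (∣⇒∣ᵤ; divides)
open import Data.Integer.Tactic.RingSolver using (solve-∀)
open import Data.Nat using (ℕ; _≤_; _*_; _+_)
open import Data.Nat.DivMod using (_/_; _%_; m≡m%n+[m/n]*n; m%n<n; m<n*o⇒m/o<n)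
open import Data.Nat.ListAction using (sum)
open import Data.Nat.ListAction.Properties using (sum-++)
open import Data.Nat.Logarithm using (⌊log₂_⌋; ⌊log₂⌋-mono-≤; ⌊log₂[2^n]⌋≡n)
open import Data.Nat.Tactic.RingSolver using () renaming (solve-∀ to solveℕ-∀)

-- Residues as sums of registers

extend : ℕ → List (List Bool) → List (List Bool)
extend d       []         = []
extend zero    (bs ∷ bss) = (false ∷ bs) ∷ extend zero bss
extend (suc d) (bs ∷ bss) = (true ∷ bs) ∷ extend d bss

extend-length : ∀ d bss → length (extend d bss) ≡ length bss
extend-length d       []         = refl
extend-length zero    (bs ∷ bss) = cong suc (extend-length zero bss)
extend-length (suc d) (bs ∷ bss) = cong suc (extend-length d bss)

extend-lengths : ∀ {n} d {bss} → All (λ bs → length bs ≡ n) bss → All (λ bs → length bs ≡ suc n) (extend d bss)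
extend-lengths d       []       = []
extend-lengths zero    (h ∷ hs) = cong suc h ∷ extend-lengths zero hs
extend-lengths (suc d) (h ∷ hs) = cong suc h ∷ extend-lengths d hs

-- The new digit is the least significant one: 15 in the first d registers and 14 in the others. So
-- every register contributes 14 and d of them one more.
extend-total : ∀ d bss → d ≤ length bss → total (extend d bss) ≡ 36 * total bss + 14 * length bss + d
extend-total zero    []         z≤n = refl
extend-total zero    (bs ∷ bss) z≤n = trans (cong (ℕ._+_ (value (false ∷ bs))) (extend-total zero bss z≤n))
  (eq (value bs) (total bss) (length bss))
  where
  eq : ∀ v w l → 36 * v + 14 + (36 * w + 14 * l + 0) ≡ 36 * (v + w) + 14 * (1 + l) + 0
  eq = solveℕ-∀
extend-total (suc d) (bs ∷ bss) (s≤s d≤) = trans (cong (ℕ._+_ (value (true ∷ bs))) (extend-total d bss d≤))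
  (eq (value bs) (total bss) (length bss) d)
  where
  eq : ∀ v w l d → 36 * v + 15 + (36 * w + 14 * l + d) ≡ 36 * (v + w) + 14 * (1 + l) + (1 + d)
  eq = solveℕ-∀

-- The sum reached when all 35 registers have only digits 14; the constant is 35 · 14.
leastTotal : ℕ → ℕ
leastTotal zero    = 0
leastTotal (suc n) = 36 * leastTotal n + 490

-- 35 registers with digits 14 and 15 in base 36 together realise every digit 490 + d, 0 ≤ d ≤ 35.
total-surjective : ∀ n e → e < 36 ^ n →
  ∃[ bss ] length bss ≡ 35 × All (λ bs → length bs ≡ n) bss × total bss ≡ leastTotal n + e
total-surjective zero    zero    _          = replicate 35 [] , refl , All.replicate⁺ 35 refl , refl
total-surjective zero    (suc e) (s≤s ())
total-surjective (suc n) e       e< = append (total-surjective n (e / 36) (m<n*o⇒m/o<n (subst (e <_) (ℕ.*-comm 36 (36 ^ n)) e<)))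
  where
  open ≡-Reasoning
  eq : ∀ k q d → 36 * (k + q) + 490 + d ≡ 36 * k + 490 + (d + q * 36)
  eq = solveℕ-∀
  append : (∃[ bss ] length bss ≡ 35 × All (λ bs → length bs ≡ n) bss × total bss ≡ leastTotal n + e / 36) →
    ∃[ bss ] length bss ≡ 35 × All (λ bs → length bs ≡ suc n) bss × total bss ≡ leastTotal (suc n) + e
  append (bss , l≡ , ls , t≡) = extend d bss , trans (extend-length d bss) l≡ , extend-lengths d ls , (begin
    total (extend d bss)                          ≡⟨ extend-total d bss (subst (d ≤_) (sym l≡) (ℕ.≤-pred (m%n<n e 36))) ⟩
    36 * total bss + 14 * length bss + d          ≡⟨ cong₂ (λ a b → 36 * a + 14 * b + d) t≡ l≡ ⟩
    36 * (leastTotal n + e / 36) + 490 + d        ≡⟨ eq (leastTotal n) (e / 36) d ⟩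
    36 * leastTotal n + 490 + (d + e / 36 * 36)   ≡⟨ cong (ℕ._+_ (36 * leastTotal n + 490)) (m≡m%n+[m/n]*n e 36) ⟨
    36 * leastTotal n + 490 + e                   ∎)
    where
    d = e % 36

-- Two words with the same product modulo N

bit : Fin 2 → Bool
bit Fin.zero    = false
bit (Fin.suc _) = true

bit-injective : ∀ {i j} → bit i ≡ bit j → i ≡ j
bit-injective {Fin.zero}           {Fin.zero}           _ = refl
bit-injective {Fin.suc Fin.zero}   {Fin.suc Fin.zero}   _ = refl

word : ∀ l → Fin (2 ^ l) → List Bool
word zero    _ = []
word (suc l) i = bit (proj₁ (remQuot (2 ^ l) i)) ∷ word l (proj₂ (remQuot {2} (2 ^ l) i))

word-length : ∀ l i → length (word l i) ≡ l
word-length zero    _ = refl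
word-length (suc l) i = cong suc (word-length l _)

word-injective : ∀ l {i j} → word l i ≡ word l j → i ≡ j
word-injective zero    {Fin.zero} {Fin.zero} _ = refl
word-injective (suc l) {i} {j} eq with ∷-injective eq
... | eq₁ , eq₂ = trans (sym (Fin.combine-remQuot {2} (2 ^ l) i))
  (trans (cong₂ combine (bit-injective eq₁) (word-injective l eq₂)) (Fin.combine-remQuot {2} (2 ^ l) j))

module _ (N : ℕ) .{{_ : NonZero N}} where
  open Congruence (+ N)

  ≈-residue : ∀ a → a ≈ + (a %ℕ N)
  ≈-residue a = (a /ℕ N) because a≡a%ℕn+[a/ℕn]*n a N

  residue : ℤ → Fin N
  residue a = fromℕ< (n%ℕd<d a N)

  residue-≈ : ∀ {a b} → residue a ≡ residue b → a ≈ b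
  residue-≈ {a} {b} eq = ≈-trans (≈-residue a) (≈-trans (≡⇒≈ (cong +_ same)) (≈-sym (≈-residue b)))
    where
    same : a %ℕ N ≡ b %ℕ N
    same = trans (sym (Fin.toℕ-fromℕ< (n%ℕd<d a N))) (trans (cong toℕ eq) (Fin.toℕ-fromℕ< (n%ℕd<d b N)))

  residues : Matrix → Fin (N * (N * (N * N)))
  residues (mat a b c d) = combine (residue a) (combine (residue b) (combine (residue c) (residue d)))

  residues-≈ : ∀ {M M′} → residues M ≡ residues M′ → M ≈ᴹ M′
  residues-≈ {mat a b c d} {mat a′ b′ c′ d′} eq
    with Fin.combine-injective (residue a) _ (residue a′) _ eq
  ... | eqa , eq₁ with Fin.combine-injective (residue b) _ (residue b′) _ eq₁
  ...   | eqb , eq₂ with Fin.combine-injective (residue c) _ (residue c′) _ eq₂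
  ...     | eqc , eqd = mat≈ (residue-≈ eqa) (residue-≈ eqb) (residue-≈ eqc) (residue-≈ eqd)

  ≈ᴹ-sym : ∀ {M M′} → M ≈ᴹ M′ → M′ ≈ᴹ M
  ≈ᴹ-sym (mat≈ a≈ b≈ c≈ d≈) = mat≈ (≈-sym a≈) (≈-sym b≈) (≈-sym c≈) (≈-sym d≈)

  -- Common first letters are cancelled until the words differ. Their lengths being equal, neither
  -- can be a proper prefix of the other, so a position with different letters is reached.
  branching : ∀ l us vs → length us ≡ l → length vs ≡ l → us ≢ vs → product us ≈ᴹ product vs →
    ∃₂ λ X Y → Branching X Y × length X ≤ l × length Y ≤ l
  branching zero    []           []           _  _  us≢vs _  = ⊥-elim (us≢vs refl)
  branching (suc l) (false ∷ us) (true ∷ vs)  lu lv _     M≈ =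
    us , vs , M≈ , ℕ.≤-trans (ℕ.n≤1+n _) (ℕ.≤-reflexive lu) , ℕ.≤-trans (ℕ.n≤1+n _) (ℕ.≤-reflexive lv)
  branching (suc l) (true ∷ us)  (false ∷ vs) lu lv _     M≈ =
    vs , us , ≈ᴹ-sym M≈ , ℕ.≤-trans (ℕ.n≤1+n _) (ℕ.≤-reflexive lv) , ℕ.≤-trans (ℕ.n≤1+n _) (ℕ.≤-reflexive lu)
  branching (suc l) (false ∷ us) (false ∷ vs) lu lv us≢vs M≈
    with X , Y , branch , X≤ , Y≤ ← branching l us vs (ℕ.suc-injective lu) (ℕ.suc-injective lv) (us≢vs ∘ cong (false ∷_)) (letter-cancel false M≈) =
    X , Y , branch , ℕ.m≤n⇒m≤1+n X≤ , ℕ.m≤n⇒m≤1+n Y≤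
  branching (suc l) (true ∷ us)  (true ∷ vs)  lu lv us≢vs M≈
    with X , Y , branch , X≤ , Y≤ ← branching l us vs (ℕ.suc-injective lu) (ℕ.suc-injective lv) (us≢vs ∘ cong (true ∷_)) (letter-cancel true M≈) =
    X , Y , branch , ℕ.m≤n⇒m≤1+n X≤ , ℕ.m≤n⇒m≤1+n Y≤

  branching-exists : ∀ l → N * (N * (N * N)) < 2 ^ l → ∃₂ λ X Y → Branching X Y × length X ≤ l × length Y ≤ l
  branching-exists l N⁴< with Fin.pigeonhole N⁴< (residues ∘ product ∘ word l)
  ... | i , j , i<j , eq = branching l (word l i) (word l j) (word-length l i) (word-length l j)
    (λ eq′ → Fin.<⇒≢ i<j (word-injective l eq′)) (residues-≈ eq)

-- Numbers of vertices

weight : Op → ℕ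
weight new    = 1
weight step   = 1
weight spokeA = 0
weight spokeB = 0
weight pend₂  = 1
weight pend₃  = 2

vertices : List Op → ℕ
vertices p = sum (map weight p)

size-vertices : ∀ k p → size k p ≡ k + vertices p
size-vertices k []           = sym (ℕ.+-identityʳ k)
size-vertices k (new ∷ p)    = trans (size-vertices (suc k) p) (sym (ℕ.+-suc k _))
size-vertices k (step ∷ p)   = trans (size-vertices (suc k) p) (sym (ℕ.+-suc k _))
size-vertices k (spokeA ∷ p) = size-vertices k p
size-vertices k (spokeB ∷ p) = size-vertices k p
size-vertices k (pend₂ ∷ p)  = trans (size-vertices (suc k) p) (sym (ℕ.+-suc k _))
size-vertices k (pend₃ ∷ p)  = trans (size-vertices (suc (suc k)) p) (trans (cong suc (sym (ℕ.+-suc k _))) (sym (ℕ.+-suc k _)))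

vertices-++ : ∀ p q → vertices (p ++ q) ≡ vertices p + vertices q
vertices-++ p q = trans (cong sum (map-++ weight p q)) (sum-++ (map weight p) (map weight q))

vertices-++-≤ : ∀ {p q a b} → vertices p ≤ a → vertices q ≤ b → vertices (p ++ q) ≤ a + b
vertices-++-≤ {p} {q} p≤ q≤ = ℕ.≤-trans (ℕ.≤-reflexive (vertices-++ p q)) (ℕ.+-mono-≤ p≤ q≤)

letter-vertices : ∀ c → vertices (letter c) ≤ 2
letter-vertices false = s≤s z≤n
letter-vertices true  = s≤s (s≤s z≤n)

forward-vertices : ∀ cs → vertices (forward cs) ≤ length cs * 2
forward-vertices []       = z≤n
forward-vertices (c ∷ cs) = ℕ.≤-trans (vertices-++-≤ {forward cs} {letter c} (forward-vertices cs) (letter-vertices c))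
  (ℕ.≤-reflexive (ℕ.+-comm (length cs * 2) 2))

backward-vertices : ∀ cs → vertices (backward cs) ≤ length cs * 2
backward-vertices []       = z≤n
backward-vertices (c ∷ cs) = vertices-++-≤ {letter c} {backward cs} (letter-vertices c) (backward-vertices cs)

turn-vertices : ∀ {l} X Y → length X ≤ l → length Y ≤ l → vertices (turn X Y) ≤ l * 2 + (3 + l * 2)
turn-vertices X Y X≤ Y≤ = vertices-++-≤ {forward Y} (ℕ.≤-trans (forward-vertices Y) (ℕ.*-monoˡ-≤ 2 Y≤))
  (ℕ.+-monoʳ-≤ 3 (ℕ.≤-trans (backward-vertices X) (ℕ.*-monoˡ-≤ 2 X≤)))

-- Two turns with at most 4 l + 3 vertices each, together with 1, 6 and 2 steps in the prelude,
-- interlude and postlude.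
block-vertices : ∀ {l} X Y → length X ≤ l → length Y ≤ l → vertices (block X Y) ≤ 8 * l + 15
block-vertices {l} X Y X≤ Y≤ = ℕ.≤-trans
  (ℕ.+-monoʳ-≤ 1 (vertices-++-≤ {turn X Y} (turn-vertices X Y X≤ Y≤)
    (ℕ.+-monoʳ-≤ 6 (vertices-++-≤ {turn X Y} {postlude} (turn-vertices X Y X≤ Y≤) (ℕ.≤-refl {2})))))
  (ℕ.≤-reflexive (eq l))
  where
  eq : ∀ l → 1 + (l * 2 + (3 + l * 2) + (6 + (l * 2 + (3 + l * 2) + 2))) ≡ 8 * l + 15
  eq = solveℕ-∀

digit-vertices : ∀ b → vertices (digit b) ≤ 8
digit-vertices false = ℕ.m≤m+n 5 3
digit-vertices true  = ℕ.≤-refl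

digits-vertices : ∀ bs → vertices (digits bs) ≤ length bs * 8
digits-vertices []       = z≤n
digits-vertices (b ∷ bs) = ℕ.≤-trans (vertices-++-≤ {digits bs} {digit b} (digits-vertices bs) (digit-vertices b))
  (ℕ.≤-reflexive (ℕ.+-comm (length bs * 8) 8))

chain-vertices : ∀ {l n} X Y bs → length X ≤ l → length Y ≤ l → length bs ≡ n →
  vertices (chain X Y bs) ≤ 1 + (n * 8 + (8 * l + 15))
chain-vertices X Y bs X≤ Y≤ refl = ℕ.+-monoʳ-≤ 1 (vertices-++-≤ {digits bs} (digits-vertices bs) (block-vertices X Y X≤ Y≤))

chains-vertices : ∀ {l n} X Y bss → length X ≤ l → length Y ≤ l → All (λ bs → length bs ≡ n) bss →
  vertices (chains X Y bss) ≤ length bss * (1 + (n * 8 + (8 * l + 15)))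
chains-vertices X Y []         X≤ Y≤ []       = z≤n
chains-vertices X Y (bs ∷ bss) X≤ Y≤ (h ∷ hs) =
  vertices-++-≤ {chain X Y bs} (chain-vertices X Y bs X≤ Y≤ h) (chains-vertices X Y bss X≤ Y≤ hs)

-- No vertex is joined twice to the same hub

letter-safe : ∀ c → Safe (letter c)
letter-safe false s = step (spokeB s)
letter-safe true  s = step (step (spokeB (spokeA s)))

forward-safe : ∀ cs → Safe (forward cs)
forward-safe []       s = s
forward-safe (c ∷ cs) = safe-++ {forward cs} {letter c} (forward-safe cs) (letter-safe c)

backward-safe : ∀ cs → Safe (backward cs)
backward-safe []       s = s
backward-safe (c ∷ cs) = safe-++ {letter c} {backward cs} (letter-safe c) (backward-safe cs)

turn-safe : ∀ X Y → Safe (turn X Y)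
turn-safe X Y = safe-++ {forward Y} (forward-safe Y) (λ s → step (step (step (backward-safe X s))))

block-safe : ∀ X Y → Safe (block X Y)
block-safe X Y s = step (spokeB (safe-++ {turn X Y} (turn-safe X Y) (λ s → step (spokeB (spokeA (step (step (step
  (spokeA (step (step (spokeB (safe-++ {turn X Y} {postlude} (turn-safe X Y)
    (λ s → step (spokeB (spokeA (step (spokeB s))))) s))))))))))) s))

digit-safe : ∀ b → Safe (digit b)
digit-safe false s = pend₃ (step (spokeB (pend₂ (step s))))
digit-safe true  s = pend₃ (step (step (step (step (step (pend₂ s))))))

digits-safe : ∀ bs → Safe (digits bs)
digits-safe []       s = s
digits-safe (b ∷ bs) = safe-++ {digits bs} {digit b} (digits-safe bs) (digit-safe b)

chain-safe : ∀ X Y bs → Safe (chain X Y bs)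
chain-safe X Y bs s = new (spokeB (safe-++ {digits bs} (digits-safe bs) (block-safe X Y) s))

chains-safe : ∀ X Y bss → Safe (chains X Y bss)
chains-safe X Y []         s = s
chains-safe X Y (bs ∷ bss) = safe-++ {chain X Y bs} {chains X Y bss} (chain-safe X Y bs) (chains-safe X Y bss)

-- Two isolated hubs with the current vertex at B.
hubs : State
hubs = basis A|Bc

program-graph : ∀ p → Simple false false p → Σ SimpleGraph λ G → Planar G × n G ≡ 3 + vertices p ×
  ∃[ k ] NumSpanningTrees G k × + k ≡ State.t (run (new ∷ p) hubs)
program-graph p simple = layoutGraph 0<H es distinct kinds , planeDrawing 0<H es distinct kinds , refl ,
  count M es id ,
  numSpanningTrees M es (edge-ordered 0<H es distinct kinds) (edge-bounded 0<H es distinct kinds) distinct (s≤s z≤n) ,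
  trans (cong (λ n → + count n es id) (sym size≡M)) (counts (new ∷ p) 1 2 A|Bc initial)
  where
  H : ℕ
  H = 2 + vertices p
  lower : ℕ → Bool
  lower = lowers 3 p
  open Layout H lower
  0<H : 0 < H
  0<H = s≤s z≤n
  es : List Edge
  es = edges 2 3 p
  size≡M : size 3 p ≡ M
  size≡M = size-vertices 3 p
  front : Front H lower 2 3 p
  front = record
    { 2≤c = ℕ.≤-refl ; c<k = ℕ.≤-refl ; size≤M = ℕ.≤-reflexive size≡M ; upper-c = lowers-old 3 p ℕ.≤-refl
    ; behind = λ 2<z z<3 → ⊥-elim (ℕ.<-irrefl refl (ℕ.<-≤-trans 2<z (ℕ.≤-pred z<3))) ; ahead = λ _ → refl }
  kinds : All Kind es
  kinds = edges-kind H lower 2 3 p front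
  distinct : ∀ i j → List.lookup es i ≡ List.lookup es j → i ≡ j
  distinct = lookup-injective (edges-unique ℕ.≤-refl ℕ.≤-refl simple)
  initial : Ready 1 2 A|Bc id
  initial = record
    { 1<k = ℕ.≤-refl ; c<k = ℕ.≤-refl ; pattern′ = refl , λ () ; small = λ z<2 → z<2 ; fresh = λ _ → refl
    ; attached = λ { {0} _ → inj₁ refl ; {1} _ → inj₂ (inj₁ refl) ; {suc (suc _)} (s≤s (s≤s ())) } }

-- Assembling the graph and its size bound

<2^suc-log : ∀ N → N < 2 ^ suc ⌊log₂ N ⌋
<2^suc-log N = ℕ.≰⇒> λ 2^≤N → ℕ.1+n≰n (ℕ.≤-trans (ℕ.≤-reflexive (sym (⌊log₂[2^n]⌋≡n (suc ⌊log₂ N ⌋)))) (⌊log₂⌋-mono-≤ 2^≤N))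

module _ (N : ℕ) (2≤N : 2 ≤ N) where

  private
    K : ℕ
    K = suc ⌊log₂ N ⌋

    instance
      N-nonZero : NonZero N
      N-nonZero = ℕ.>-nonZero (ℕ.<⇒≤ 2≤N)

  open Congruence (+ N)

  ≈⇒∣ : ∀ {a b} → a ≈ b → + N ∣ (a - b)
  ≈⇒∣ {b = b} (q because refl) = ∣⇒∣ᵤ (divides q (eq b q (+ N)))
    where
    eq : ∀ b q n → b ℤ.+ q ℤ.* n - b ≡ q ℤ.* n
    eq = solve-∀

  N⁴<2^ : N * (N * (N * N)) < 2 ^ (K * 4)
  N⁴<2^ = ℕ.<-≤-trans (ℕ.*-mono-< N< (ℕ.*-mono-< N< (ℕ.*-mono-< N< N<)))
    (ℕ.≤-reflexive (trans (cong (λ z → 2 ^ K * (2 ^ K * (2 ^ K * z))) (sym (ℕ.*-identityʳ (2 ^ K)))) (ℕ.^-*-assoc 2 K 4)))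
    where
    N< = <2^suc-log N

  module _ {X Y : List Bool} (branch : Branching X Y) where
    open Block (+ N) X Y branch

    chains-≈ : ∀ u → ∃[ bss ] length bss ≡ 35 × All (λ bs → length bs ≡ K) bss ×
      State.t (run (chains X Y bss) hubs) ≈ u
    chains-≈ u = reach (total-surjective K e (ℕ.<-≤-trans (n%ℕd<d a N) (ℕ.≤-trans (ℕ.<⇒≤ (<2^suc-log N)) (ℕ.^-monoˡ-≤ K (ℕ.m≤m+n 2 34)))))
      where
      -- From the hubs, where y = 1 and t = 0, an odd number of chains yields 35 β + total. Since
      -- total = `leastTotal` + e, this residue is what e must supply; it is admissible because N <
      -- 2 ^ K ≤ 36 ^ K.
      a = u - (+ 35 ℤ.* offset ℤ.+ + leastTotal K)
      e = a %ℕ N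
      eq : ∀ u β k → -1ℤ ℤ.* (0ℤ - 1ℤ ℤ.* (+ 35 ℤ.* β ℤ.+ (k ℤ.+ (u - (+ 35 ℤ.* β ℤ.+ k))))) ≡ u
      eq = solve-∀
      reach : (∃[ bss ] length bss ≡ 35 × All (λ bs → length bs ≡ K) bss × total bss ≡ leastTotal K + e) →
        ∃[ bss ] length bss ≡ 35 × All (λ bs → length bs ≡ K) bss × State.t (run (chains X Y bss) hubs) ≈ u
      reach (bss , l≡ , ls , t≡) = bss , l≡ , ls , (
        State.t (run (chains X Y bss) hubs)
          ≈⟨ chains-t bss hubs ⟩
        alternating (length bss) ℤ.* (0ℤ - 1ℤ ℤ.* (+ length bss ℤ.* offset ℤ.+ + total bss))
          ≡⟪ cong₂ (λ l k → alternating l ℤ.* (0ℤ - 1ℤ ℤ.* (+ l ℤ.* offset ℤ.+ + k))) l≡ t≡ ⟫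
        -1ℤ ℤ.* (0ℤ - 1ℤ ℤ.* (+ 35 ℤ.* offset ℤ.+ (+ leastTotal K ℤ.+ + e)))
          ≈⟨ k*-cong -1ℤ (+-cong (≈-refl {0ℤ}) (neg-cong (k*-cong 1ℤ (+-cong (≈-refl {+ 35 ℤ.* offset})
               (+-cong (≈-refl {+ leastTotal K}) (≈-sym (≈-residue N a))))))) ⟩
        -1ℤ ℤ.* (0ℤ - 1ℤ ℤ.* (+ 35 ℤ.* offset ℤ.+ (+ leastTotal K ℤ.+ a)))
          ≡⟪ eq u offset (+ leastTotal K) ⟫
        u ∎′)

  chains-size : ∀ X Y bss → length bss ≡ 35 → All (λ bs → length bs ≡ K) bss → length X ≤ K * 4 → length Y ≤ K * 4 →
    2 + vertices (chains X Y bss) ≤ 3362 * ⌊log₂ N ⌋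
  chains-size X Y bss l≡ ls X≤ Y≤ = begin
    2 + vertices (chains X Y bss)          ≤⟨ ℕ.+-monoʳ-≤ 2 (chains-vertices X Y bss X≤ Y≤ ls) ⟩
    2 + length bss * c                     ≡⟨ cong (λ l → 2 + l * c) {length bss} {35} l≡ ⟩
    2 + 35 * c                             ≡⟨ eq ⌊log₂ N ⌋ ⟩
    -- The constant part is 2 + 35 · 56 = 1962. As N ≥ 2, the logarithm is at least 1 and absorbs
    -- it.
    1962 * 1 + 1400 * ⌊log₂ N ⌋            ≤⟨ ℕ.+-monoˡ-≤ (1400 * ⌊log₂ N ⌋) (ℕ.*-monoʳ-≤ 1962 (⌊log₂⌋-mono-≤ 2≤N)) ⟩
    1962 * ⌊log₂ N ⌋ + 1400 * ⌊log₂ N ⌋    ≡⟨ ℕ.*-distribʳ-+ ⌊log₂ N ⌋ 1962 1400 ⟨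
    3362 * ⌊log₂ N ⌋                         ∎
    where
    open ℕ.≤-Reasoning
    c = 1 + (K * 8 + (8 * (K * 4) + 15))
    eq : ∀ k → 2 + 35 * (1 + ((1 + k) * 8 + (8 * ((1 + k) * 4) + 15))) ≡ 1962 * 1 + 1400 * k
    eq = solveℕ-∀

  chains-graph : ∀ X Y bss → length bss ≡ 35 → All (λ bs → length bs ≡ K) bss → length X ≤ K * 4 → length Y ≤ K * 4 →
    Σ SimpleGraph λ G → Planar G × n G ≤ 3362 * ⌊log₂ N ⌋ ×
      ∃[ k ] NumSpanningTrees G k × + k ≡ State.t (run (chains X Y bss) hubs)
  -- There is at least one chain, so the program begins with a `new`; it is peeled off here because
  -- `program-graph` supplies it.
  chains-graph X Y bss@(bs ∷ bss′) l≡ ls X≤ Y≤ =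
    let G , planar , n≡ , trees = program-graph p (tail (safe⇒simple {chains X Y bss} {false} {false} (chains-safe X Y bss)))
    in G , planar , ℕ.≤-trans (ℕ.≤-reflexive n≡) (chains-size X Y bss l≡ ls X≤ Y≤) , trees
    where
    p : List Op
    p = spokeB ∷ (digits bs ++ block X Y) ++ chains X Y bss′
    tail : ∀ {p} → Simple false false (new ∷ p) → Simple false false p
    tail (new simple) = simple

theorem1p3 : ∃[ C ] (1 ≤ C) × (∀ (N : ℕ) → 2 ≤ N → (u : Fin N) →
    Σ SimpleGraph λ G → Planar G × (n G ≤ C * ⌊log₂ N ⌋) ×
    (∃[ k ] NumSpanningTrees G k × ((+ N) ∣ ((+ k) - (+ toℕ u)))))
theorem1p3 = 3362 , s≤s z≤n , λ N 2≤N u →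
  let X , Y , branch , X≤ , Y≤ = branching-exists N {{ℕ.>-nonZero (ℕ.<⇒≤ 2≤N)}} (suc ⌊log₂ N ⌋ * 4) (N⁴<2^ N 2≤N)
      bss , l≡ , ls , t≈ = chains-≈ N 2≤N branch (+ toℕ u)
      G , planar , n≤ , k , trees , k≡ = chains-graph N 2≤N X Y bss l≡ ls X≤ Y≤
  in G , planar , n≤ , k , trees , ≈⇒∣ N 2≤N (subst (λ z → Congruence._≈_ (+ N) z (+ toℕ u)) (sym k≡) t≈)
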